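{- For all $k$-tuples of partitions $\boldsymbol\lambda,\boldsymbol\mu$ (regarded as having $\ell$ parts, with $\ell$ at least the number of nonzero parts of every component of $\boldsymbol\lambda,\boldsymbol\mu,\boldsymbol\lambda',\boldsymbol\mu'$) and all $n,m\ge0$, $$\mathcal L^S_{\boldsymbol\lambda/\boldsymbol\mu}(X_n;Y_m;t)=t^{g(\boldsymbol\lambda)-g(\boldsymbol\mu)}\,\mathcal L^S_{\boldsymbol\lambda'/\boldsymbol\mu'}(Y_m;X_n;t^{ -1}).$$
   Context: Fix an integer $k\ge1$ (colours $1,\dots,k$) and an indeterminate $t$. For $\mathbf I\in\{0,1\}^k$ let $|\mathbf I|=\sum_cI_c$, and for $\mathbf I,\mathbf J\in\mathbb Z^k$ let $\varphi(\mathbf I,\mathbf J)=\sum_{1\le c<d\le k}I_cJ_d$. A vertex is a unit square whose bottom, left, top, right edges carry labels $\mathbf I,\mathbf J,\mathbf K,\mathbf L\in\{0,1\}^k$; $I_c=1$ means a path of colour $c$ uses that edge (paths move up and right). White weight: $W_x(\mathbf I,\mathbf J,\mathbf K,\mathbf L)=\mathbf 1_{\mathbf I+\mathbf J=\mathbf K+\mathbf L}\prod_c\mathbf 1_{I_c+J_c\ne2}\,x^{|\mathbf L|}t^{\varphi(\mathbf L,\mathbf I+\mathbf J)}$; purple weight: $P_x(\mathbf I,\mathbf J,\mathbf K,\mathbf L)=\mathbf 1_{\mathbf I+\mathbf J=\mathbf K+\mathbf L}\prod_c\mathbf 1_{K_c\ge J_c}\,x^{|\mathbf L|}t^{\varphi(\mathbf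 L,\mathbf K-\mathbf J)}$. For $k$-tuples of partitions $\boldsymbol\lambda,\boldsymbol\mu$ with $\ell$ parts and variables $X_n,Y_m$, consider the lattice with $n+m$ rows and columns $-\ell,\dots,N$ ($N$ large): rows $1,\dots,n$ from the bottom are white with parameters $x_1,\dots,x_n$, rows $n+1,\dots,n+m$ purple with parameters $y_1,\dots,y_m$; the bottom boundary edge of column $c$ carries colour $a$ iff $c=\mu^{(a)}_j-j$ for some $j$, the top boundary edge carries colour $a$ iff $c=\lambda^{(a)}_j-j$ for some $j$, left/right boundaries empty. $\mathcal L^S_{\boldsymbol\lambda/\boldsymbol\mu}(X_n;Y_m;t)$ is the sum over labellings of internal edges of the product of vertex weights; $\mathcal L^S_{\boldsymbol\lambda/\boldsymbol\mu}(Y_m;X_n;t)$ is the same with $m$ white rows carrying $y_1,\dots,y_m$ below $n$ purple rows carrying $x_1,\dots,x_n$. Conjugation: $\boldsymbol\lambda'=((\lambda^{(k)})',\dots,(\lambda^{(1)})')$, $\rho'$ the conjugate partition. The function $g$: for $k$-tuples $\boldsymbol\alpha,\boldsymbol\beta$ (with $\ell$ parts) such that $\alpha^{(a)}_1\ge\beta^{(a)}_1\ge\alpha^{(a)}_2\ge\beta^{(a)}_2\ge\cdots$ for all $a$, let $C$ be the configuration of a single white row with bottom boundary $\boldsymbol\beta$, top $\boldsymbol\alpha$, empty left/right boundaries, in which the path of colour $a$ entering at the bottom of column $\beta^{(a)}_j-j$ moves right and exits through the top of column $\alpha^{(a)}_j-j$. A box $b$ of $C$ is good for colours $i<j$ if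 either colour $i$ occupies the right edge of $b$ and colour $j$ occupies some edge of $b$, or colour $i$ occupies no edge of $b$ and colour $j$ occupies the left edge of $b$. Let $\tilde g(\boldsymbol\alpha/\boldsymbol\beta)$ be the number of triples $(b,i,j)$, $i<j$, with $b$ good for $i,j$. For $\boldsymbol\rho$ with $\ell$ parts let $\boldsymbol\beta^r$ ($0\le r\le\ell$) have components $(\rho^{(a)}_{\ell-r+1},\dots,\rho^{(a)}_\ell,0,\dots,0)$, and $g(\boldsymbol\rho)=\sum_{r=1}^\ell\tilde g(\boldsymbol\beta^r/\boldsymbol\beta^{r-1})$. -}

module Defs where

open import Level using (Level)
open import Data.Bool using (Bool; true; false; _∧_; _∨_; not; if_then_else_)
open import Data.Nat using (ℕ; zero; suc; _+_; _*_; _∸_; _≤_; _≡ᵇ_; _<ᵇ_; _≤ᵇ_)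
open import Data.Fin using (Fin; toℕ; opposite)
open import Data.Vec using (Vec; []; _∷_; tabulate; zipWith; toList)
import Data.Vec as V
open import Data.List using (List; []; _∷_; upTo; allFin; map; foldr; _++_; concatMap)
open import Data.Bool.ListAction using (and; or)
import Data.List as L
open import Algebra.Bundles using (CommutativeRing)

b2n : Bool → ℕ
b2n true  = 1
b2n false = 0

sumℕ : List ℕ → ℕ
sumℕ = foldr _+_ 0

-- total lookup in a vector, default 0 (parts beyond ℓ are 0)
nth : ∀ {ℓ} → Vec ℕ ℓ → ℕ → ℕ
nth []       _       = 0
nth (x ∷ xs) zero    = x
nth (x ∷ xs) (suc i) = nth xs i

allVecs : ∀ {a} {A : Set a} → List A → (n : ℕ) → List (Vec A n)
allVecs xs zero    = [] ∷ []
allVecs xs (suc n) = concatMap (λ x → map (x ∷_) (allVecs xs n)) xs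

anyUpTo : ℕ → (ℕ → Bool) → Bool
anyUpTo n f = or (map f (upTo n))

eqVecℕ : ∀ {n} → Vec ℕ n → Vec ℕ n → Bool
eqVecℕ []       []       = true
eqVecℕ (x ∷ xs) (y ∷ ys) = (x ≡ᵇ y) ∧ eqVecℕ xs ys

eqBool : Bool → Bool → Bool
eqBool true  b = b
eqBool false b = not b

eqVecB : ∀ {n} → Vec Bool n → Vec Bool n → Bool
eqVecB []       []       = true
eqVecB (x ∷ xs) (y ∷ ys) = eqBool x y ∧ eqVecB xs ys

-- Partitions with ℓ parts: ρ : Vec ℕ ℓ, entries ρ₁ ≥ ρ₂ ≥ … ≥ ρ_ℓ ≥ 0
-- (0-based: nth ρ i = ρ_{i+1}).

IsPartition : ∀ {ℓ} → Vec ℕ ℓ → Set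
IsPartition ρ = ∀ i → nth ρ (suc i) ≤ nth ρ i

Tuple : ℕ → ℕ → Set
Tuple k ℓ = Fin k → Vec ℕ ℓ

conjP : ∀ {ℓ} → Vec ℕ ℓ → Vec ℕ ℓ
conjP {ℓ} ρ = tabulate (λ i → sumℕ (map (λ j → b2n (suc (toℕ i) ≤ᵇ nth ρ j)) (upTo ℓ)))

conjT : ∀ {k ℓ} → Tuple k ℓ → Tuple k ℓ
conjT λs a = conjP (λs (opposite a))

-- shifted column of the j-th part (0-based i, j = i+1): (ρ_j − j) + ℓ
pos : ∀ {ℓ} → Vec ℕ ℓ → ℕ → ℕ
pos {ℓ} ρ i = nth ρ i + (ℓ ∸ suc i)

-- Edge labels: Label k = Vec Bool k  (entry c true iff colour c uses edge)

Label : ℕ → Set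
Label k = Vec Bool k

labN : ∀ {k} → Label k → Vec ℕ k
labN = V.map b2n

allLabels : (k : ℕ) → List (Label k)
allLabels k = allVecs (true ∷ false ∷ []) k

emptyLabel : ∀ {k} → Label k
emptyLabel = V.replicate _ false

card : ∀ {k} → Label k → ℕ
card L = sumℕ (toList (labN L))

φ : ∀ {k} → Vec ℕ k → Vec ℕ k → ℕ
φ []       []       = 0
φ (i ∷ I)  (j ∷ J)  = i * sumℕ (toList J) + φ I J

-- Ring-valued part (the partition functions are polynomials in x,y,t,t⁻¹;
-- they are evaluated in an arbitrary commutative ring).

module _ {c ℓr : Level} (R : CommutativeRing c ℓr) where
  open CommutativeRing R using (Carrier; 0#; 1#) renaming (_+_ to _+R_; _*_ to _*R_)

  pow : Carrier → ℕ → Carrier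
  pow x zero    = 1#
  pow x (suc n) = x *R pow x n

  sumR : List Carrier → Carrier
  sumR = foldr _+R_ 0#

  VertexWeight : ℕ → Set c
  VertexWeight k = Label k → Label k → Label k → Label k → Carrier

  whiteW : ∀ {k} → Carrier → Carrier → VertexWeight k
  whiteW τ x I J K L =
    if eqVecℕ (zipWith _+_ (labN I) (labN J)) (zipWith _+_ (labN K) (labN L))
       ∧ and (toList (zipWith (λ a b → not (a ∧ b)) I J))
    then pow x (card L) *R pow τ (φ (labN L) (zipWith _+_ (labN I) (labN J)))
    else 0#

  purpleW : ∀ {k} → Carrier → Carrier → VertexWeight k
  purpleW τ x I J K L =
    if eqVecℕ (zipWith _+_ (labN I) (labN J)) (zipWith _+_ (labN K) (labN L))
       ∧ and (toList (zipWith _≤ᵇ_ (labN J) (labN K)))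
    then pow x (card L) *R pow τ (φ (labN L) (zipWith _∸_ (labN K) (labN J)))
    else 0#

  -- weight of one row: sum over labellings of its internal horizontal edges;
  -- h = label of the horizontal edge entering the current vertex from the left;
  -- the right boundary edge must be empty.
  rowWeight : ∀ {k W} → VertexWeight k → Label k → Vec (Label k) W → Vec (Label k) W → Carrier
  rowWeight {k} w h []       []       = if eqVecB h emptyLabel then 1# else 0#
  rowWeight {k} w h (b ∷ bs) (t ∷ ts) =
    sumR (map (λ h' → w b h t h' *R rowWeight w h' bs ts) (allLabels k))

  -- partition function of a stack of rows (listed bottom to top), summing over
  -- the labellings of all internal vertical edges between consecutive rows
  -- (and, via rowWeight, all internal horizontal edges)
  stackWeight : ∀ {k W} → List (VertexWeight k) → Vec (Label k) W → Vec (Label k) W → Carrier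
  stackWeight {k} {W} []       bot top = if eqVecB (V.concat bot) (V.concat top) then 1# else 0#
  stackWeight {k} {W} (r ∷ []) bot top = rowWeight r emptyLabel bot top
  stackWeight {k} {W} (r ∷ rs@(_ ∷ _)) bot top =
    sumR (map (λ s → rowWeight r emptyLabel bot s *R stackWeight rs s top) (allVecs (allLabels k) W))

  -- boundary state of columns −ℓ,…,N (stored at positions p = c + ℓ = 0,…,N+ℓ):
  -- colour a on the edge of column c iff c = ρ^(a)_j − j for some j
  boundary : ∀ {k ℓ} → (N : ℕ) → Tuple k ℓ → Vec (Label k) (suc (N + ℓ))
  boundary {k} {ℓ} N ρs =
    tabulate (λ p → tabulate (λ a → anyUpTo ℓ (λ i → pos (ρs a) i ≡ᵇ toℕ p)))

  LS : ∀ {k ℓ n m} → (N : ℕ) → Tuple k ℓ → Tuple k ℓ →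
       Vec Carrier n → Vec Carrier m → Carrier → Carrier
  LS N λs μs xs ys τ =
    stackWeight (map (whiteW τ) (toList xs) ++ map (purpleW τ) (toList ys))
                (boundary N μs) (boundary N λs)

module _ {k ℓ : ℕ} (α β : Tuple k ℓ) where
  -- single white row, bottom β, top α; positions p = column + ℓ
  botE topE leftE rightE : Fin k → ℕ → Bool
  botE   a p = anyUpTo ℓ (λ i → pos (β a) i ≡ᵇ p)
  topE   a p = anyUpTo ℓ (λ i → pos (α a) i ≡ᵇ p)
  leftE  a p = anyUpTo ℓ (λ i → (pos (β a) i <ᵇ p) ∧ (p ≤ᵇ pos (α a) i))
  rightE a p = anyUpTo ℓ (λ i → (pos (β a) i ≤ᵇ p) ∧ (p <ᵇ pos (α a) i))

  someE : Fin k → ℕ → Bool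
  someE a p = botE a p ∨ topE a p ∨ leftE a p ∨ rightE a p

  good : ℕ → Fin k → Fin k → Bool
  good p i j = (rightE i p ∧ someE j p) ∨ (not (someE i p) ∧ leftE j p)

  -- g̃(α/β): number of triples (box, i, j), i < j, box good for i,j;
  -- boxes in columns −ℓ,…,ℓ (all other boxes are empty)
  gTilde : ℕ
  gTilde = sumℕ (map (λ p → sumℕ (map (λ i → sumℕ (map (λ j →
             b2n ((toℕ i <ᵇ toℕ j) ∧ good p i j)) (allFin k))) (allFin k)))
             (upTo (suc (ℓ + ℓ))))

betaR : ∀ {k ℓ} → Tuple k ℓ → ℕ → Tuple k ℓ
betaR {k} {ℓ} ρs r a =
  tabulate (λ i → if toℕ i <ᵇ r then nth (ρs a) (ℓ ∸ r + toℕ i) else 0)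

gStat : ∀ {k ℓ} → Tuple k ℓ → ℕ
gStat {k} {ℓ} ρs =
  sumℕ (map (λ r → gTilde (betaR ρs (suc r)) (betaR ρs r)) (upTo ℓ))

-- Conjugation complements and reflects the particle positions of a partition, and this turns a white vertex
-- into a purple one with the colours reversed. The exponent of t at a white vertex plus that of t⁻¹ at its dual is
-- the number of good pairs of colours, which is a coboundary: summed over a row it equals Ψ(bottom) − Ψ(top) for an
-- explicit potential Ψ of the boundary configurations. The same identity along the chain β⁰, …, β^ℓ gives
-- g(ρ) = Ψ(∅) − Ψ(ρ), so a stack equals t^(g(λ) − g(μ)) times the dual stack, in which the purple rows are below
-- the white ones. It remains to commute white with purple rows. Instead of an R-matrix, whose entries would have
-- denominators, one uses an eigenvector: with S = A ⊔ B the colours on the two horizontal edges, the weighted sum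
-- over the splittings of S on the one side and the splitting-independence on the other reduce both products to a
-- single row with labels S, and the two one-row weights differ by h(|S|) = ∏_{i<|S|} (y + x tⁱ), which is 1 at the
-- empty boundary.
module Submission where

open import Defs
open import Level using (Level; _⊔_)
open import Data.Bool using (Bool; true; false; _∧_; _∨_; not; if_then_else_)
import Data.Bool as Bool
import Data.Bool.Properties as 𝔹
open import Data.Bool.ListAction using (and; or)
open import Data.Nat using (ℕ; zero; suc; _∸_; _≤_; _≡ᵇ_; _≤ᵇ_; z≤n; s≤s)
import Data.Nat as ℕ
import Data.Nat.Properties as ℕ
import Data.Nat.Solver
open import Algebra.Properties.CommutativeSemigroup ℕ.+-commutativeSemigroup
  using () renaming (interchange to ℕ-interchange)
open import Data.Fin using (Fin; zero; suc; toℕ; opposite; inject₁; fromℕ)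
import Data.Fin.Properties as Fin
open import Data.Vec using (Vec; []; _∷_; _∷ʳ_; zipWith; toList; reverse; replicate; tabulate)
import Data.Vec as V
import Data.Vec.Properties as V
open import Data.List using (List; []; _∷_; map; _++_; concatMap; upTo; allFin)
import Data.List as L
import Data.List.Properties as L
open import Data.List.Relation.Binary.Pointwise using (Pointwise; []; _∷_)
open import Data.List.Relation.Unary.All as All using (All; []; _∷_)
import Data.List.Relation.Unary.All.Properties as All
open import Data.Product using (_×_; _,_; proj₁; proj₂; ∃)
open import Data.Sum as Sum using (_⊎_; inj₁; inj₂; fromInj₂)
open import Data.Empty using (⊥; ⊥-elim)
open import Data.Unit using (tt)
open import Function using (_∘_; id)
open import Function.Bundles using (Equivalence)
open import Relation.Nullary using (yes; no; contradiction)
open import Relation.Binary.PropositionalEquality as ≡ using (_≡_; _≢_)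
open import Algebra.Bundles using (CommutativeRing)
import Algebra.Solver.Ring.NaturalCoefficients.Default as RingSolver

-- Differences such as Ψ(bottom) - Ψ(top) may be negative. Identities between exponents are
-- therefore additive ones in ℕ, and a partition function carries a power of t on either side of an
-- equation. Complementing a configuration turns empty columns into full ones, so duality is exact
-- only in a window of 2ℓ columns. The lattice has N + ℓ + 1 of them; the surplus is removed
-- beforehand, using that conserved paths cannot enter columns through which none of them leaves.
-- The potential exists because the numbers of particles to the left of a column, in the upper and
-- in the lower row, differ exactly by the label of the horizontal edge there. Bilinear expressions
-- in edge labels can thus be rewritten through these counts, up to a term on horizontal edges that
-- telescopes along the row. In the exchange relation the colours interact only through φ. On the
-- support of the weights, conservation reduces this interaction to a few totals over the later
-- colours and one running index q; once these are independent variables, the relation splits into a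
-- polynomial identity for each choice of one-colour labels.

eqVec : ∀ {a} {A : Set a} → (A → A → Bool) → ∀ {n} → Vec A n → Vec A n → Bool
eqVec e []       []       = true
eqVec e (x ∷ xs) (y ∷ ys) = e x y ∧ eqVec e xs ys

-- Finite sums in a commutative ring

module Sums {c ℓr} (R : CommutativeRing c ℓr) where
  open CommutativeRing R
  open import Relation.Binary.Reasoning.Setoid setoid
  open import Algebra.Properties.CommutativeSemigroup +-commutativeSemigroup
    using () renaming (interchange to +-interchange)

  opaque
    ∑ : ∀ {a} {A : Set a} → List A → (A → Carrier) → Carrier
    ∑ xs f = sumR R (map f xs)

  [_] : Bool → Carrier
  [ b ] = if b then 1# else 0#

  []-∧ : ∀ b b' → [ b ∧ b' ] ≈ [ b ] * [ b' ]
  []-∧ true  b' = sym (*-identityˡ _)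
  []-∧ false b' = sym (zeroˡ _)

  -- Many identities between exponents hold only under a conservation or splitting condition P.
  -- Where P fails the weight `w` vanishes, so next to `w` the condition may be assumed.
  absorb : ∀ {p} {P : Set p} {w a b} → w ≈ 0# ⊎ P → (P → a ≈ b) → w * a ≈ w * b
  absorb {w = w} {a} {b} (inj₁ w≈0) _ = begin
    w * a   ≈⟨ *-congʳ w≈0 ⟩
    0# * a  ≈⟨ zeroˡ a ⟩
    0#      ≈⟨ zeroˡ b ⟨
    0# * b  ≈⟨ *-congʳ w≈0 ⟨
    w * b   ∎
  absorb (inj₂ p) eq = *-congˡ (eq p)

  pow-+ : ∀ z m n → pow R z (m ℕ.+ n) ≈ pow R z m * pow R z n
  pow-+ z zero    n = sym (*-identityˡ _)
  pow-+ z (suc m) n = trans (*-congˡ (pow-+ z m n)) (sym (*-assoc _ _ _))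

  pow-inverse : ∀ {z z⁻¹} → z * z⁻¹ ≈ 1# → ∀ n → pow R z n * pow R z⁻¹ n ≈ 1#
  pow-inverse zz⁻¹ zero = *-identityˡ _
  pow-inverse {z} {z⁻¹} zz⁻¹ (suc n) = begin
    (z * pow R z n) * (z⁻¹ * pow R z⁻¹ n)  ≈⟨ *-interchange z _ _ _ ⟩
    (z * z⁻¹) * (pow R z n * pow R z⁻¹ n)  ≈⟨ *-cong zz⁻¹ (pow-inverse zz⁻¹ n) ⟩
    1# * 1#                                ≈⟨ *-identityˡ _ ⟩
    1#                                     ∎
    where
    open import Algebra.Properties.CommutativeSemigroup *-commutativeSemigroup
      using () renaming (interchange to *-interchange)

  private
    variable
      a b : Level
      A : Set a
      B : Set b

  opaque
    unfolding ∑

    ∑-sumR : ∀ (xs : List A) f → ∑ xs f ≡ sumR R (map f xs)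
    ∑-sumR xs f = ≡.refl

    ∑-∷ : ∀ x (xs : List A) f → ∑ (x ∷ xs) f ≈ f x + ∑ xs f
    ∑-∷ x xs f = refl

    ∑-[] : ∀ (f : A → Carrier) → ∑ [] f ≈ 0#
    ∑-[] f = refl

    ∑-cong : ∀ (xs : List A) {f g : A → Carrier} → (∀ x → f x ≈ g x) → ∑ xs f ≈ ∑ xs g
    ∑-cong []       eq = refl
    ∑-cong (x ∷ xs) eq = +-cong (eq x) (∑-cong xs eq)

    ∑-zero : ∀ (xs : List A) → ∑ xs (λ _ → 0#) ≈ 0#
    ∑-zero []       = refl
    ∑-zero (x ∷ xs) = trans (+-identityˡ _) (∑-zero xs)

    ∑-distrib-+ : ∀ (xs : List A) (f g : A → Carrier) → ∑ xs (λ x → f x + g x) ≈ ∑ xs f + ∑ xs g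
    ∑-distrib-+ []       f g = sym (+-identityˡ _)
    ∑-distrib-+ (x ∷ xs) f g = trans (+-congˡ (∑-distrib-+ xs f g)) (+-interchange _ _ _ _)

    *-distribˡ-∑ : ∀ (xs : List A) (f : A → Carrier) y → y * ∑ xs f ≈ ∑ xs (λ x → y * f x)
    *-distribˡ-∑ []       f y = zeroʳ y
    *-distribˡ-∑ (x ∷ xs) f y = trans (distribˡ _ _ _) (+-congˡ (*-distribˡ-∑ xs f y))

    *-distribʳ-∑ : ∀ (xs : List A) (f : A → Carrier) y → ∑ xs f * y ≈ ∑ xs (λ x → f x * y)
    *-distribʳ-∑ []       f y = zeroˡ y
    *-distribʳ-∑ (x ∷ xs) f y = trans (distribʳ _ _ _) (+-congˡ (*-distribʳ-∑ xs f y))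

    ∑-++ : ∀ (xs ys : List A) f → ∑ (xs ++ ys) f ≈ ∑ xs f + ∑ ys f
    ∑-++ []       ys f = sym (+-identityˡ _)
    ∑-++ (x ∷ xs) ys f = trans (+-congˡ (∑-++ xs ys f)) (sym (+-assoc _ _ _))

    ∑-map : ∀ (g : B → A) (xs : List B) f → ∑ (map g xs) f ≈ ∑ xs (λ x → f (g x))
    ∑-map g xs f = reflexive (≡.cong (sumR R) (≡.sym (L.map-∘ xs)))

    ∑-swap : ∀ (xs : List A) (ys : List B) (f : A → B → Carrier) →
      ∑ xs (λ x → ∑ ys (f x)) ≈ ∑ ys (λ y → ∑ xs (λ x → f x y))
    ∑-swap []       ys f = sym (∑-zero ys)
    ∑-swap (x ∷ xs) ys f = trans (+-congˡ (∑-swap xs ys f)) (sym (∑-distrib-+ ys _ _))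

  ∑-allVecs-suc : ∀ {A : Set a} (xs : List A) n (f : Vec A (suc n) → Carrier) →
    ∑ (allVecs xs (suc n)) f ≈ ∑ xs (λ x → ∑ (allVecs xs n) (λ v → f (x ∷ v)))
  ∑-allVecs-suc {A = A} xs n f = go xs
    where
    vs : List (Vec A n)
    vs = allVecs xs n
    go : ∀ ys → ∑ (concatMap (λ x → map (x ∷_) vs) ys) f ≈ ∑ ys (λ x → ∑ vs (λ v → f (x ∷ v)))
    go []       = trans (∑-[] f) (sym (∑-[] _))
    go (y ∷ ys) = begin
      ∑ (map (y ∷_) vs ++ concatMap (λ x → map (x ∷_) vs) ys) f
        ≈⟨ ∑-++ (map (y ∷_) vs) _ f ⟩
      ∑ (map (y ∷_) vs) f + ∑ (concatMap (λ x → map (x ∷_) vs) ys) f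
        ≈⟨ +-cong (∑-map (y ∷_) vs f) (go ys) ⟩
      ∑ vs (λ v → f (y ∷ v)) + ∑ ys (λ x → ∑ vs (λ v → f (x ∷ v)))
        ≈⟨ ∑-∷ y ys _ ⟨
      ∑ (y ∷ ys) (λ x → ∑ vs (λ v → f (x ∷ v))) ∎

  ∑-singleton : ∀ (x : A) f → ∑ (x ∷ []) f ≈ f x
  ∑-singleton x f = trans (∑-∷ x [] f) (trans (+-congˡ (∑-[] f)) (+-identityʳ _))

  ∑-allVecs-++ : ∀ (xs : List A) m n (f : Vec A (m ℕ.+ n) → Carrier) →
    ∑ (allVecs xs (m ℕ.+ n)) f ≈ ∑ (allVecs xs m) (λ v → ∑ (allVecs xs n) (λ w → f (v V.++ w)))
  ∑-allVecs-++ xs zero    n f = sym (∑-singleton [] _)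
  ∑-allVecs-++ xs (suc m) n f = begin
    ∑ (allVecs xs (suc m ℕ.+ n)) f
      ≈⟨ ∑-allVecs-suc xs (m ℕ.+ n) f ⟩
    ∑ xs (λ x → ∑ (allVecs xs (m ℕ.+ n)) (λ v → f (x ∷ v)))
      ≈⟨ ∑-cong xs (λ x → ∑-allVecs-++ xs m n (λ v → f (x ∷ v))) ⟩
    ∑ xs (λ x → ∑ (allVecs xs m) (λ v → ∑ (allVecs xs n) (λ w → f (x ∷ v V.++ w))))
      ≈⟨ ∑-allVecs-suc xs m _ ⟨
    ∑ (allVecs xs (suc m)) (λ v → ∑ (allVecs xs n) (λ w → f (v V.++ w))) ∎

  ∑-allVecs-∷ʳ : ∀ (xs : List A) n (f : Vec A (suc n) → Carrier) →
    ∑ (allVecs xs (suc n)) f ≈ ∑ (allVecs xs n) (λ v → ∑ xs (λ x → f (v ∷ʳ x)))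
  ∑-allVecs-∷ʳ xs zero f = begin
    ∑ (allVecs xs 1) f                ≈⟨ ∑-allVecs-suc xs 0 f ⟩
    ∑ xs (λ x → ∑ ([] ∷ []) λ v → f (x ∷ v))  ≈⟨ ∑-cong xs (λ x → ∑-singleton [] _) ⟩
    ∑ xs (λ x → f (x ∷ []))                   ≈⟨ ∑-singleton [] _ ⟨
    ∑ ([] ∷ []) (λ v → ∑ xs λ x → f (v ∷ʳ x)) ∎
  ∑-allVecs-∷ʳ xs (suc n) f = begin
    ∑ (allVecs xs (suc (suc n))) f
      ≈⟨ ∑-allVecs-suc xs (suc n) f ⟩
    ∑ xs (λ x → ∑ (allVecs xs (suc n)) (λ v → f (x ∷ v)))
      ≈⟨ ∑-cong xs (λ x → ∑-allVecs-∷ʳ xs n (λ v → f (x ∷ v))) ⟩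
    ∑ xs (λ x → ∑ (allVecs xs n) (λ v → ∑ xs (λ y → f (x ∷ (v ∷ʳ y)))))
      ≈⟨ ∑-allVecs-suc xs n _ ⟨
    ∑ (allVecs xs (suc n)) (λ v → ∑ xs (λ x → f (v ∷ʳ x))) ∎

  ∑-allVecs-reverse : ∀ (xs : List A) n (f : Vec A n → Carrier) →
    ∑ (allVecs xs n) (λ v → f (reverse v)) ≈ ∑ (allVecs xs n) f
  ∑-allVecs-reverse xs zero    f = ∑-cong _ λ { [] → refl }
  ∑-allVecs-reverse xs (suc n) f = begin
    ∑ (allVecs xs (suc n)) (λ v → f (reverse v))
      ≈⟨ ∑-allVecs-suc xs n _ ⟩
    ∑ xs (λ x → ∑ (allVecs xs n) (λ v → f (reverse (x ∷ v))))
      ≈⟨ ∑-cong xs (λ x → ∑-cong (allVecs xs n) λ v → reflexive (≡.cong f (V.reverse-∷ x v))) ⟩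
    ∑ xs (λ x → ∑ (allVecs xs n) (λ v → f (reverse v ∷ʳ x)))
      ≈⟨ ∑-cong xs (λ x → ∑-allVecs-reverse xs n (λ v → f (v ∷ʳ x))) ⟩
    ∑ xs (λ x → ∑ (allVecs xs n) (λ v → f (v ∷ʳ x)))
      ≈⟨ ∑-swap xs (allVecs xs n) _ ⟩
    ∑ (allVecs xs n) (λ v → ∑ xs (λ x → f (v ∷ʳ x)))
      ≈⟨ ∑-allVecs-∷ʳ xs n f ⟨
    ∑ (allVecs xs (suc n)) f ∎

  ∑-allVecs-map : ∀ (xs : List A) (π : A → A) →
    (∀ f → ∑ xs (λ x → f (π x)) ≈ ∑ xs f) →
    ∀ n (f : Vec A n → Carrier) → ∑ (allVecs xs n) (λ v → f (V.map π v)) ≈ ∑ (allVecs xs n) f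
  ∑-allVecs-map xs π inv zero    f = ∑-cong _ λ { [] → refl }
  ∑-allVecs-map xs π inv (suc n) f = begin
    ∑ (allVecs xs (suc n)) (λ v → f (V.map π v))
      ≈⟨ ∑-allVecs-suc xs n _ ⟩
    ∑ xs (λ x → ∑ (allVecs xs n) (λ v → f (π x ∷ V.map π v)))
      ≈⟨ ∑-cong xs (λ x → ∑-allVecs-map xs π inv n (λ v → f (π x ∷ v))) ⟩
    ∑ xs (λ x → ∑ (allVecs xs n) (λ v → f (π x ∷ v)))
      ≈⟨ inv (λ x → ∑ (allVecs xs n) (λ v → f (x ∷ v))) ⟩
    ∑ xs (λ x → ∑ (allVecs xs n) (λ v → f (x ∷ v)))
      ≈⟨ ∑-allVecs-suc xs n f ⟨
    ∑ (allVecs xs (suc n)) f ∎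

  -- `e` behaves as a Kronecker delta and `xs` as a list without repetitions of all elements;
  -- testing against every `f` expresses both at once.
  Sifts : {A : Set a} → List A → (A → A → Bool) → Set (a ⊔ c ⊔ ℓr)
  Sifts {A = A} xs e = ∀ y (f : A → Carrier) → ∑ xs (λ x → [ e x y ] * f x) ≈ f y

  ∑-allVecs-sift : ∀ {xs : List A} {e} → Sifts xs e → ∀ n → Sifts (allVecs xs n) (eqVec e)
  ∑-allVecs-sift sift zero [] f = trans (∑-singleton [] _) (*-identityˡ _)
  ∑-allVecs-sift {xs = xs} {e} sift (suc n) (y ∷ ys) f = begin
    ∑ (allVecs xs (suc n)) (λ v → [ eqVec e v (y ∷ ys) ] * f v)
      ≈⟨ ∑-allVecs-suc xs n _ ⟩
    ∑ xs (λ x → ∑ vs (λ v → [ e x y ∧ eqVec e v ys ] * f (x ∷ v)))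
      ≈⟨ ∑-cong xs (λ x → ∑-cong vs λ v → trans (*-congʳ ([]-∧ _ _)) (*-assoc _ _ _)) ⟩
    ∑ xs (λ x → ∑ vs (λ v → [ e x y ] * ([ eqVec e v ys ] * f (x ∷ v))))
      ≈⟨ ∑-cong xs (λ x → *-distribˡ-∑ vs _ _) ⟨
    ∑ xs (λ x → [ e x y ] * ∑ vs (λ v → [ eqVec e v ys ] * f (x ∷ v)))
      ≈⟨ sift y _ ⟩
    ∑ vs (λ v → [ eqVec e v ys ] * f (y ∷ v))
      ≈⟨ ∑-allVecs-sift sift n ys _ ⟩
    f (y ∷ ys) ∎
    where
    vs = allVecs xs n

-- Vertex conditions and exchange identities for a single colour

module ℕS = Data.Nat.Solver.+-*-Solver

true→T : ∀ {b} → b ≡ true → Bool.T b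
true→T = 𝔹.T-≡ .Equivalence.from

T→true : ∀ {b} → Bool.T b → b ≡ true
T→true = 𝔹.T-≡ .Equivalence.to

infixl 6 _⊕_

_⊕_ : ∀ {n} → Vec ℕ n → Vec ℕ n → Vec ℕ n
_⊕_ = zipWith ℕ._+_

total : ∀ {n} → Vec ℕ n → ℕ
total v = sumℕ (toList v)

total-⊕ : ∀ {n} (u v : Vec ℕ n) → total (u ⊕ v) ≡ total u ℕ.+ total v
total-⊕ []      []      = ≡.refl
total-⊕ (a ∷ u) (b ∷ v) = ≡.trans (≡.cong (a ℕ.+ b ℕ.+_) (total-⊕ u v)) (ℕ-interchange a b _ _)

whiteOK purpleOK : Bool → Bool → Bool → Bool → Bool
whiteOK  i j k l = (b2n i ℕ.+ b2n j ≡ᵇ b2n k ℕ.+ b2n l) ∧ not (i ∧ j)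
purpleOK i j k l = (b2n i ℕ.+ b2n j ≡ᵇ b2n k ℕ.+ b2n l) ∧ (b2n j ≤ᵇ b2n k)

allColours : (Bool → Bool → Bool → Bool → Bool) → ∀ {k} → Label k → Label k → Label k → Label k → Bool
allColours p []      []      []      []      = true
allColours p (i ∷ I) (j ∷ J) (k ∷ K) (l ∷ L) = p i j k l ∧ allColours p I J K L

∧-interchange : ∀ a b c d → (a ∧ b) ∧ (c ∧ d) ≡ (a ∧ c) ∧ (b ∧ d)
∧-interchange true  b true  d = ≡.refl
∧-interchange true  b false d = 𝔹.∧-zeroʳ b
∧-interchange false b c     d = ≡.refl

white-cond : ∀ {k} (I J K L : Label k) →
  (eqVecℕ (labN I ⊕ labN J) (labN K ⊕ labN L) ∧ and (toList (zipWith (λ a b → not (a ∧ b)) I J)))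
  ≡ allColours whiteOK I J K L
white-cond []      []      []      []      = ≡.refl
white-cond (i ∷ I) (j ∷ J) (k ∷ K) (l ∷ L) =
  ≡.trans (∧-interchange (b2n i ℕ.+ b2n j ≡ᵇ b2n k ℕ.+ b2n l) _ _ _) (≡.cong (whiteOK i j k l ∧_) (white-cond I J K L))

purple-cond : ∀ {k} (I J K L : Label k) →
  (eqVecℕ (labN I ⊕ labN J) (labN K ⊕ labN L) ∧ and (toList (zipWith _≤ᵇ_ (labN J) (labN K))))
  ≡ allColours purpleOK I J K L
purple-cond []      []      []      []      = ≡.refl
purple-cond (i ∷ I) (j ∷ J) (k ∷ K) (l ∷ L) =
  ≡.trans (∧-interchange (b2n i ℕ.+ b2n j ≡ᵇ b2n k ℕ.+ b2n l) _ _ _) (≡.cong (purpleOK i j k l ∧_) (purple-cond I J K L))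

allColours-conserve : ∀ {p} → (∀ i j k l → p i j k l ≡ true → b2n i ℕ.+ b2n j ≡ b2n k ℕ.+ b2n l) →
  ∀ {k} (I J K L : Label k) → allColours p I J K L ≡ true → labN I ⊕ labN J ≡ labN K ⊕ labN L
allColours-conserve con []      []      []      []      _ = ≡.refl
allColours-conserve {p} con (i ∷ I) (j ∷ J) (k ∷ K) (l ∷ L) ok with p i j k l in eq
... | true = ≡.cong₂ _∷_ (con i j k l eq) (allColours-conserve con I J K L ok)

whiteOK-conserve : ∀ i j k l → whiteOK i j k l ≡ true → b2n i ℕ.+ b2n j ≡ b2n k ℕ.+ b2n l
whiteOK-conserve i j k l ok =
  ℕ.≡ᵇ⇒≡ _ _ (true→T (𝔹.∧-conicalˡ _ _ ok))

purpleOK-conserve : ∀ i j k l → purpleOK i j k l ≡ true → b2n i ℕ.+ b2n j ≡ b2n k ℕ.+ b2n l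
purpleOK-conserve i j k l ok =
  ℕ.≡ᵇ⇒≡ _ _ (true→T (𝔹.∧-conicalˡ _ _ ok))

infixl 6 _⊖_
_⊖_ : ∀ {n} → Vec ℕ n → Vec ℕ n → Vec ℕ n
_⊖_ = zipWith _∸_

-- The purple condition is J ≤ K in every colour, so the truncated subtraction in the weight is
-- exact.
purple-⊖ : ∀ {k} (I J K L : Label k) → allColours purpleOK I J K L ≡ true →
  total (labN K ⊖ labN J) ℕ.+ card J ≡ card K
purple-⊖ []      []      []      []      _ = ≡.refl
purple-⊖ (i ∷ I) (j ∷ J) (k ∷ K) (l ∷ L) ok =
  ≡.trans (ℕ-interchange (b2n k ∸ b2n j) _ _ _) (≡.cong₂ ℕ._+_ (head i j k l (𝔹.∧-conicalˡ _ _ ok))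
    (purple-⊖ I J K L (𝔹.∧-conicalʳ (purpleOK i j k l) _ ok)))
  where
  head : ∀ i j k l → purpleOK i j k l ≡ true → (b2n k ∸ b2n j) ℕ.+ b2n j ≡ b2n k
  head i j k l ok = ℕ.m∸n+n≡m (ℕ.≤ᵇ⇒≤ (b2n j) (b2n k) (true→T (𝔹.∧-conicalʳ (b2n i ℕ.+ b2n j ≡ᵇ b2n k ℕ.+ b2n l) _ ok)))

split : Bool → Bool → Bool → Bool
split s a b = b2n a ℕ.+ b2n b ≡ᵇ b2n s

-- The factors contributed by a single colour to the identities white-then-purple and purple-then-white.
-- They are parametrised by raw operations because the ring solver needs the same expressions as syntax.
module OneColour {a} {C : Set a} (_+_ _*_ : C → C → C) (0# 1# : C) where

  if01 : Bool → C → C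
  if01 b z = if b then z else 0#

  pw : C → Bool → C
  pw z b = if b then z else 1#

  white₁ purple₁ : Bool → Bool → Bool → Bool → C → C
  white₁  i j k l z = if01 (whiteOK i j k l) (pw z l)
  purple₁ i j k l z = if01 (purpleOK i j k l) (pw z l)

  v₁ : C → C → Bool → Bool → Bool → C → C
  v₁ x y s a b X = if01 (split s a b) (pw (x * X) a * pw y b)

  -- Vertices of the merged row, with bottom i, left s, top k and right s′; X and Q are the powers
  -- of τ counting the later colours of S and the earlier colours of S′. A horizontal path with i =
  -- k = 0 is tied to the white edge (on its left in `c₁`, on its right in `d₁`) and weighs `x * X`;
  -- with i = k = 1 it is tied to the purple edge and weighs `y`. The tables differ only at turns:
  -- `c₁` puts `y + (x * (X * Q))` on the turn from horizontal to vertical, `d₁` on the opposite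
  -- one.
  c₁ d₁ : C → C → Bool → Bool → Bool → Bool → C → C → C
  c₁ x y false true  false true  X Q = x * X
  c₁ x y true  true  true  true  X Q = y
  c₁ x y false true  true  false X Q = y + (x * (X * Q))
  c₁ x y true  false false true  X Q = 1#
  c₁ x y true  false true  false X Q = Q
  c₁ x y false false false false X Q = 1#
  c₁ x y _     _     _     _     X Q = 0#
  d₁ x y false true  false true  X Q = x * X
  d₁ x y true  true  true  true  X Q = y
  d₁ x y false true  true  false X Q = 1#
  d₁ x y true  false false true  X Q = y + (x * (X * Q))
  d₁ x y true  false true  false X Q = Q
  d₁ x y false false false false X Q = 1#
  d₁ x y _     _     _     _     X Q = 0#

  sum : (Bool → C) → C
  sum f = f true + (f false + 0#)

  -- In the `wp` pair X, Y, Z, Q stand for powers of τ whose exponents are |S|, |A′| + |B′| and |K -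
  -- B| over the later colours, and the index q. In the `pw` pair Y and Z belong to |A| + |B| and |M
  -- - B|. The factor `pw Z s′` on the right is what raises q by s′ for the later colours.
  wp-lhs wp-rhs pw-lhs pw-rhs : Bool → Bool → Bool → Bool → Bool → C → C → C → C → C → C → C
  wp-lhs i s k a′ b′ x y X Y Z Q = sum λ a → sum λ b → sum λ m →
    v₁ x y s a b X * (white₁ i a m a′ (x * (Z * Y)) * (purple₁ m b k b′ (y * Z) * pw Q (k ∧ not b)))
  wp-rhs i s k a′ b′ x y X Y Z Q = sum λ s′ → c₁ x y i s k s′ X Q * (v₁ x y s′ a′ b′ Y * pw Z s′)
  pw-lhs i a k b s′ x y X Y Z Q = sum λ a′ → sum λ b′ → sum λ m →
    purple₁ i b m b′ (y * Z) * (white₁ m a k a′ (x * (Z * Y)) * (if01 (split s′ a′ b′) 1# * pw Q (m ∧ not b)))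
  pw-rhs i a k b s′ x y X Y Z Q = sum λ s → if01 (split s a b) 1# * (d₁ x y i s k s′ Y Q * pw Z s′)

module OneColourIdentities {c ℓr} (R : CommutativeRing c ℓr) where
  open CommutativeRing R
  open RingSolver commutativeSemiring
  module H = OneColour _+_ _*_ 0# 1#
  module P {n} = OneColour {C = Polynomial n} _:+_ _:*_ (con 0) (con 1)

  WP PW : Bool → Bool → Bool → Bool → Bool → Set _
  WP i s k a′ b′ = ∀ x y X Y Z Q → H.wp-lhs i s k a′ b′ x y X Y Z Q ≈ H.wp-rhs i s k a′ b′ x y X Y Z Q
  PW i a k b s′  = ∀ x y X Y Z Q → H.pw-lhs i a k b s′ x y X Y Z Q ≈ H.pw-rhs i a k b s′ x y X Y Z Q

  wp-syntax pw-syntax : Bool → Bool → Bool → Bool → Bool → (x y X Y Z Q : Polynomial 6) → Polynomial 6 × Polynomial 6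
  wp-syntax i s k a′ b′ x y X Y Z Q = P.wp-lhs i s k a′ b′ x y X Y Z Q := P.wp-rhs i s k a′ b′ x y X Y Z Q
  pw-syntax i a k b s′  x y X Y Z Q = P.pw-lhs i a k b s′ x y X Y Z Q := P.pw-rhs i a k b s′ x y X Y Z Q

  -- The powers of τ have become independent variables, so each choice of labels leaves a polynomial
  -- identity with natural coefficients.
  wp : ∀ i s k a′ b′ → WP i s k a′ b′
  wp true  true  true  true  true  = solve 6 (wp-syntax true  true  true  true  true) refl
  wp true  true  true  true  false = solve 6 (wp-syntax true  true  true  true  false) refl
  wp true  true  true  false true  = solve 6 (wp-syntax true  true  true  false true) refl
  wp true  true  true  false false = solve 6 (wp-syntax true  true  true  false false) refl
  wp true  true  false true  true  = solve 6 (wp-syntax true  true  false true  true) refl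
  wp true  true  false true  false = solve 6 (wp-syntax true  true  false true  false) refl
  wp true  true  false false true  = solve 6 (wp-syntax true  true  false false true) refl
  wp true  true  false false false = solve 6 (wp-syntax true  true  false false false) refl
  wp true  false true  true  true  = solve 6 (wp-syntax true  false true  true  true) refl
  wp true  false true  true  false = solve 6 (wp-syntax true  false true  true  false) refl
  wp true  false true  false true  = solve 6 (wp-syntax true  false true  false true) refl
  wp true  false true  false false = solve 6 (wp-syntax true  false true  false false) refl
  wp true  false false true  true  = solve 6 (wp-syntax true  false false true  true) refl
  wp true  false false true  false = solve 6 (wp-syntax true  false false true  false) refl
  wp true  false false false true  = solve 6 (wp-syntax true  false false false true) refl
  wp true  false false false false = solve 6 (wp-syntax true  false false false false) refl
  wp false true  true  true  true  = solve 6 (wp-syntax false true  true  true  true) refl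
  wp false true  true  true  false = solve 6 (wp-syntax false true  true  true  false) refl
  wp false true  true  false true  = solve 6 (wp-syntax false true  true  false true) refl
  wp false true  true  false false = solve 6 (wp-syntax false true  true  false false) refl
  wp false true  false true  true  = solve 6 (wp-syntax false true  false true  true) refl
  wp false true  false true  false = solve 6 (wp-syntax false true  false true  false) refl
  wp false true  false false true  = solve 6 (wp-syntax false true  false false true) refl
  wp false true  false false false = solve 6 (wp-syntax false true  false false false) refl
  wp false false true  true  true  = solve 6 (wp-syntax false false true  true  true) refl
  wp false false true  true  false = solve 6 (wp-syntax false false true  true  false) refl
  wp false false true  false true  = solve 6 (wp-syntax false false true  false true) refl
  wp false false true  false false = solve 6 (wp-syntax false false true  false false) refl
  wp false false false true  true  = solve 6 (wp-syntax false false false true  true) refl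
  wp false false false true  false = solve 6 (wp-syntax false false false true  false) refl
  wp false false false false true  = solve 6 (wp-syntax false false false false true) refl
  wp false false false false false = solve 6 (wp-syntax false false false false false) refl

  pw : ∀ i a k b s′ → PW i a k b s′
  pw true  true  true  true  true  = solve 6 (pw-syntax true  true  true  true  true) refl
  pw true  true  true  true  false = solve 6 (pw-syntax true  true  true  true  false) refl
  pw true  true  true  false true  = solve 6 (pw-syntax true  true  true  false true) refl
  pw true  true  true  false false = solve 6 (pw-syntax true  true  true  false false) refl
  pw true  true  false true  true  = solve 6 (pw-syntax true  true  false true  true) refl
  pw true  true  false true  false = solve 6 (pw-syntax true  true  false true  false) refl
  pw true  true  false false true  = solve 6 (pw-syntax true  true  false false true) refl
  pw true  true  false false false = solve 6 (pw-syntax true  true  false false false) refl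
  pw true  false true  true  true  = solve 6 (pw-syntax true  false true  true  true) refl
  pw true  false true  true  false = solve 6 (pw-syntax true  false true  true  false) refl
  pw true  false true  false true  = solve 6 (pw-syntax true  false true  false true) refl
  pw true  false true  false false = solve 6 (pw-syntax true  false true  false false) refl
  pw true  false false true  true  = solve 6 (pw-syntax true  false false true  true) refl
  pw true  false false true  false = solve 6 (pw-syntax true  false false true  false) refl
  pw true  false false false true  = solve 6 (pw-syntax true  false false false true) refl
  pw true  false false false false = solve 6 (pw-syntax true  false false false false) refl
  pw false true  true  true  true  = solve 6 (pw-syntax false true  true  true  true) refl
  pw false true  true  true  false = solve 6 (pw-syntax false true  true  true  false) refl
  pw false true  true  false true  = solve 6 (pw-syntax false true  true  false true) refl
  pw false true  true  false false = solve 6 (pw-syntax false true  true  false false) refl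
  pw false true  false true  true  = solve 6 (pw-syntax false true  false true  true) refl
  pw false true  false true  false = solve 6 (pw-syntax false true  false true  false) refl
  pw false true  false false true  = solve 6 (pw-syntax false true  false false true) refl
  pw false true  false false false = solve 6 (pw-syntax false true  false false false) refl
  pw false false true  true  true  = solve 6 (pw-syntax false false true  true  true) refl
  pw false false true  true  false = solve 6 (pw-syntax false false true  true  false) refl
  pw false false true  false true  = solve 6 (pw-syntax false false true  false true) refl
  pw false false true  false false = solve 6 (pw-syntax false false true  false false) refl
  pw false false false true  true  = solve 6 (pw-syntax false false false true  true) refl
  pw false false false true  false = solve 6 (pw-syntax false false false true  false) refl
  pw false false false false true  = solve 6 (pw-syntax false false false false true) refl
  pw false false false false false = solve 6 (pw-syntax false false false false false) refl

-- The exponent of the white vertex involves |I + A|. Adding the conservation laws of both vertices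
-- eliminates the middle edge M and leaves |K - B| and the outgoing labels, so the power of τ
-- becomes the product of `Z` and `Y`.
white-purple-card : ∀ {k} (I A M A′ B K B′ : Label k) →
  allColours whiteOK I A M A′ ≡ true → allColours purpleOK M B K B′ ≡ true →
  total (labN I ⊕ labN A) ≡ total (labN K ⊖ labN B) ℕ.+ (card A′ ℕ.+ card B′)
white-purple-card I A M A′ B K B′ okW okP = ℕ.+-cancelʳ-≡ (card B) _ _ (begin
    total (labN I ⊕ labN A) ℕ.+ card B                  ≡⟨ ≡.cong (λ u → total u ℕ.+ card B)
                                                             (allColours-conserve whiteOK-conserve I A M A′ okW) ⟩
    total (labN M ⊕ labN A′) ℕ.+ card B                 ≡⟨ ≡.cong (ℕ._+ card B) (total-⊕ (labN M) (labN A′)) ⟩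
    (card M ℕ.+ card A′) ℕ.+ card B                     ≡⟨ ℕS.solve 3 (λ M A′ B → (M ℕS.:+ A′) ℕS.:+ B
                                                             ℕS.:= (M ℕS.:+ B) ℕS.:+ A′) ≡.refl (card M) _ _ ⟩
    (card M ℕ.+ card B) ℕ.+ card A′                     ≡⟨ ≡.cong (ℕ._+ card A′) (total-⊕ (labN M) (labN B)) ⟨
    total (labN M ⊕ labN B) ℕ.+ card A′                 ≡⟨ ≡.cong (λ u → total u ℕ.+ card A′)
                                                             (allColours-conserve purpleOK-conserve M B K B′ okP) ⟩
    total (labN K ⊕ labN B′) ℕ.+ card A′                ≡⟨ ≡.cong (ℕ._+ card A′) (total-⊕ (labN K) (labN B′)) ⟩
    (card K ℕ.+ card B′) ℕ.+ card A′                    ≡⟨ ≡.cong (λ n → (n ℕ.+ card B′) ℕ.+ card A′)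
                                                             (purple-⊖ M B K B′ okP) ⟨
    ((D ℕ.+ card B) ℕ.+ card B′) ℕ.+ card A′          ≡⟨ ℕS.solve 4 (λ D B B′ A′ → ((D ℕS.:+ B) ℕS.:+ B′) ℕS.:+ A′
                                                             ℕS.:= (D ℕS.:+ (A′ ℕS.:+ B′)) ℕS.:+ B) ≡.refl D (card B) _ _ ⟩
    (D ℕ.+ (card A′ ℕ.+ card B′)) ℕ.+ card B          ∎)
  where
  open ≡.≡-Reasoning
  D = total (labN K ⊖ labN B)

-- Vertex weights and label sums, peeled off colour by colour

module Vertex {c ℓr} (R : CommutativeRing c ℓr) where
  open CommutativeRing R
  open import Relation.Binary.Reasoning.Setoid setoid
  open Sums R
  open RingSolver commutativeSemiring
  open OneColour _+_ _*_ 0# 1#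

  weight : Bool → Carrier → ℕ → Carrier → ℕ → Carrier
  weight ok x m τ n = if ok then pow R x m * pow R τ n else 0#

  -- In φ the first colour meets only the total s of the later ones, so it contributes a factor x
  -- τ^s exactly when it uses the right edge.
  weight-∷ : ∀ ok₁ ok l x m τ n s →
    weight (ok₁ ∧ ok) x (b2n l ℕ.+ m) τ (b2n l ℕ.* s ℕ.+ n)
    ≈ if01 ok₁ (pw (x * pow R τ s) l) * weight ok x m τ n
  weight-∷ false ok    l     x m τ n s = sym (zeroˡ _)
  weight-∷ true  false l     x m τ n s = sym (zeroʳ _)
  weight-∷ true  true  false x m τ n s = sym (*-identityˡ _)
  weight-∷ true  true  true  x m τ n s = begin
    (x * pow R x m) * pow R τ ((s ℕ.+ 0) ℕ.+ n)
      ≈⟨ *-congˡ (trans (pow-+ τ (s ℕ.+ 0) n) (*-congʳ (reflexive (≡.cong (pow R τ) (ℕ.+-identityʳ s))))) ⟩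
    (x * pow R x m) * (pow R τ s * pow R τ n)
      ≈⟨ solve 4 (λ a b c d → (a :* b) :* (c :* d) := (a :* c) :* (b :* d)) refl _ _ _ _ ⟩
    (x * pow R τ s) * (pow R x m * pow R τ n) ∎

  whiteW-weight : ∀ {k} τ x (I J K L : Label k) →
    whiteW R τ x I J K L ≡ weight (allColours whiteOK I J K L) x (card L) τ (φ (labN L) (labN I ⊕ labN J))
  whiteW-weight τ x I J K L = ≡.cong (λ ok → weight ok x (card L) τ (φ (labN L) (labN I ⊕ labN J))) (white-cond I J K L)

  purpleW-weight : ∀ {k} τ x (I J K L : Label k) →
    purpleW R τ x I J K L ≡ weight (allColours purpleOK I J K L) x (card L) τ (φ (labN L) (labN K ⊖ labN J))
  purpleW-weight τ x I J K L = ≡.cong (λ ok → weight ok x (card L) τ (φ (labN L) (labN K ⊖ labN J))) (purple-cond I J K L)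

  whiteW-∷ : ∀ {k} τ x i j m l (I J K L : Label k) →
    whiteW R τ x (i ∷ I) (j ∷ J) (m ∷ K) (l ∷ L)
    ≈ white₁ i j m l (x * pow R τ (total (labN I ⊕ labN J))) * whiteW R τ x I J K L
  whiteW-∷ τ x i j m l I J K L = begin
    _ ≡⟨ whiteW-weight τ x (i ∷ I) (j ∷ J) (m ∷ K) (l ∷ L) ⟩
    _ ≈⟨ weight-∷ (whiteOK i j m l) (allColours whiteOK I J K L) l x (card L) τ (φ (labN L) (labN I ⊕ labN J)) (total (labN I ⊕ labN J)) ⟩
    _ ≡⟨ ≡.cong (_ *_) (whiteW-weight τ x I J K L) ⟨
    _ ∎

  purpleW-∷ : ∀ {k} τ x i j m l (I J K L : Label k) →
    purpleW R τ x (i ∷ I) (j ∷ J) (m ∷ K) (l ∷ L)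
    ≈ purple₁ i j m l (x * pow R τ (total (labN K ⊖ labN J))) * purpleW R τ x I J K L
  purpleW-∷ τ x i j m l I J K L = begin
    _ ≡⟨ purpleW-weight τ x (i ∷ I) (j ∷ J) (m ∷ K) (l ∷ L) ⟩
    _ ≈⟨ weight-∷ (purpleOK i j m l) (allColours purpleOK I J K L) l x (card L) τ (φ (labN L) (labN K ⊖ labN J)) (total (labN K ⊖ labN J)) ⟩
    _ ≡⟨ ≡.cong (_ *_) (purpleW-weight τ x I J K L) ⟨
    _ ∎

  weight-support : ∀ ok x m τ n → weight ok x m τ n ≈ 0# ⊎ ok ≡ true
  weight-support true  x m τ n = inj₂ ≡.refl
  weight-support false x m τ n = inj₁ refl

  whiteW-support : ∀ {k} τ x (I J K L : Label k) →
    whiteW R τ x I J K L ≈ 0# ⊎ allColours whiteOK I J K L ≡ true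
  whiteW-support τ x I J K L rewrite whiteW-weight τ x I J K L = weight-support (allColours whiteOK I J K L) x (card L) τ (φ (labN L) (labN I ⊕ labN J))

  purpleW-support : ∀ {k} τ x (I J K L : Label k) →
    purpleW R τ x I J K L ≈ 0# ⊎ allColours purpleOK I J K L ≡ true
  purpleW-support τ x I J K L rewrite purpleW-weight τ x I J K L = weight-support (allColours purpleOK I J K L) x (card L) τ (φ (labN L) (labN K ⊖ labN J))

  infixr 2 _⊗_
  _⊗_ : ∀ {a b p q} {P : Set p} {Q : Set q} → a ≈ 0# ⊎ P → b ≈ 0# ⊎ Q → a * b ≈ 0# ⊎ P × Q
  inj₁ a≈0 ⊗ _        = inj₁ (trans (*-congʳ a≈0) (zeroˡ _))
  inj₂ _   ⊗ inj₁ b≈0 = inj₁ (trans (*-congˡ b≈0) (zeroʳ _))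
  inj₂ p   ⊗ inj₂ q   = inj₂ (p , q)

  Bools : List Bool
  Bools = true ∷ false ∷ []

  ∑-Bools : ∀ (f : Bool → Carrier) → ∑ Bools f ≈ sum f
  ∑-Bools f = trans (∑-∷ true _ f) (+-congˡ (trans (∑-∷ false [] f) (+-congˡ (∑-[] f))))

  sum-cong : ∀ (f g : Bool → Carrier) → (∀ b → f b ≈ g b) → sum f ≈ sum g
  sum-cong f g eq = +-cong (eq true) (+-congʳ (eq false))

  ∑³ : ∀ {a} {A : Set a} → List A → (A → A → A → Carrier) → Carrier
  ∑³ xs f = ∑ xs λ a → ∑ xs λ b → ∑ xs λ c → f a b c

  ∑³-Bools : ∀ (f : Bool → Bool → Bool → Carrier) →
    ∑³ Bools f ≈ sum λ a → sum λ b → sum λ c → f a b c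
  ∑³-Bools f = trans (∑-Bools _) (sum-cong (λ a → ∑ Bools λ b → ∑ Bools (f a b)) (λ a → sum λ b → sum (f a b)) λ a →
    trans (∑-Bools _) (sum-cong (λ b → ∑ Bools (f a b)) (λ b → sum (f a b)) λ b → ∑-Bools (f a b)))

  module _ {a} {A : Set a} where

    ∑³-cong : ∀ (xs : List A) {f g : A → A → A → Carrier} → (∀ a b c → f a b c ≈ g a b c) → ∑³ xs f ≈ ∑³ xs g
    ∑³-cong xs eq = ∑-cong xs λ a → ∑-cong xs λ b → ∑-cong xs λ c → eq a b c

    *-distribˡ-∑³ : ∀ (xs : List A) (f : A → A → A → Carrier) y → y * ∑³ xs f ≈ ∑³ xs (λ a b c → y * f a b c)
    *-distribˡ-∑³ xs f y = trans (*-distribˡ-∑ xs _ y) (∑-cong xs λ a →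
      trans (*-distribˡ-∑ xs _ y) (∑-cong xs λ b → *-distribˡ-∑ xs _ y))

    ∑³-∑-swap : ∀ {b} {B : Set b} (xs : List A) (ys : List B) (f : A → A → A → B → Carrier) →
      ∑³ xs (λ a b c → ∑ ys (f a b c)) ≈ ∑ ys (λ y → ∑³ xs (λ a b c → f a b c y))
    ∑³-∑-swap xs ys f = begin
      _ ≈⟨ ∑-cong xs (λ a → trans (∑-cong xs λ b → ∑-swap xs ys (f a b)) (∑-swap xs ys _)) ⟩
      _ ≈⟨ ∑-swap xs ys _ ⟩
      _ ∎

    -- The sums over the first colour are brought innermost, where the one-colour identity applies
    -- with the other colours fixed.
    ∑³-∷ : ∀ (xs : List A) n (f : Vec A (suc n) → Vec A (suc n) → Vec A (suc n) → Carrier) → ∑³ (allVecs xs (suc n)) f ≈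
      ∑³ (allVecs xs n) (λ A B C → ∑³ xs (λ a b c → f (a ∷ A) (b ∷ B) (c ∷ C)))
    ∑³-∷ xs n f = begin
      ∑³ (allVecs xs (suc n)) f
        ≈⟨ ∑-cong _ (λ A → ∑-cong _ λ B → ∑-allVecs-suc xs n _) ⟩
      ∑ (allVecs xs (suc n)) (λ A → ∑ (allVecs xs (suc n)) λ B → ∑ xs λ c → ∑ vs λ C → f A B (c ∷ C))
        ≈⟨ ∑-cong _ (λ A → ∑-allVecs-suc xs n _) ⟩
      ∑ (allVecs xs (suc n)) (λ A → ∑ xs λ b → ∑ vs λ B → ∑ xs λ c → ∑ vs λ C → f A (b ∷ B) (c ∷ C))
        ≈⟨ ∑-allVecs-suc xs n _ ⟩
      ∑ xs (λ a → ∑ vs λ A → ∑ xs λ b → ∑ vs λ B → ∑ xs λ c → ∑ vs λ C → f (a ∷ A) (b ∷ B) (c ∷ C))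
        ≈⟨ ∑-swap xs vs _ ⟩
      ∑ vs (λ A → ∑ xs λ a → ∑ xs λ b → ∑ vs λ B → ∑ xs λ c → ∑ vs λ C → f (a ∷ A) (b ∷ B) (c ∷ C))
        ≈⟨ ∑-cong vs (λ A → trans (∑-cong xs λ a → ∑-swap xs vs _) (∑-swap xs vs _)) ⟩
      ∑ vs (λ A → ∑ vs λ B → ∑ xs λ a → ∑ xs λ b → ∑ xs λ c → ∑ vs λ C → f (a ∷ A) (b ∷ B) (c ∷ C))
        ≈⟨ ∑-cong vs (λ A → ∑-cong vs λ B → ∑³-∑-swap xs vs _) ⟩
      ∑³ vs (λ A B C → ∑³ xs (λ a b c → f (a ∷ A) (b ∷ B) (c ∷ C))) ∎
      where
      vs = allVecs xs n

-- Exchange of a white and a purple vertex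

module WhitePurple {r ℓr} (R : CommutativeRing r ℓr) (τ x y : CommutativeRing.Carrier R) where
  open CommutativeRing R
  open import Relation.Binary.Reasoning.Setoid setoid
  open Sums R
  open Vertex R
  open RingSolver commutativeSemiring
  open OneColour _+_ _*_ 0# 1#

  τ^ : ℕ → Carrier
  τ^ = pow R τ

  W P : ∀ {k} → VertexWeight R k
  W = whiteW R τ x
  P = purpleW R τ y

  -- v S A B = [A ⊔ B = S] x^|A| y^|B| τ^φ(A,S). For fixed S this is a left eigenvector, up to the change of S,
  -- of white below purple, while the indicator of A ⊔ B is a right one of purple below white.
  -- Here A and B are the labels of the white and of the purple horizontal edge.
  v : ∀ {k} → Label k → Label k → Label k → Carrier
  v []      []      []      = 1#
  v (s ∷ S) (a ∷ A) (b ∷ B) = v₁ x y s a b (τ^ (card S)) * v S A B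

  splits : ∀ {k} → Label k → Label k → Label k → Bool
  splits []      []      []      = true
  splits (s ∷ S) (a ∷ A) (b ∷ B) = split s a b ∧ splits S A B

  -- The eigenvalues. The index q counts the colours of S′ met before the current one; it absorbs the
  -- coupling φ between a colour and the later ones, so that everything below is an induction on colours.
  c d : ∀ {k} → ℕ → VertexWeight R k
  c q []      []      []      []        = 1#
  c q (i ∷ I) (s ∷ S) (m ∷ K) (s′ ∷ S′) = c₁ x y i s m s′ (τ^ (card S)) (τ^ q) * c (b2n s′ ℕ.+ q) I S K S′
  d q []      []      []      []        = 1#
  d q (i ∷ I) (s ∷ S) (m ∷ K) (s′ ∷ S′) = d₁ x y i s m s′ (τ^ (card S)) (τ^ q) * d (b2n s′ ℕ.+ q) I S K S′

  splits-card : ∀ {k} (S A B : Label k) → splits S A B ≡ true → card A ℕ.+ card B ≡ card S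
  splits-card []      []      []      _  = ≡.refl
  splits-card (s ∷ S) (a ∷ A) (b ∷ B) ok = ≡.trans (ℕ-interchange (b2n a) (card A) (b2n b) (card B))
    (≡.cong₂ ℕ._+_ (ℕ.≡ᵇ⇒≡ (b2n a ℕ.+ b2n b) (b2n s) (true→T (𝔹.∧-conicalˡ _ (splits S A B) ok)))
      (splits-card S A B (𝔹.∧-conicalʳ (split s a b) _ ok)))

  v-support : ∀ {k} (S A B : Label k) → v S A B ≈ 0# ⊎ splits S A B ≡ true
  v-support []      []      []      = inj₂ ≡.refl
  v-support (s ∷ S) (a ∷ A) (b ∷ B) with split s a b
  ... | false = inj₁ (zeroˡ _)
  ... | true with v-support S A B
  ...   | inj₁ v≈0 = inj₁ (trans (*-congˡ v≈0) (zeroʳ _))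
  ...   | inj₂ ok  = inj₂ ok

  splits-support : ∀ {k} (S A B : Label k) → [ splits S A B ] ≈ 0# ⊎ splits S A B ≡ true
  splits-support S A B with splits S A B
  ... | false = inj₁ refl
  ... | true  = inj₂ ≡.refl

  pow-∸ : ∀ q m b D → τ^ (q ℕ.* ((b2n m ∸ b2n b) ℕ.+ D)) ≈ pw (τ^ q) (m ∧ not b) * τ^ (q ℕ.* D)
  pow-∸ q m b D = trans (reflexive (≡.cong τ^ (ℕ.*-distribˡ-+ q (b2n m ∸ b2n b) D)))
    (trans (pow-+ τ (q ℕ.* (b2n m ∸ b2n b)) _) (*-congʳ (lem m b)))
    where
    zero-power : τ^ (q ℕ.* 0) ≈ 1#
    zero-power = reflexive (≡.cong τ^ (ℕ.*-zeroʳ q))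
    lem : ∀ m b → τ^ (q ℕ.* (b2n m ∸ b2n b)) ≈ pw (τ^ q) (m ∧ not b)
    lem true  true  = zero-power
    lem true  false = reflexive (≡.cong τ^ (ℕ.*-identityʳ q))
    lem false true  = zero-power
    lem false false = zero-power

  pow-b2n : ∀ s q D → τ^ (q ℕ.* D) * pw (τ^ D) s ≈ τ^ ((b2n s ℕ.+ q) ℕ.* D)
  pow-b2n false q D = *-identityʳ _
  pow-b2n true  q D = trans (*-comm _ _) (sym (pow-+ τ D (q ℕ.* D)))

  if01-cong : ∀ ok {a b} → a ≈ b → if01 ok a ≈ if01 ok b
  if01-cong false eq = refl
  if01-cong true  eq = eq

  pw-cong : ∀ l {a b} → a ≈ b → pw a l ≈ pw b l
  pw-cong false eq = refl
  pw-cong true  eq = eq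

  -- Row commutation uses q = 0. The general index serves the induction: once the first colour is
  -- summed out, its new label s′ multiplies the rest by τ^(s′ |K - B|), which is the same statement
  -- for the later colours at index s′ + q.
  white-then-purple : ∀ {k} q (I S K A′ B′ : Label k) →
    ∑³ (allLabels k) (λ A B M →
      v S A B * (W I A M A′ * (P M B K B′ * τ^ (q ℕ.* total (labN K ⊖ labN B)))))
    ≈ ∑ (allLabels k) (λ S′ → c q I S K S′ * v S′ A′ B′)
  white-then-purple {zero} q [] [] [] [] [] = begin
    _ ≈⟨ trans (∑-singleton [] _) (trans (∑-singleton [] _) (∑-singleton [] _)) ⟩
    1# * ((1# * 1#) * ((1# * 1#) * τ^ (q ℕ.* 0)))
      ≈⟨ *-congˡ (*-congˡ (*-congˡ (reflexive (≡.cong τ^ (ℕ.*-zeroʳ q))))) ⟩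
    1# * ((1# * 1#) * ((1# * 1#) * 1#))
      ≈⟨ solve 0 (con 1 :* ((con 1 :* con 1) :* ((con 1 :* con 1) :* con 1)) := con 1 :* con 1) refl ⟩
    1# * 1#
      ≈⟨ ∑-singleton [] _ ⟨
    _ ∎
  white-then-purple {suc k} q (i ∷ I) (s ∷ S) (m ∷ K) (a′ ∷ A′) (b′ ∷ B′) = begin
    _ ≈⟨ ∑³-∷ Bools k _ ⟩
    _ ≈⟨ ∑³-cong Ls (λ A B M → ∑³-cong Bools λ a b l → factor A B M a b l) ⟩
    _ ≈⟨ ∑³-cong Ls (λ A B M → *-distribˡ-∑³ Bools _ (tail q A B M)) ⟨
    _ ≈⟨ ∑³-cong Ls (λ A B M → *-congˡ (trans (∑³-Bools λ a b l → v₁ x y s a b X * (white₁ i a l a′ (x * (Z B * Y))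
             * (purple₁ l b m b′ (y * Z B) * pw (τ^ q) (m ∧ not b)))) (trans (OneColourIdentities.wp R i s m a′ b′ x y X Y (Z B) (τ^ q)) (sym (∑-Bools λ s′ → c₁ x y i s m s′ X (τ^ q) * (v₁ x y s′ a′ b′ Y * pw (Z B) s′)))))) ⟩
    _ ≈⟨ ∑³-cong Ls (λ A B M → trans (*-distribˡ-∑ Bools _ (tail q A B M))
           (∑-cong Bools λ s′ → shift A B M s′)) ⟩
    _ ≈⟨ ∑³-∑-swap Ls Bools _ ⟩
    _ ≈⟨ ∑-cong Bools (λ s′ → *-distribˡ-∑³ Ls (tail (b2n s′ ℕ.+ q)) _) ⟨
    _ ≈⟨ ∑-cong Bools (λ s′ → *-congˡ (white-then-purple (b2n s′ ℕ.+ q) I S K A′ B′)) ⟩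
    _ ≈⟨ ∑-cong Bools (λ s′ → trans (*-distribˡ-∑ Ls _ _) (∑-cong Ls λ S′ → unfactor s′ S′)) ⟩
    _ ≈⟨ ∑-allVecs-suc Bools k _ ⟨
    _ ∎
    where
    Ls = allLabels k
    D : Label k → ℕ
    D B = total (labN K ⊖ labN B)
    Z : Label k → Carrier
    Z B = τ^ (D B)
    X Y : Carrier
    X = τ^ (card S)
    Y = τ^ (card A′ ℕ.+ card B′)
    tail : ℕ → Label k → Label k → Label k → Carrier
    tail q A B M = v S A B * (W I A M A′ * (P M B K B′ * τ^ (q ℕ.* D B)))

    factor : ∀ A B M a b l →
      v (s ∷ S) (a ∷ A) (b ∷ B) * (W (i ∷ I) (a ∷ A) (l ∷ M) (a′ ∷ A′) * (P (l ∷ M) (b ∷ B) (m ∷ K) (b′ ∷ B′)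
        * τ^ (q ℕ.* total (labN (m ∷ K) ⊖ labN (b ∷ B)))))
      ≈ tail q A B M * (v₁ x y s a b X * (white₁ i a l a′ (x * (Z B * Y))
        * (purple₁ l b m b′ (y * Z B) * pw (τ^ q) (m ∧ not b))))
    factor A B M a b l = begin
      _ ≈⟨ *-congˡ (*-cong (whiteW-∷ τ x i a l a′ I A M A′)
             (*-cong (purpleW-∷ τ y l b m b′ M B K B′) (pow-∸ q m b (D B)))) ⟩
      _ ≈⟨ solve 8 (λ v₁ v w₁ w p₁ p t₁ t → (v₁ :* v) :* ((w₁ :* w) :* ((p₁ :* p) :* (t₁ :* t)))
             := (v :* (w :* (p :* t))) :* (v₁ :* (w₁ :* (p₁ :* t₁)))) refl _ _ _ _ _ _ _ _ ⟩
      _ ≈⟨ absorb (v-support S A B ⊗ whiteW-support τ x I A M A′ ⊗ purpleW-support τ y M B K B′ ⊗ inj₂ tt)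
             (λ { (_ , okW , okP , _) → *-congˡ (*-congʳ (if01-cong (whiteOK i a l a′) (pw-cong a′ (*-congˡ
             (trans (reflexive (≡.cong τ^ (white-purple-card I A M A′ B K B′ okW okP))) (pow-+ τ (D B) _)))))) }) ⟩
      _ ∎

    shift : ∀ A B M s′ →
      tail q A B M * (c₁ x y i s m s′ X (τ^ q) * (v₁ x y s′ a′ b′ Y * pw (Z B) s′))
      ≈ (c₁ x y i s m s′ X (τ^ q) * v₁ x y s′ a′ b′ Y) * tail (b2n s′ ℕ.+ q) A B M
    shift A B M s′ = begin
      _ ≈⟨ solve 7 (λ v w p t c v₁ z → (v :* (w :* (p :* t))) :* (c :* (v₁ :* z))
             := (c :* v₁) :* (v :* (w :* (p :* (t :* z))))) refl _ _ _ _ _ _ _ ⟩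
      _ ≈⟨ *-congˡ (*-congˡ (*-congˡ (*-congˡ (pow-b2n s′ q (D B))))) ⟩
      _ ∎

    unfactor : ∀ s′ S′ →
      (c₁ x y i s m s′ X (τ^ q) * v₁ x y s′ a′ b′ Y) * (c (b2n s′ ℕ.+ q) I S K S′ * v S′ A′ B′)
      ≈ c q (i ∷ I) (s ∷ S) (m ∷ K) (s′ ∷ S′) * v (s′ ∷ S′) (a′ ∷ A′) (b′ ∷ B′)
    unfactor s′ S′ = begin
      _ ≈⟨ solve 4 (λ c₁ v₁ c v → (c₁ :* v₁) :* (c :* v) := v :* (c₁ :* (c :* v₁))) refl _ _ _ _ ⟩
      -- `v` is defined with τ^|S′|, whereas the one-colour identity produced τ^(|A′| + |B′|); they
      -- agree wherever `v S′ A′ B′` does not vanish.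
      _ ≈⟨ absorb (v-support S′ A′ B′) (λ ok → *-congˡ (*-congˡ (if01-cong (split s′ a′ b′) (*-congʳ
             (pw-cong a′ (*-congˡ (reflexive (≡.cong τ^ (splits-card S′ A′ B′ ok))))))))) ⟩
      _ ≈⟨ solve 4 (λ c₁ v₁ c v → v :* (c₁ :* (c :* v₁)) := (c₁ :* c) :* (v₁ :* v)) refl _ _ _ _ ⟩
      _ ∎

  -- With purple below, the outgoing edges are summed while A and B stay fixed, and the result
  -- depends on them only through their union S. The white exponent now involves |M + A|, which is
  -- |M - B| + |A| + |B| by the purple condition.
  purple-then-white : ∀ {k} q (I K A B S′ : Label k) →
    ∑³ (allLabels k) (λ A′ B′ M →
      P I B M B′ * (W M A K A′ * ([ splits S′ A′ B′ ] * τ^ (q ℕ.* total (labN M ⊖ labN B)))))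
    ≈ ∑ (allLabels k) (λ S → [ splits S A B ] * d q I S K S′)
  purple-then-white {zero} q [] [] [] [] [] = begin
    _ ≈⟨ trans (∑-singleton [] _) (trans (∑-singleton [] _) (∑-singleton [] _)) ⟩
    (1# * 1#) * ((1# * 1#) * (1# * τ^ (q ℕ.* 0)))
      ≈⟨ *-congˡ (*-congˡ (*-congˡ (reflexive (≡.cong τ^ (ℕ.*-zeroʳ q))))) ⟩
    (1# * 1#) * ((1# * 1#) * (1# * 1#))
      ≈⟨ solve 0 ((con 1 :* con 1) :* ((con 1 :* con 1) :* (con 1 :* con 1)) := con 1 :* con 1) refl ⟩
    1# * 1#
      ≈⟨ ∑-singleton [] _ ⟨
    _ ∎
  purple-then-white {suc k} q (i ∷ I) (m ∷ K) (a ∷ A) (b ∷ B) (s′ ∷ S′) = begin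
    _ ≈⟨ ∑³-∷ Bools k _ ⟩
    _ ≈⟨ ∑³-cong Ls (λ A′ B′ M → ∑³-cong Bools λ a′ b′ l → factor A′ B′ M a′ b′ l) ⟩
    _ ≈⟨ ∑³-cong Ls (λ A′ B′ M → *-distribˡ-∑³ Bools _ (tail q A′ B′ M)) ⟨
    _ ≈⟨ ∑³-cong Ls (λ A′ B′ M → *-congˡ (head M)) ⟩
    _ ≈⟨ ∑³-cong Ls (λ A′ B′ M → trans (*-distribˡ-∑ Bools _ (tail q A′ B′ M))
           (∑-cong Bools λ s → shift A′ B′ M s)) ⟩
    _ ≈⟨ ∑³-∑-swap Ls Bools _ ⟩
    _ ≈⟨ ∑-cong Bools (λ s → *-distribˡ-∑³ Ls (tail (b2n s′ ℕ.+ q)) _) ⟨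
    _ ≈⟨ ∑-cong Bools (λ s → *-congˡ (purple-then-white (b2n s′ ℕ.+ q) I K A B S′)) ⟩
    _ ≈⟨ ∑-cong Bools (λ s → trans (*-distribˡ-∑ Ls _ _) (∑-cong Ls λ S → unfactor s S)) ⟩
    _ ≈⟨ ∑-allVecs-suc Bools k _ ⟨
    _ ∎
    where
    Ls = allLabels k
    D : Label k → ℕ
    D M = total (labN M ⊖ labN B)
    Z : Label k → Carrier
    Z M = τ^ (D M)
    Y : Carrier
    Y = τ^ (card A ℕ.+ card B)
    tail : ℕ → Label k → Label k → Label k → Carrier
    tail q A′ B′ M = P I B M B′ * (W M A K A′ * ([ splits S′ A′ B′ ] * τ^ (q ℕ.* D M)))

    head : ∀ M →
      ∑³ Bools (λ a′ b′ l → purple₁ i b l b′ (y * Z M)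
        * (white₁ l a m a′ (x * (Z M * Y)) * ([ split s′ a′ b′ ] * pw (τ^ q) (l ∧ not b))))
      ≈ ∑ Bools (λ s → [ split s a b ] * (d₁ x y i s m s′ Y (τ^ q) * pw (Z M) s′))
    head M = begin
      _ ≈⟨ ∑³-Bools (λ a′ b′ l → purple₁ i b l b′ (y * Z M)
             * (white₁ l a m a′ (x * (Z M * Y)) * ([ split s′ a′ b′ ] * pw (τ^ q) (l ∧ not b)))) ⟩
      _ ≈⟨ OneColourIdentities.pw R i a m b s′ x y Y Y (Z M) (τ^ q) ⟩
      _ ≈⟨ ∑-Bools (λ s → [ split s a b ] * (d₁ x y i s m s′ Y (τ^ q) * pw (Z M) s′)) ⟨
      _ ∎

    total-M : ∀ M B′ → allColours purpleOK I B M B′ ≡ true →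
      total (labN M ⊕ labN A) ≡ D M ℕ.+ (card A ℕ.+ card B)
    total-M M B′ okP = ≡.trans (total-⊕ (labN M) (labN A))
      (≡.trans (≡.cong (ℕ._+ card A) (≡.sym (purple-⊖ I B M B′ okP)))
        (ℕS.solve 3 (λ D B A → (D ℕS.:+ B) ℕS.:+ A ℕS.:= D ℕS.:+ (A ℕS.:+ B)) ≡.refl (D M) (card B) (card A)))

    factor : ∀ A′ B′ M a′ b′ l →
      P (i ∷ I) (b ∷ B) (l ∷ M) (b′ ∷ B′) * (W (l ∷ M) (a ∷ A) (m ∷ K) (a′ ∷ A′)
        * ([ splits (s′ ∷ S′) (a′ ∷ A′) (b′ ∷ B′) ] * τ^ (q ℕ.* total (labN (l ∷ M) ⊖ labN (b ∷ B)))))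
      ≈ tail q A′ B′ M * (purple₁ i b l b′ (y * Z M)
        * (white₁ l a m a′ (x * (Z M * Y)) * ([ split s′ a′ b′ ] * pw (τ^ q) (l ∧ not b))))
    factor A′ B′ M a′ b′ l = begin
      _ ≈⟨ *-cong (purpleW-∷ τ y i b l b′ I B M B′) (*-cong (whiteW-∷ τ x l a m a′ M A K A′)
             (*-cong ([]-∧ (split s′ a′ b′) _) (pow-∸ q l b (D M)))) ⟩
      _ ≈⟨ solve 8 (λ p₁ p w₁ w v₁ v t₁ t → (p₁ :* p) :* ((w₁ :* w) :* ((v₁ :* v) :* (t₁ :* t)))
             := (p :* (w :* (v :* t))) :* (p₁ :* (w₁ :* (v₁ :* t₁)))) refl _ _ _ _ _ _ _ _ ⟩
      _ ≈⟨ absorb (purpleW-support τ y I B M B′ ⊗ inj₂ tt)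
             (λ { (okP , _) → *-congˡ (*-congʳ (if01-cong (whiteOK l a m a′) (pw-cong a′ (*-congˡ
             (trans (reflexive (≡.cong τ^ (total-M M B′ okP))) (pow-+ τ (D M) _)))))) }) ⟩
      _ ∎

    shift : ∀ A′ B′ M s →
      tail q A′ B′ M * ([ split s a b ] * (d₁ x y i s m s′ Y (τ^ q) * pw (Z M) s′))
      ≈ ([ split s a b ] * d₁ x y i s m s′ Y (τ^ q)) * tail (b2n s′ ℕ.+ q) A′ B′ M
    shift A′ B′ M s = begin
      _ ≈⟨ solve 7 (λ v w p t c v₁ z → (v :* (w :* (p :* t))) :* (c :* (v₁ :* z))
             := (c :* v₁) :* (v :* (w :* (p :* (t :* z))))) refl _ _ _ _ _ _ _ ⟩
      _ ≈⟨ *-congˡ (*-congˡ (*-congˡ (*-congˡ (pow-b2n s′ q (D M))))) ⟩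
      _ ∎

    unfactor : ∀ s S →
      ([ split s a b ] * d₁ x y i s m s′ Y (τ^ q)) * ([ splits S A B ] * d (b2n s′ ℕ.+ q) I S K S′)
      ≈ [ splits (s ∷ S) (a ∷ A) (b ∷ B) ] * d q (i ∷ I) (s ∷ S) (m ∷ K) (s′ ∷ S′)
    unfactor s S = begin
      _ ≈⟨ solve 4 (λ u₁ d₁ u d → (u₁ :* d₁) :* (u :* d) := u :* (u₁ :* (d₁ :* d))) refl _ _ _ _ ⟩
      _ ≈⟨ absorb (splits-support S A B) (λ ok → *-congˡ (*-congʳ (reflexive (≡.cong
             (λ n → d₁ x y i s m s′ (τ^ n) (τ^ q)) (splits-card S A B ok))))) ⟩
      _ ≈⟨ solve 4 (λ u₁ d₁ u d → u :* (u₁ :* (d₁ :* d)) := (u₁ :* u) :* (d₁ :* d)) refl _ _ _ _ ⟩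
      _ ≈⟨ *-congʳ ([]-∧ (split s a b) _) ⟨
      _ ∎

  h : ℕ → Carrier
  h zero    = 1#
  h (suc n) = (y + x * τ^ n) * h n

  -- Reading the colours in order, |S after| + |S′ before| moves from |S| to |S′| by unit steps, and every step
  -- multiplies by the factor of h that c or d contributes at that colour.
  c-h-d : ∀ {k} q (I S K S′ : Label k) →
    c q I S K S′ * h (card S′ ℕ.+ q) ≈ h (card S ℕ.+ q) * d q I S K S′
  c-h-d q [] [] [] [] = *-comm _ _
  c-h-d q (i ∷ I) (s ∷ S) (m ∷ K) (s′ ∷ S′) = one i s m s′
    where
    X = τ^ (card S)
    IH : c q I S K S′ * h (card S′ ℕ.+ q) ≈ h (card S ℕ.+ q) * d q I S K S′
    IH = c-h-d q I S K S′
    IH′ : c (suc q) I S K S′ * h (suc (card S′ ℕ.+ q)) ≈ h (suc (card S ℕ.+ q)) * d (suc q) I S K S′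
    IH′ = begin
      _ ≡⟨ ≡.cong (λ n → c (suc q) I S K S′ * h n) (ℕ.+-suc (card S′) q) ⟨
      _ ≈⟨ c-h-d (suc q) I S K S′ ⟩
      _ ≡⟨ ≡.cong (λ n → h n * d (suc q) I S K S′) (ℕ.+-suc (card S) q) ⟩
      _ ∎
    step : y + x * (X * τ^ q) ≈ y + x * τ^ (card S ℕ.+ q)
    step = +-congˡ (*-congˡ (sym (pow-+ τ (card S) q)))
    none : ∀ {a b d e} → (0# * a) * b ≈ d * (0# * e)
    none = trans (trans (*-congʳ (zeroˡ _)) (zeroˡ _)) (sym (trans (*-congˡ (zeroˡ _)) (zeroʳ _)))
    same : ∀ {z c h′ h d} → c * h′ ≈ h * d → (z * c) * h′ ≈ h * (z * d)
    same {z} {c} {h′} {h} {d} eq = begin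
      (z * c) * h′  ≈⟨ *-assoc _ _ _ ⟩
      z * (c * h′)  ≈⟨ *-congˡ eq ⟩
      z * (h * d)   ≈⟨ solve 3 (λ z h d → z :* (h :* d) := h :* (z :* d)) refl _ _ _ ⟩
      h * (z * d)   ∎
    one : ∀ i s m s′ → c q (i ∷ I) (s ∷ S) (m ∷ K) (s′ ∷ S′) * h (card (s′ ∷ S′) ℕ.+ q)
      ≈ h (card (s ∷ S) ℕ.+ q) * d q (i ∷ I) (s ∷ S) (m ∷ K) (s′ ∷ S′)
    one true  true  true  true  = same IH′
    one true  true  true  false = none
    one true  true  false true  = none
    one true  true  false false = none
    one true  false true  true  = none
    one true  false true  false = same IH
    one true  false false true  = begin
      _ ≈⟨ *-congʳ (*-identityˡ _) ⟩
      _ ≈⟨ IH′ ⟩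
      _ ≈⟨ solve 3 (λ z h d → (z :* h) :* d := h :* (z :* d)) refl _ _ _ ⟩
      _ ≈⟨ *-congˡ (*-congʳ step) ⟨
      _ ∎
    one true  false false false = none
    one false true  true  true  = none
    one false true  true  false = begin
      _ ≈⟨ *-congʳ (*-congʳ step) ⟩
      _ ≈⟨ *-assoc _ _ _ ⟩
      _ ≈⟨ *-congˡ IH ⟩
      _ ≈⟨ solve 3 (λ z h d → z :* (h :* d) := (z :* h) :* (con 1 :* d)) refl _ _ _ ⟩
      _ ∎
    one false true  false true  = same IH′
    one false true  false false = none
    one false false true  true  = none
    one false false true  false = none
    one false false false true  = none
    one false false false false = same IH

-- Commutation of white and purple rows

eqVecB-eqVec : ∀ {n} (u v : Vec Bool n) → eqVecB u v ≡ eqVec eqBool u v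
eqVecB-eqVec []      []      = ≡.refl
eqVecB-eqVec (a ∷ u) (b ∷ v) = ≡.cong (eqBool a b ∧_) (eqVecB-eqVec u v)

card-empty : ∀ k → card (emptyLabel {k}) ≡ 0
card-empty zero    = ≡.refl
card-empty (suc k) = card-empty k

module Rows {r ℓr} (R : CommutativeRing r ℓr) where
  open CommutativeRing R
  open import Relation.Binary.Reasoning.Setoid setoid
  open Sums R
  open Vertex R
  open OneColour _+_ _*_ 0# 1#
  open RingSolver commutativeSemiring

  Bools-sift : Sifts Bools eqBool
  Bools-sift true  f = trans (∑-Bools _) (solve 2 (λ a b → con 1 :* a :+ (con 0 :* b :+ con 0) := a) refl _ _)
  Bools-sift false f = trans (∑-Bools _) (solve 2 (λ a b → con 0 :* a :+ (con 1 :* b :+ con 0) := b) refl _ _)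

  allLabels-sift : ∀ {k} → Sifts (allLabels k) eqVecB
  allLabels-sift {k} y f = trans
    (∑-cong (allLabels k) λ x → *-congʳ (reflexive (≡.cong [_] (eqVecB-eqVec x y))))
    (∑-allVecs-sift Bools-sift k y f)

  rowWeight-∷ : ∀ {k n} (w : VertexWeight R k) h b t (bs ts : Vec (Label k) n) →
    rowWeight R w h (b ∷ bs) (t ∷ ts) ≈ ∑ (allLabels k) (λ h′ → w b h t h′ * rowWeight R w h′ bs ts)
  rowWeight-∷ w h b t bs ts = reflexive (≡.sym (∑-sumR _ _))

  -- Two stacked rows read column by column: the vertical edge between them is summed inside its
  -- column, so that an exchange of vertices can travel along the rows.
  twoRows : ∀ {k n} → VertexWeight R k → VertexWeight R k → Label k → Label k →
    Vec (Label k) n → Vec (Label k) n → Carrier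
  twoRows     w₁ w₂ h₁ h₂ []       []       = [ eqVecB h₁ emptyLabel ] * [ eqVecB h₂ emptyLabel ]
  twoRows {k} w₁ w₂ h₁ h₂ (b ∷ bs) (t ∷ ts) = ∑³ (allLabels k) λ h₁′ h₂′ s →
    (w₁ b h₁ s h₁′ * w₂ s h₂ t h₂′) * twoRows w₁ w₂ h₁′ h₂′ bs ts

  ∑-*-∑ : ∀ {a b} {A : Set a} {B : Set b} (xs : List A) (ys : List B) f g →
    ∑ xs f * ∑ ys g ≈ ∑ xs λ x → ∑ ys λ y → f x * g y
  ∑-*-∑ xs ys f g = trans (*-distribʳ-∑ xs f _) (∑-cong xs λ x → *-distribˡ-∑ ys g (f x))

  ∑-∑³-swap : ∀ {a b} {A : Set a} {B : Set b} (ys : List B) (xs : List A) (f : B → A → A → A → Carrier) →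
    ∑ ys (λ y → ∑³ xs (f y)) ≈ ∑³ xs (λ a b c → ∑ ys λ y → f y a b c)
  ∑-∑³-swap ys xs f = sym (∑³-∑-swap xs ys λ a b c y → f y a b c)

  ∑-rows : ∀ {k n} (w₁ w₂ : VertexWeight R k) h₁ h₂ (bs ts : Vec (Label k) n) →
    ∑ (allVecs (allLabels k) n) (λ s → rowWeight R w₁ h₁ bs s * rowWeight R w₂ h₂ s ts)
    ≈ twoRows w₁ w₂ h₁ h₂ bs ts
  ∑-rows w₁ w₂ h₁ h₂ [] [] = ∑-singleton [] _
  ∑-rows {k} {suc n} w₁ w₂ h₁ h₂ (b ∷ bs) (t ∷ ts) = begin
    _ ≈⟨ ∑-allVecs-suc Ls n _ ⟩
    _ ≈⟨ ∑-cong Ls (λ m → ∑-cong Ss λ s → *-cong (rowWeight-∷ w₁ h₁ b m bs s) (rowWeight-∷ w₂ h₂ m t s ts)) ⟩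
    _ ≈⟨ ∑-cong Ls (λ m → ∑-cong Ss λ s → ∑-*-∑ Ls Ls _ _) ⟩
    _ ≈⟨ ∑-cong Ls (λ m → ∑-swap Ss Ls _) ⟩
    _ ≈⟨ ∑-cong Ls (λ m → ∑-cong Ls λ h₁′ → ∑-swap Ss Ls _) ⟩
    _ ≈⟨ ∑-swap Ls Ls _ ⟩
    _ ≈⟨ ∑-cong Ls (λ h₁′ → ∑-swap Ls Ls _) ⟩
    _ ≈⟨ ∑³-cong Ls collect ⟩
    _ ∎
    where
    Ls = allLabels k
    Ss = allVecs Ls n
    collect : ∀ h₁′ h₂′ m →
      ∑ Ss (λ s → (w₁ b h₁ m h₁′ * rowWeight R w₁ h₁′ bs s) * (w₂ m h₂ t h₂′ * rowWeight R w₂ h₂′ s ts))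
      ≈ (w₁ b h₁ m h₁′ * w₂ m h₂ t h₂′) * twoRows w₁ w₂ h₁′ h₂′ bs ts
    collect h₁′ h₂′ m = begin
      _ ≈⟨ ∑-cong Ss (λ s → solve 4 (λ a b c d → (a :* b) :* (c :* d) := (a :* c) :* (b :* d)) refl _ _ _ _) ⟩
      _ ≈⟨ *-distribˡ-∑ Ss _ _ ⟨
      _ ≈⟨ *-congˡ (∑-rows w₁ w₂ h₁′ h₂′ bs ts) ⟩
      _ ∎

  module _ (τ x y : Carrier) where
    open WhitePurple R τ x y

    ∑-v-∷ : ∀ {k} s (S : Label k) (f : Label (suc k) → Label (suc k) → Carrier) →
      ∑ (allLabels (suc k)) (λ A → ∑ (allLabels (suc k)) λ B → v (s ∷ S) A B * f A B)
      ≈ sum λ a → sum λ b → v₁ x y s a b (τ^ (card S))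
        * ∑ (allLabels k) (λ A → ∑ (allLabels k) λ B → v S A B * f (a ∷ A) (b ∷ B))
    ∑-v-∷ {k} s S f = begin
      _ ≈⟨ ∑-cong _ (λ A → ∑-allVecs-suc Bools k _) ⟩
      _ ≈⟨ ∑-allVecs-suc Bools k _ ⟩
      _ ≈⟨ ∑-cong Bools (λ a → ∑-swap Ls Bools _) ⟩
      _ ≈⟨ ∑-cong Bools (λ a → ∑-cong Bools λ b → pull a b) ⟩
      _ ≈⟨ ∑-cong Bools (λ a → ∑-Bools (λ b → g a b)) ⟩
      _ ≈⟨ ∑-Bools (λ a → sum (g a)) ⟩
      _ ∎
      where
      Ls = allLabels k
      g : Bool → Bool → Carrier
      g a b = v₁ x y s a b (τ^ (card S)) * ∑ Ls (λ A → ∑ Ls λ B → v S A B * f (a ∷ A) (b ∷ B))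
      pull : ∀ a b → ∑ Ls (λ A → ∑ Ls λ B → v (s ∷ S) (a ∷ A) (b ∷ B) * f (a ∷ A) (b ∷ B)) ≈ g a b
      pull a b = begin
        _ ≈⟨ ∑-cong Ls (λ A → trans (∑-cong Ls λ B → *-assoc _ _ _) (sym (*-distribˡ-∑ Ls _ _))) ⟩
        _ ≈⟨ *-distribˡ-∑ Ls _ _ ⟨
        _ ∎

    -- The left boundary: S = ∅ splits only into two empty labels, with weight 1.
    ∑-v-empty : ∀ {k} (f : Label k → Label k → Carrier) →
      ∑ (allLabels k) (λ A → ∑ (allLabels k) λ B → v emptyLabel A B * f A B) ≈ f emptyLabel emptyLabel
    ∑-v-empty {zero}  f = trans (∑-singleton [] _) (trans (∑-singleton [] _) (*-identityˡ _))
    ∑-v-empty {suc k} f = begin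
      _ ≈⟨ ∑-v-∷ false emptyLabel f ⟩
      _ ≈⟨ solve 4 (λ a b c d → (con 0 :* a :+ (con 0 :* b :+ con 0))
             :+ ((con 0 :* c :+ ((con 1 :* con 1) :* d :+ con 0)) :+ con 0) := d) refl _ _ _ _ ⟩
      _ ≈⟨ ∑-v-empty (λ A B → f (false ∷ A) (false ∷ B)) ⟩
      _ ∎

    -- The right boundary: among all S only ∅ has a splitting into two empty labels.
    ∑-v-end : ∀ {k} (S : Label k) → ∑ (allLabels k) (λ A → ∑ (allLabels k) λ B →
      v S A B * ([ eqVecB A emptyLabel ] * [ eqVecB B emptyLabel ])) ≈ [ eqVecB S emptyLabel ]
    ∑-v-end []      = trans (∑-singleton [] _) (trans (∑-singleton [] _) (solve 0 (con 1 :* (con 1 :* con 1) := con 1) refl))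
    ∑-v-end {suc k} (s ∷ S) = begin
      _ ≈⟨ ∑-v-∷ s S (λ A B → [ eqVecB A emptyLabel ] * [ eqVecB B emptyLabel ]) ⟩
      _ ≈⟨ +-cong (+-cong (*-congˡ (vanish λ A B → zeroˡ _)) (+-congʳ (*-congˡ (vanish λ A B → zeroˡ _))))
             (+-congʳ (+-cong (*-congˡ (vanish λ A B → zeroʳ _)) (+-congʳ (*-congˡ (∑-v-end S))))) ⟩
      _ ≈⟨ last s ⟩
      _ ∎
      where
      Ls = allLabels k
      vanish : ∀ {f : Label k → Label k → Carrier} → (∀ A B → f A B ≈ 0#) →
        ∑ Ls (λ A → ∑ Ls λ B → v S A B * f A B) ≈ 0#
      vanish eq = trans (∑-cong Ls λ A → trans (∑-cong Ls λ B → trans (*-congˡ (eq A B)) (zeroʳ _)) (∑-zero Ls)) (∑-zero Ls)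
      last : ∀ s → (sum λ a → sum λ b → v₁ x y s a b (τ^ (card S)) * (if not (a ∨ b) then [ eqVecB S emptyLabel ] else 0#))
        ≈ [ eqVecB (s ∷ S) emptyLabel ]
      last true  = solve 3 (λ a b e → ((con 0 :* con 0) :+ ((a :* con 1) :* con 0 :+ con 0))
        :+ (((con 1 :* b) :* con 0 :+ (con 0 :* e :+ con 0)) :+ con 0) := con 0) refl _ _ _
      last false = solve 1 (λ e → ((con 0 :* con 0) :+ (con 0 :* con 0 :+ con 0))
        :+ ((con 0 :* con 0 :+ ((con 1 :* con 1) :* e :+ con 0)) :+ con 0) := e) refl _

    ∑-splits-empty : ∀ {k} (f : Label k → Carrier) →
      ∑ (allLabels k) (λ S → [ splits S emptyLabel emptyLabel ] * f S) ≈ f emptyLabel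
    ∑-splits-empty {zero}  f = trans (∑-singleton [] _) (*-identityˡ _)
    ∑-splits-empty {suc k} f = begin
      _ ≈⟨ ∑-allVecs-suc Bools k _ ⟩
      _ ≈⟨ ∑-Bools (λ s → ∑ (allLabels k) λ S → [ splits (s ∷ S) emptyLabel emptyLabel ] * f (s ∷ S)) ⟩
      _ ≈⟨ +-cong (trans (∑-cong _ λ S → zeroˡ _) (∑-zero (allLabels k)))
             (+-congʳ (∑-splits-empty (λ S → f (false ∷ S)))) ⟩
      0# + (f emptyLabel + 0#)
        ≈⟨ trans (+-identityˡ _) (+-identityʳ _) ⟩
      _ ∎

    ∑-splits-end : ∀ {k} (A B : Label k) →
      [ eqVecB B emptyLabel ] * [ eqVecB A emptyLabel ]
      ≈ ∑ (allLabels k) (λ S → [ splits S A B ] * [ eqVecB S emptyLabel ])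
    ∑-splits-end []      []      = sym (∑-singleton [] _)
    ∑-splits-end {suc k} (a ∷ A) (b ∷ B) = begin
      _ ≈⟨ first a b ⟩
      _ ≈⟨ *-congˡ (∑-splits-end A B) ⟩
      _ ≈⟨ *-distribˡ-∑ Ls _ _ ⟩
      _ ≈⟨ ∑-cong Ls (λ S → trans (sym (*-assoc _ _ _)) (*-congʳ (sym ([]-∧ (split false a b) _)))) ⟩
      _ ≈⟨ trans (+-identityˡ _) (+-identityʳ _) ⟨
      _ ≈⟨ +-congʳ (trans (∑-cong Ls λ S → zeroʳ _) (∑-zero Ls)) ⟨
      _ ≈⟨ ∑-Bools (λ s → ∑ Ls λ S → [ splits (s ∷ S) (a ∷ A) (b ∷ B) ] * [ eqVecB (s ∷ S) emptyLabel ]) ⟨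
      _ ≈⟨ ∑-allVecs-suc Bools k _ ⟨
      _ ∎
      where
      Ls = allLabels k
      first : ∀ a b → [ eqVecB (b ∷ B) emptyLabel ] * [ eqVecB (a ∷ A) emptyLabel ]
        ≈ [ split false a b ] * ([ eqVecB B emptyLabel ] * [ eqVecB A emptyLabel ])
      first true  true  = solve 2 (λ a b → con 0 :* con 0 := con 0 :* (b :* a)) refl _ _
      first true  false = solve 2 (λ a b → b :* con 0 := con 0 :* (b :* a)) refl _ _
      first false true  = solve 2 (λ a b → con 0 :* a := con 0 :* (b :* a)) refl _ _
      first false false = sym (*-identityˡ _)

    -- The left eigenvector is pushed from left to right: each column trades `v S` for `v S′` at the
    -- cost of one merged vertex `c 0`.
    white-purple-rows : ∀ {k n} (S : Label k) (bs ts : Vec (Label k) n) →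
      ∑ (allLabels k) (λ A → ∑ (allLabels k) λ B → v S A B * twoRows W P A B bs ts)
      ≈ rowWeight R (c 0) S bs ts
    white-purple-rows S [] [] = ∑-v-end S
    white-purple-rows {k} S (b ∷ bs) (t ∷ ts) = begin
      _ ≈⟨ ∑-cong Ls (λ A → ∑-cong Ls λ B → *-distribˡ-∑³ Ls _ _) ⟩
      _ ≈⟨ ∑-cong Ls (λ A → ∑-∑³-swap Ls Ls _) ⟩
      _ ≈⟨ ∑-∑³-swap Ls Ls _ ⟩
      _ ≈⟨ ∑-cong Ls (λ A′ → ∑-cong Ls λ B′ → collect A′ B′) ⟩
      _ ≈⟨ ∑-cong Ls (λ A′ → ∑-swap Ls Ls _) ⟩
      _ ≈⟨ ∑-swap Ls Ls _ ⟩
      _ ≈⟨ ∑-cong Ls (λ S′ → trans (∑-cong Ls λ A′ → sym (*-distribˡ-∑ Ls _ _)) (sym (*-distribˡ-∑ Ls _ _))) ⟩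
      _ ≈⟨ ∑-cong Ls (λ S′ → *-congˡ (white-purple-rows S′ bs ts)) ⟩
      _ ≈⟨ rowWeight-∷ (c 0) S b t bs ts ⟨
      _ ∎
      where
      Ls = allLabels k
      collect : ∀ A′ B′ →
        ∑ Ls (λ M → ∑ Ls λ A → ∑ Ls λ B → v S A B * ((W b A M A′ * P M B t B′) * twoRows W P A′ B′ bs ts))
        ≈ ∑ Ls (λ S′ → c 0 b S t S′ * (v S′ A′ B′ * twoRows W P A′ B′ bs ts))
      collect A′ B′ = begin
        _ ≈⟨ trans (∑-swap Ls Ls _) (∑-cong Ls λ A → ∑-swap Ls Ls _) ⟩
        _ ≈⟨ ∑³-cong Ls (λ A B M → solve 4 (λ v w p r → v :* ((w :* p) :* r) := r :* (v :* (w :* (p :* con 1))))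
               refl _ _ _ _) ⟩
        _ ≈⟨ *-distribˡ-∑³ Ls _ _ ⟨
        _ ≈⟨ *-congˡ (white-then-purple 0 b S t A′ B′) ⟩
        _ ≈⟨ *-distribˡ-∑ Ls _ _ ⟩
        _ ≈⟨ ∑-cong Ls (λ S′ → solve 3 (λ r c v → r :* (c :* v) := c :* (v :* r)) refl _ _ _) ⟩
        _ ∎

    -- The indicator of a union is a right eigenvector, so here the merging starts at the right
    -- boundary and is pulled to the left.
    purple-white-rows : ∀ {k n} (A B : Label k) (bs ts : Vec (Label k) n) →
      twoRows P W B A bs ts ≈ ∑ (allLabels k) (λ S → [ splits S A B ] * rowWeight R (d 0) S bs ts)
    purple-white-rows A B [] [] = ∑-splits-end A B
    purple-white-rows {k} A B (b ∷ bs) (t ∷ ts) = begin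
      _ ≈⟨ ∑³-cong Ls (λ B′ A′ M → trans (*-congˡ (purple-white-rows A′ B′ bs ts)) (*-distribˡ-∑ Ls _ _)) ⟩
      _ ≈⟨ ∑³-∑-swap Ls Ls _ ⟩
      _ ≈⟨ ∑-cong Ls collect ⟩
      _ ≈⟨ ∑-swap Ls Ls _ ⟩
      _ ≈⟨ ∑-cong Ls (λ S → *-distribˡ-∑ Ls _ _) ⟨
      _ ≈⟨ ∑-cong Ls (λ S → *-congˡ (rowWeight-∷ (d 0) S b t bs ts)) ⟨
      _ ∎
      where
      Ls = allLabels k
      collect : ∀ S′ →
        ∑³ Ls (λ B′ A′ M → (P b B M B′ * W M A t A′) * ([ splits S′ A′ B′ ] * rowWeight R (d 0) S′ bs ts))
        ≈ ∑ Ls (λ S → [ splits S A B ] * (d 0 b S t S′ * rowWeight R (d 0) S′ bs ts))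
      collect S′ = begin
        _ ≈⟨ ∑-swap Ls Ls _ ⟩
        _ ≈⟨ ∑³-cong Ls (λ A′ B′ M → solve 4 (λ p w u r → (p :* w) :* (u :* r) := r :* (p :* (w :* (u :* con 1))))
               refl _ _ _ _) ⟩
        _ ≈⟨ *-distribˡ-∑³ Ls _ _ ⟨
        _ ≈⟨ *-congˡ (purple-then-white 0 b t A B S′) ⟩
        _ ≈⟨ *-distribˡ-∑ Ls _ _ ⟩
        _ ≈⟨ ∑-cong Ls (λ S → solve 3 (λ r u d → r :* (u :* d) := u :* (d :* r)) refl _ _ _) ⟩
        _ ∎

    -- By `c-h-d` at q = 0 the factors h(|S|) telescope along the row. At the right boundary only
    -- the empty label survives, where h is 1.
    c-row-d-row : ∀ {k n} (S : Label k) (bs ts : Vec (Label k) n) →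
      rowWeight R (c 0) S bs ts ≈ h (card S ℕ.+ 0) * rowWeight R (d 0) S bs ts
    c-row-d-row []          [] [] = sym (*-identityˡ _)
    c-row-d-row (true  ∷ S) [] [] = sym (zeroʳ _)
    c-row-d-row (false ∷ S) [] [] = c-row-d-row S [] []
    c-row-d-row {k} S (b ∷ bs) (t ∷ ts) = begin
      _ ≈⟨ rowWeight-∷ (c 0) S b t bs ts ⟩
      _ ≈⟨ ∑-cong Ls (λ S′ → *-congˡ (c-row-d-row S′ bs ts)) ⟩
      _ ≈⟨ ∑-cong Ls (λ S′ → trans (sym (*-assoc _ _ _)) (trans (*-congʳ (c-h-d 0 b S t S′)) (*-assoc _ _ _))) ⟩
      _ ≈⟨ *-distribˡ-∑ Ls _ _ ⟨
      _ ≈⟨ *-congˡ (rowWeight-∷ (d 0) S b t bs ts) ⟨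
      _ ∎
      where
      Ls = allLabels k

    white-purple-commute : ∀ {k n} (bs ts : Vec (Label k) n) →
      ∑ (allVecs (allLabels k) n) (λ s → rowWeight R W emptyLabel bs s * rowWeight R P emptyLabel s ts)
      ≈ ∑ (allVecs (allLabels k) n) (λ s → rowWeight R P emptyLabel bs s * rowWeight R W emptyLabel s ts)
    white-purple-commute {k} bs ts = begin
      _ ≈⟨ ∑-rows W P emptyLabel emptyLabel bs ts ⟩
      twoRows W P emptyLabel emptyLabel bs ts
        ≈⟨ ∑-v-empty (λ A B → twoRows W P A B bs ts) ⟨
      ∑ (allLabels k) (λ A → ∑ (allLabels k) λ B → v emptyLabel A B * twoRows W P A B bs ts)
        ≈⟨ white-purple-rows emptyLabel bs ts ⟩
      rowWeight R (c 0) emptyLabel bs ts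
        ≈⟨ c-row-d-row emptyLabel bs ts ⟩
      h (card (emptyLabel {k}) ℕ.+ 0) * rowWeight R (d 0) emptyLabel bs ts
        ≈⟨ *-congʳ (reflexive (≡.cong (λ n → h (n ℕ.+ 0)) (card-empty k))) ⟩
      1# * rowWeight R (d 0) emptyLabel bs ts
        ≈⟨ *-identityˡ _ ⟩
      rowWeight R (d 0) emptyLabel bs ts
        ≈⟨ ∑-splits-empty (λ S → rowWeight R (d 0) S bs ts) ⟨
      ∑ (allLabels k) (λ S → [ splits S emptyLabel emptyLabel ] * rowWeight R (d 0) S bs ts)
        ≈⟨ purple-white-rows emptyLabel emptyLabel bs ts ⟨
      twoRows P W emptyLabel emptyLabel bs ts
        ≈⟨ ∑-rows P W emptyLabel emptyLabel bs ts ⟨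
      _ ∎

-- Conjugating a tuple of partitions complements its set of particle positions and reverses both the columns
-- and the order of the colours; horizontal labels are only reversed.
dualLabel : ∀ {k} → Label k → Label k
dualLabel L = reverse (V.map not L)

dual : ∀ {k n} → Vec (Label k) n → Vec (Label k) n
dual s = reverse (V.map dualLabel s)

dual-∷ : ∀ {k n} b (s : Vec (Label k) n) → dual (b ∷ s) ≡ dual s ∷ʳ dualLabel b
dual-∷ b s = V.reverse-∷ (dualLabel b) (V.map dualLabel s)

-- Duality of vertices and rows

total-∷ʳ : ∀ {n} (u : Vec ℕ n) a → total (u ∷ʳ a) ≡ total u ℕ.+ a
total-∷ʳ []      a = ℕ.+-identityʳ a
total-∷ʳ (b ∷ u) a = ≡.trans (≡.cong (b ℕ.+_) (total-∷ʳ u a)) (≡.sym (ℕ.+-assoc b _ a))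

total-reverse : ∀ {n} (u : Vec ℕ n) → total (reverse u) ≡ total u
total-reverse []      = ≡.refl
total-reverse (a ∷ u) = ≡.trans (≡.cong total (V.reverse-∷ a u))
  (≡.trans (total-∷ʳ (reverse u) a) (≡.trans (≡.cong (ℕ._+ a) (total-reverse u)) (ℕ.+-comm _ a)))

card-reverse : ∀ {k} (L : Label k) → card (reverse L) ≡ card L
card-reverse L = ≡.trans (≡.cong total (V.map-reverse b2n L)) (total-reverse (labN L))

module _ {a b c} {A : Set a} {B : Set b} {C : Set c} (f : A → B → C) where

  zipWith-∷ʳ : ∀ {n} (u : Vec A n) (v : Vec B n) x y → zipWith f (u ∷ʳ x) (v ∷ʳ y) ≡ zipWith f u v ∷ʳ f x y
  zipWith-∷ʳ []      []      x y = ≡.refl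
  zipWith-∷ʳ (a ∷ u) (b ∷ v) x y = ≡.cong (_ ∷_) (zipWith-∷ʳ u v x y)

  zipWith-reverse : ∀ {n} (u : Vec A n) (v : Vec B n) → zipWith f (reverse u) (reverse v) ≡ reverse (zipWith f u v)
  zipWith-reverse []      []      = ≡.refl
  zipWith-reverse (a ∷ u) (b ∷ v) = begin
    zipWith f (reverse (a ∷ u)) (reverse (b ∷ v))   ≡⟨ ≡.cong₂ (zipWith f) (V.reverse-∷ a u) (V.reverse-∷ b v) ⟩
    zipWith f (reverse u ∷ʳ a) (reverse v ∷ʳ b)     ≡⟨ zipWith-∷ʳ (reverse u) (reverse v) a b ⟩
    zipWith f (reverse u) (reverse v) ∷ʳ f a b      ≡⟨ ≡.cong (_∷ʳ f a b) (zipWith-reverse u v) ⟩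
    reverse (zipWith f u v) ∷ʳ f a b                ≡⟨ V.reverse-∷ (f a b) (zipWith f u v) ⟨
    reverse (zipWith f (a ∷ u) (b ∷ v))             ∎
    where open ≡.≡-Reasoning

φ-∷ʳ : ∀ {n} (u v : Vec ℕ n) a b → φ (u ∷ʳ a) (v ∷ʳ b) ≡ φ u v ℕ.+ total u ℕ.* b
φ-∷ʳ []      []      a b = ≡.cong (ℕ._+ 0) (ℕ.*-zeroʳ a)
φ-∷ʳ (c ∷ u) (d ∷ v) a b rewrite φ-∷ʳ u v a b | total-∷ʳ v b =
  ℕS.solve 5 (λ c b U V W → c ℕS.:* (V ℕS.:+ b) ℕS.:+ (W ℕS.:+ U ℕS.:* b)
    ℕS.:= (c ℕS.:* V ℕS.:+ W) ℕS.:+ (c ℕS.:+ U) ℕS.:* b) ≡.refl c b (total u) (total v) (φ u v)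

-- φ sums over ordered pairs of colours, so reversing the colours swaps its arguments; hence
-- conjugation has to reverse the order of the components.
φ-reverse : ∀ {n} (u v : Vec ℕ n) → φ (reverse u) (reverse v) ≡ φ v u
φ-reverse []      []      = ≡.refl
φ-reverse (a ∷ u) (b ∷ v)
  rewrite V.reverse-∷ a u | V.reverse-∷ b v | φ-∷ʳ (reverse u) (reverse v) a b | φ-reverse u v | total-reverse u =
  ≡.trans (ℕ.+-comm (φ v u) _) (≡.cong (ℕ._+ φ v u) (ℕ.*-comm (total u) b))

φ-⊕ˡ : ∀ {n} (u v w : Vec ℕ n) → φ (u ⊕ v) w ≡ φ u w ℕ.+ φ v w
φ-⊕ˡ []      []      []      = ≡.refl
φ-⊕ˡ (a ∷ u) (b ∷ v) (c ∷ w) rewrite φ-⊕ˡ u v w =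
  ℕS.solve 5 (λ a b W U V → (a ℕS.:+ b) ℕS.:* W ℕS.:+ (U ℕS.:+ V)
    ℕS.:= (a ℕS.:* W ℕS.:+ U) ℕS.:+ (b ℕS.:* W ℕS.:+ V)) ≡.refl a b (total w) (φ u w) (φ v w)

φ-⊕ʳ : ∀ {n} (u v w : Vec ℕ n) → φ u (v ⊕ w) ≡ φ u v ℕ.+ φ u w
φ-⊕ʳ []      []      []      = ≡.refl
φ-⊕ʳ (a ∷ u) (b ∷ v) (c ∷ w) rewrite φ-⊕ʳ u v w | total-⊕ v w =
  ℕS.solve 5 (λ a V W U U' → a ℕS.:* (V ℕS.:+ W) ℕS.:+ (U ℕS.:+ U')
    ℕS.:= (a ℕS.:* V ℕS.:+ U) ℕS.:+ (a ℕS.:* W ℕS.:+ U')) ≡.refl a (total v) (total w) (φ u v) (φ u w)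

ones : ∀ {n} → Vec ℕ n
ones = replicate _ 1

-- The contribution to the potential Ψ of a column with label t and T_c particles of colour c to its left.
ψ : ∀ {n} → Vec ℕ n → Vec ℕ n → ℕ
ψ T t = φ (T ⊕ t) t ℕ.+ φ ones T

module _ {k} (T b h t h′ m : Vec ℕ k) where
  open ≡.≡-Reasoning
  open import Data.Nat using (_+_)

  -- T counts the particles of the top row to the left of the column, `T ⊕ h` those of the bottom
  -- row, and `φ T h` is the flux term that telescopes along the row. `φ h′ (b ⊕ h)` is the exponent
  -- of the white vertex and `φ m h`, with m the colours absent from it, that of its dual. As m is
  -- `ones` minus b + h, a term `φ ones h` appears; the summand `φ ones T` of `ψ` exists to absorb
  -- it.
  white-balance : b ⊕ h ≡ t ⊕ h′ → m ⊕ (b ⊕ h) ≡ ones →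
    (φ h′ (b ⊕ h) + (ψ T t + φ (T ⊕ t) h′)) + φ m h ≡ ψ (T ⊕ h) b + φ T h
  white-balance conserve complement = begin
    (φ h′ n + ((φ (T ⊕ t) t + φ ones T) + φ (T ⊕ t) h′)) + φ m h
      ≡⟨ ℕS.solve 5 (λ a b c d e → (a ℕS.:+ ((b ℕS.:+ c) ℕS.:+ d)) ℕS.:+ e
           ℕS.:= (a ℕS.:+ (b ℕS.:+ d)) ℕS.:+ (c ℕS.:+ e)) ≡.refl (φ h′ n) (φ (T ⊕ t) t) (φ ones T) _ _ ⟩
    (φ h′ n + (φ (T ⊕ t) t + φ (T ⊕ t) h′)) + (φ ones T + φ m h)
      ≡⟨ ≡.cong (λ z → (φ h′ n + z) + (φ ones T + φ m h)) (φ-⊕ʳ (T ⊕ t) t h′) ⟨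
    (φ h′ n + φ (T ⊕ t) (t ⊕ h′)) + (φ ones T + φ m h)
      ≡⟨ ≡.cong (λ z → (φ h′ n + z) + (φ ones T + φ m h))
           (≡.trans (≡.cong (φ (T ⊕ t)) (≡.sym conserve)) (φ-⊕ˡ T t n)) ⟩
    (φ h′ n + (φ T n + φ t n)) + (φ ones T + φ m h)
      ≡⟨ ℕS.solve 5 (λ a b c d e → (a ℕS.:+ (b ℕS.:+ c)) ℕS.:+ (d ℕS.:+ e)
           ℕS.:= (b ℕS.:+ (c ℕS.:+ a)) ℕS.:+ (d ℕS.:+ e)) ≡.refl (φ h′ n) (φ T n) (φ t n) (φ ones T) (φ m h) ⟩
    (φ T n + (φ t n + φ h′ n)) + (φ ones T + φ m h)
      ≡⟨ ≡.cong (λ z → (φ T n + z) + (φ ones T + φ m h))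
           (≡.trans (≡.sym (φ-⊕ˡ t h′ n)) (≡.cong (λ z → φ z n) (≡.sym conserve))) ⟩
    (φ T n + φ n n) + (φ ones T + φ m h)
      ≡⟨ ≡.cong₂ (λ y z → (y + z) + (φ ones T + φ m h)) (φ-⊕ʳ T b h) (φ-⊕ʳ n b h) ⟩
    ((φ T b + φ T h) + (φ n b + φ n h)) + (φ ones T + φ m h)
      ≡⟨ ℕS.solve 6 (λ a b c d e f → ((a ℕS.:+ b) ℕS.:+ (c ℕS.:+ d)) ℕS.:+ (e ℕS.:+ f)
           ℕS.:= ((a ℕS.:+ c) ℕS.:+ (e ℕS.:+ (f ℕS.:+ d))) ℕS.:+ b) ≡.refl (φ T b) (φ T h) (φ n b) (φ n h) (φ ones T) _ ⟩
    ((φ T b + φ n b) + (φ ones T + (φ m h + φ n h))) + φ T h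
      ≡⟨ ≡.cong₂ (λ y z → (y + (φ ones T + z)) + φ T h) (φ-⊕ˡ T n b)
           (≡.trans (≡.cong (λ z → φ z h) (≡.sym complement)) (φ-⊕ˡ m n h)) ⟨
    (φ (T ⊕ n) b + (φ ones T + φ ones h)) + φ T h
      ≡⟨ ≡.cong₂ (λ y z → (φ y b + z) + φ T h) T⊕n (≡.sym (φ-⊕ʳ ones T h)) ⟩
    ψ (T ⊕ h) b + φ T h ∎
    where
    n = b ⊕ h
    T⊕n : T ⊕ n ≡ (T ⊕ h) ⊕ b
    T⊕n = ≡.trans (≡.cong (T ⊕_) (V.zipWith-comm ℕ.+-comm b h)) (≡.sym (V.zipWith-assoc ℕ.+-assoc T h b))

  -- Here m consists of the colours going straight up: a path from the left has to turn up, one from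
  -- below goes up or right. The flux term is now `φ (T ⊕ h) h`. Adding `φ m h` on both sides turns
  -- `φ m̅ h` into `φ ones h`, after which bilinearity of φ suffices.
  purple-balance : t ≡ h ⊕ m → b ≡ m ⊕ h′ → ∀ m̅ → m̅ ⊕ m ≡ ones →
    (φ h′ m + (ψ T t + φ ((T ⊕ t) ⊕ h′) h′)) + φ m̅ h ≡ ψ (T ⊕ h) b + φ (T ⊕ h) h
  purple-balance ≡.refl ≡.refl m̅ complement = ℕ.+-cancelʳ-≡ (φ m h) _ _ (begin
    ((φ h′ m + (ψ T (h ⊕ m) + φ ((T ⊕ (h ⊕ m)) ⊕ h′) h′)) + φ m̅ h) + φ m h
      ≡⟨ ℕ.+-assoc (φ h′ m + _) _ _ ⟩
    (φ h′ m + (ψ T (h ⊕ m) + φ ((T ⊕ (h ⊕ m)) ⊕ h′) h′)) + (φ m̅ h + φ m h)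
      ≡⟨ ≡.cong ((φ h′ m + (ψ T (h ⊕ m) + φ ((T ⊕ (h ⊕ m)) ⊕ h′) h′)) +_)
           (≡.trans (≡.sym (φ-⊕ˡ m̅ m h)) (≡.cong (λ z → φ z h) complement)) ⟩
    (φ h′ m + (ψ T (h ⊕ m) + φ ((T ⊕ (h ⊕ m)) ⊕ h′) h′)) + φ ones h
      ≡⟨ expand ⟩
    (ψ (T ⊕ h) (m ⊕ h′) + φ (T ⊕ h) h) + φ m h ∎)
    where
    expand : (φ h′ m + (ψ T (h ⊕ m) + φ ((T ⊕ (h ⊕ m)) ⊕ h′) h′)) + φ ones h
      ≡ (ψ (T ⊕ h) (m ⊕ h′) + φ (T ⊕ h) h) + φ m h
    expand
      rewrite φ-⊕ʳ (T ⊕ (h ⊕ m)) h m | φ-⊕ʳ ((T ⊕ h) ⊕ (m ⊕ h′)) m h′ | φ-⊕ʳ ones T h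
            | φ-⊕ˡ T (h ⊕ m) h | φ-⊕ˡ T (h ⊕ m) m | φ-⊕ˡ (T ⊕ (h ⊕ m)) h′ h′ | φ-⊕ˡ T (h ⊕ m) h′
            | φ-⊕ˡ h m h | φ-⊕ˡ h m m | φ-⊕ˡ h m h′
            | φ-⊕ˡ (T ⊕ h) (m ⊕ h′) m | φ-⊕ˡ (T ⊕ h) (m ⊕ h′) h′ | φ-⊕ˡ T h m | φ-⊕ˡ T h h′ | φ-⊕ˡ T h h
            | φ-⊕ˡ m h′ m | φ-⊕ˡ m h′ h′
      = ℕS.solve 14 (λ Th Tm Tp hh hm hp mh mm mp ph pm pp oT oh →
          (pm ℕS.:+ ((((Th ℕS.:+ (hh ℕS.:+ mh)) ℕS.:+ (Tm ℕS.:+ (hm ℕS.:+ mm))) ℕS.:+ oT)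
            ℕS.:+ ((Tp ℕS.:+ (hp ℕS.:+ mp)) ℕS.:+ pp))) ℕS.:+ oh
          ℕS.:= (((((Tm ℕS.:+ hm) ℕS.:+ (mm ℕS.:+ pm)) ℕS.:+ ((Tp ℕS.:+ hp) ℕS.:+ (mp ℕS.:+ pp))) ℕS.:+ (oT ℕS.:+ oh))
            ℕS.:+ (Th ℕS.:+ hh)) ℕS.:+ mh) ≡.refl
          (φ T h) (φ T m) (φ T h′) (φ h h) (φ h m) (φ h h′) (φ m h) (φ m m) (φ m h′) (φ h′ h) (φ h′ m) (φ h′ h′)
          (φ ones T) (φ ones h)

module _ (p : Bool → Bool → Bool → Bool → Bool) where

  allColours-∷ʳ : ∀ {k} (I J K L : Label k) i j m l →
    allColours p (I ∷ʳ i) (J ∷ʳ j) (K ∷ʳ m) (L ∷ʳ l) ≡ allColours p I J K L ∧ p i j m l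
  allColours-∷ʳ []      []      []      []      i j m l = 𝔹.∧-identityʳ _
  allColours-∷ʳ (a ∷ I) (b ∷ J) (c ∷ K) (d ∷ L) i j m l =
    ≡.trans (≡.cong (p a b c d ∧_) (allColours-∷ʳ I J K L i j m l)) (≡.sym (𝔹.∧-assoc (p a b c d) _ _))

  allColours-reverse : ∀ {k} (I J K L : Label k) →
    allColours p (reverse I) (reverse J) (reverse K) (reverse L) ≡ allColours p I J K L
  allColours-reverse []      []      []      []      = ≡.refl
  allColours-reverse (i ∷ I) (j ∷ J) (m ∷ K) (l ∷ L)
    rewrite V.reverse-∷ i I | V.reverse-∷ j J | V.reverse-∷ m K | V.reverse-∷ l L
          | allColours-∷ʳ (reverse I) (reverse J) (reverse K) (reverse L) i j m l
          | allColours-reverse I J K L = 𝔹.∧-comm _ (p i j m l)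

-- Complementing the vertical edges and exchanging the horizontal ones preserves i + j = m + l.
-- Under this law i + j ≤ 1 means m + l ≤ 1, that is l ≤ 1 - m, the purple condition for the
-- complemented top edge.
whiteOK-dual : ∀ i j m l → purpleOK (not i) l (not m) j ≡ whiteOK i j m l
whiteOK-dual true  true  true  true  = ≡.refl
whiteOK-dual true  true  true  false = ≡.refl
whiteOK-dual true  true  false true  = ≡.refl
whiteOK-dual true  true  false false = ≡.refl
whiteOK-dual true  false true  true  = ≡.refl
whiteOK-dual true  false true  false = ≡.refl
whiteOK-dual true  false false true  = ≡.refl
whiteOK-dual true  false false false = ≡.refl
whiteOK-dual false true  true  true  = ≡.refl
whiteOK-dual false true  true  false = ≡.refl
whiteOK-dual false true  false true  = ≡.refl
whiteOK-dual false true  false false = ≡.refl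
whiteOK-dual false false true  true  = ≡.refl
whiteOK-dual false false true  false = ≡.refl
whiteOK-dual false false false true  = ≡.refl
whiteOK-dual false false false false = ≡.refl

-- Conservation turns j ≤ m into l ≤ i, so the complemented bottom edge and l are not both occupied.
purpleOK-dual : ∀ i j m l → whiteOK (not i) l (not m) j ≡ purpleOK i j m l
purpleOK-dual true  true  true  true  = ≡.refl
purpleOK-dual true  true  true  false = ≡.refl
purpleOK-dual true  true  false true  = ≡.refl
purpleOK-dual true  true  false false = ≡.refl
purpleOK-dual true  false true  true  = ≡.refl
purpleOK-dual true  false true  false = ≡.refl
purpleOK-dual true  false false true  = ≡.refl
purpleOK-dual true  false false false = ≡.refl
purpleOK-dual false true  true  true  = ≡.refl
purpleOK-dual false true  true  false = ≡.refl
purpleOK-dual false true  false true  = ≡.refl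
purpleOK-dual false true  false false = ≡.refl
purpleOK-dual false false true  true  = ≡.refl
purpleOK-dual false false true  false = ≡.refl
purpleOK-dual false false false true  = ≡.refl
purpleOK-dual false false false false = ≡.refl

allColours-dual : ∀ {p q} → (∀ i j m l → q (not i) l (not m) j ≡ p i j m l) → ∀ {k} (I J K L : Label k) →
  allColours q (dualLabel I) (reverse L) (dualLabel K) (reverse J) ≡ allColours p I J K L
allColours-dual {p} {q} eq I J K L = ≡.trans (allColours-reverse q (V.map not I) L (V.map not K) J) (go I J K L)
  where
  go : ∀ {k} (I J K L : Label k) → allColours q (V.map not I) L (V.map not K) J ≡ allColours p I J K L
  go []      []      []      []      = ≡.refl
  go (i ∷ I) (j ∷ J) (m ∷ K) (l ∷ L) = ≡.cong₂ _∧_ (eq i j m l) (go I J K L)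

-- Up to reversal, the second argument of φ in the dual purple weight is the set of colours using no
-- edge of the white vertex; I + J counts every other colour exactly once.
white-complement : ∀ {k} (I J K L : Label k) → allColours whiteOK I J K L ≡ true →
  (labN (V.map not K) ⊖ labN L) ⊕ (labN I ⊕ labN J) ≡ ones
white-complement []      []      []      []      _ = ≡.refl
white-complement (i ∷ I) (j ∷ J) (m ∷ K) (l ∷ L) ok = ≡.cong₂ _∷_ (one i j m l (𝔹.∧-conicalˡ _ _ ok))
  (white-complement I J K L (𝔹.∧-conicalʳ (whiteOK i j m l) _ ok))
  where
  one : ∀ i j m l → whiteOK i j m l ≡ true → (b2n (not m) ℕ.∸ b2n l) ℕ.+ (b2n i ℕ.+ b2n j) ≡ 1
  one true  true  true  true  ()
  one true  true  true  false ()
  one true  true  false true  ()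
  one true  true  false false ()
  one true  false true  true  ()
  one true  false true  false _ = ≡.refl
  one true  false false true  _ = ≡.refl
  one true  false false false ()
  one false true  true  true  ()
  one false true  true  false _ = ≡.refl
  one false true  false true  _ = ≡.refl
  one false true  false false ()
  one false false true  true  ()
  one false false true  false ()
  one false false false true  ()
  one false false false false _ = ≡.refl

purple-moves : ∀ {k} (I J K L : Label k) → allColours purpleOK I J K L ≡ true →
  labN K ≡ labN J ⊕ (labN K ⊖ labN J) × labN I ≡ (labN K ⊖ labN J) ⊕ labN L
  × (labN (V.map not I) ⊕ labN L) ⊕ (labN K ⊖ labN J) ≡ ones
purple-moves []      []      []      []      _ = ≡.refl , ≡.refl , ≡.refl
purple-moves (i ∷ I) (j ∷ J) (m ∷ K) (l ∷ L) ok
  with one i j m l (𝔹.∧-conicalˡ _ _ ok) | purple-moves I J K L (𝔹.∧-conicalʳ (purpleOK i j m l) _ ok)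
  where
  one : ∀ i j m l → purpleOK i j m l ≡ true →
    b2n m ≡ b2n j ℕ.+ (b2n m ℕ.∸ b2n j) × b2n i ≡ (b2n m ℕ.∸ b2n j) ℕ.+ b2n l
    × (b2n (not i) ℕ.+ b2n l) ℕ.+ (b2n m ℕ.∸ b2n j) ≡ 1
  one true  true  true  true  _ = ≡.refl , ≡.refl , ≡.refl
  one true  true  true  false ()
  one true  true  false true  ()
  one true  true  false false ()
  one true  false true  true  ()
  one true  false true  false _ = ≡.refl , ≡.refl , ≡.refl
  one true  false false true  _ = ≡.refl , ≡.refl , ≡.refl
  one true  false false false ()
  one false true  true  true  ()
  one false true  true  false _ = ≡.refl , ≡.refl , ≡.refl
  one false true  false true  ()
  one false true  false false ()
  one false false true  true  ()
  one false false true  false ()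
  one false false false true  ()
  one false false false false _ = ≡.refl , ≡.refl , ≡.refl
... | p , q , r | ps , qs , rs = ≡.cong₂ _∷_ p ps , ≡.cong₂ _∷_ q qs , ≡.cong₂ _∷_ r rs

Ψ : ∀ {k n} → Vec ℕ k → Vec (Label k) n → ℕ
Ψ T []       = 0
Ψ T (t ∷ ts) = ψ T (labN t) ℕ.+ Ψ (T ⊕ labN t) ts

zeros : ∀ {k} → Vec ℕ k
zeros = replicate _ 0

labN-empty : ∀ k → labN (emptyLabel {k}) ≡ zeros
labN-empty k = V.map-replicate b2n false k

⊕-identityʳ : ∀ {k} (u : Vec ℕ k) → u ⊕ zeros ≡ u
⊕-identityʳ = V.zipWith-identityʳ ℕ.+-identityʳ

total-zeros : ∀ k → total (zeros {k}) ≡ 0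
total-zeros zero    = ≡.refl
total-zeros (suc k) = total-zeros k

φ-zerosʳ : ∀ {k} (u : Vec ℕ k) → φ u zeros ≡ 0
φ-zerosʳ []              = ≡.refl
φ-zerosʳ {suc k} (a ∷ u) rewrite total-zeros k | ℕ.*-zeroʳ a = φ-zerosʳ u

eqVecB-sound : ∀ {n} (u v : Vec Bool n) → eqVecB u v ≡ true → u ≡ v
eqVecB-sound []          []          _  = ≡.refl
eqVecB-sound (true  ∷ u) (true  ∷ v) eq = ≡.cong (true ∷_) (eqVecB-sound u v eq)
eqVecB-sound (false ∷ u) (false ∷ v) eq = ≡.cong (false ∷_) (eqVecB-sound u v eq)

eqVecB-refl : ∀ {n} (u : Vec Bool n) → eqVecB u u ≡ true
eqVecB-refl []          = ≡.refl
eqVecB-refl (true  ∷ u) = eqVecB-refl u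
eqVecB-refl (false ∷ u) = eqVecB-refl u

eqVecB-⇔ : ∀ {m n} {u v : Vec Bool m} {u′ v′ : Vec Bool n} → (u ≡ v → u′ ≡ v′) → (u′ ≡ v′ → u ≡ v) →
  eqVecB u v ≡ eqVecB u′ v′
eqVecB-⇔ {u = u} {v} {u′} {v′} f g with eqVecB u v in eq | eqVecB u′ v′ in eq′
... | true  | true  = ≡.refl
... | false | false = ≡.refl
... | true  | false with ≡.refl ← f (eqVecB-sound u v eq) = ≡.trans (≡.sym (eqVecB-refl u′)) eq′
... | false | true  with ≡.refl ← g (eqVecB-sound u′ v′ eq′) = ≡.trans (≡.sym eq) (eqVecB-refl u)

eqVecB-sym : ∀ {n} (u v : Vec Bool n) → eqVecB u v ≡ eqVecB v u
eqVecB-sym []          []          = ≡.refl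
eqVecB-sym (true  ∷ u) (true  ∷ v) = eqVecB-sym u v
eqVecB-sym (true  ∷ u) (false ∷ v) = ≡.refl
eqVecB-sym (false ∷ u) (true  ∷ v) = ≡.refl
eqVecB-sym (false ∷ u) (false ∷ v) = eqVecB-sym u v

reverse-replicate : ∀ {a} {A : Set a} n (x : A) → reverse (replicate n x) ≡ replicate n x
reverse-replicate zero    x = ≡.refl
reverse-replicate (suc n) x = ≡.trans (V.reverse-∷ x (replicate n x))
  (≡.trans (≡.cong (_∷ʳ x) (reverse-replicate n x)) (snoc n))
  where
  snoc : ∀ n → replicate n x ∷ʳ x ≡ x ∷ replicate n x
  snoc zero    = ≡.refl
  snoc (suc n) = ≡.cong (x ∷_) (snoc n)

module RowDuality {c ℓr} (R : CommutativeRing c ℓr) where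
  open CommutativeRing R
  open import Relation.Binary.Reasoning.Setoid setoid
  open Sums R
  open Vertex R
  open Rows R
  open RingSolver commutativeSemiring

  -- A row with an arbitrary right label e. Duality reverses the columns, so the dual row has to be
  -- taken apart at its right end, where the cut label is not empty.
  rowTo : ∀ {k n} → VertexWeight R k → Label k → Label k → Vec (Label k) n → Vec (Label k) n → Carrier
  rowTo     w e h []       []       = [ eqVecB h e ]
  rowTo {k} w e h (b ∷ bs) (t ∷ ts) = ∑ (allLabels k) λ h′ → w b h t h′ * rowTo w e h′ bs ts

  rowTo-empty : ∀ {k n} (w : VertexWeight R k) h (bs ts : Vec (Label k) n) →
    rowTo w emptyLabel h bs ts ≈ rowWeight R w h bs ts
  rowTo-empty w h []       []       = refl
  rowTo-empty {k} w h (b ∷ bs) (t ∷ ts) = trans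
    (∑-cong (allLabels k) λ h′ → *-congˡ (rowTo-empty w h′ bs ts)) (sym (rowWeight-∷ w h b t bs ts))

  rowTo-∷ʳ : ∀ {k n} (w : VertexWeight R k) e h (bs ts : Vec (Label k) n) b t →
    rowTo w e h (bs ∷ʳ b) (ts ∷ʳ t) ≈ ∑ (allLabels k) λ g → rowTo w g h bs ts * w b g t e
  rowTo-∷ʳ {k} w e h [] [] b t = begin
    ∑ Ls (λ g → w b h t g * [ eqVecB g e ])
      ≈⟨ ∑-cong Ls (λ g → *-comm _ _) ⟩
    ∑ Ls (λ g → [ eqVecB g e ] * w b h t g)
      ≈⟨ allLabels-sift e (λ g → w b h t g) ⟩
    w b h t e
      ≈⟨ allLabels-sift h (λ g → w b g t e) ⟨
    ∑ Ls (λ g → [ eqVecB g h ] * w b g t e)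
      ≈⟨ ∑-cong Ls (λ g → *-congʳ (reflexive (≡.cong [_] (eqVecB-sym g h)))) ⟩
    ∑ Ls (λ g → [ eqVecB h g ] * w b g t e) ∎
    where Ls = allLabels k
  rowTo-∷ʳ {k} w e h (b₀ ∷ bs) (t₀ ∷ ts) b t = begin
    _ ≈⟨ ∑-cong Ls (λ h′ → *-congˡ (rowTo-∷ʳ w e h′ bs ts b t)) ⟩
    _ ≈⟨ ∑-cong Ls (λ h′ → *-distribˡ-∑ Ls _ _) ⟩
    _ ≈⟨ ∑-swap Ls Ls _ ⟩
    _ ≈⟨ ∑-cong Ls (λ g → ∑-cong Ls λ h′ → *-assoc _ _ _) ⟨
    _ ≈⟨ ∑-cong Ls (λ g → *-distribʳ-∑ Ls _ _) ⟨
    _ ∎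
    where Ls = allLabels k

  -- Both kinds of rows are treated at once: X is the flux term of a horizontal edge and `w°` is `w`
  -- without its power of x. That power belongs to the right edge h′, but reflection makes the left
  -- edge h the right edge of the dual vertex; hence the factor x^|h| in `local`, which is handed on
  -- from column to column.
  module _ {k} (τ x : Carrier) (w w* w° : VertexWeight R k) (X : Vec ℕ k → Vec ℕ k → ℕ)
    (X-zeros : ∀ T → X T zeros ≡ 0)
    (w-w° : ∀ b h t h′ → w b h t h′ ≈ pow R x (card h′) * w° b h t h′)
    (local : ∀ b h t h′ →
      (w° b h t h′ ≈ 0# × w* (dualLabel b) (reverse h′) (dualLabel t) (reverse h) ≈ 0#)
      ⊎ (labN b ⊕ labN h ≡ labN t ⊕ labN h′
         × (∀ T → pow R x (card h) * (w° b h t h′ * pow R τ (ψ T (labN t) ℕ.+ X (T ⊕ labN t) (labN h′)))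
              ≈ pow R τ (ψ (T ⊕ labN h) (labN b) ℕ.+ X T (labN h))
                * w* (dualLabel b) (reverse h′) (dualLabel t) (reverse h))))
    where

    private
      τ^ : ℕ → Carrier
      τ^ = pow R τ
      Ls : List (Label k)
      Ls = allLabels k

    row-dual-from : ∀ {n} T h (bs ts : Vec (Label k) n) →
      pow R x (card h) * (τ^ (Ψ T ts) * rowTo w emptyLabel h bs ts)
      ≈ τ^ (Ψ (T ⊕ labN h) bs ℕ.+ X T (labN h)) * rowTo w* (reverse h) emptyLabel (dual bs) (dual ts)
    row-dual-from T h [] [] = begin
      _ ≈⟨ solve 2 (λ a b → a :* (con 1 :* b) := b :* a) refl _ _ ⟩
      [ eqVecB h emptyLabel ] * pow R x (card h)
        ≈⟨ absorb (support h) (λ { ≡.refl → reflexive (≡.trans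
             (≡.cong (pow R x) (card-empty k))
             (≡.cong τ^ (≡.sym (≡.trans (≡.cong (X T) (labN-empty k)) (X-zeros T))))) }) ⟩
      [ eqVecB h emptyLabel ] * τ^ (X T (labN h))
        ≈⟨ *-comm _ _ ⟩
      τ^ (X T (labN h)) * [ eqVecB h emptyLabel ]
        ≡⟨ ≡.cong (λ ok → τ^ (X T (labN h)) * [ ok ]) (≡.trans (eqVecB-⇔ {u = h} {emptyLabel} {reverse h} {reverse emptyLabel} (≡.cong reverse) V.reverse-injective)
             (≡.trans (eqVecB-sym (reverse h) (reverse emptyLabel)) (≡.cong (λ z → eqVecB z (reverse h)) (reverse-replicate k false)))) ⟩
      _ ∎
      where
      support : ∀ h → [ eqVecB h emptyLabel ] ≈ 0# ⊎ h ≡ emptyLabel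
      support h with eqVecB h emptyLabel in eq
      ... | false = inj₁ refl
      ... | true  = inj₂ (eqVecB-sound h emptyLabel eq)
    row-dual-from T h (b ∷ bs) (t ∷ ts) = begin
      _ ≈⟨ *-congˡ (*-distribˡ-∑ Ls _ _) ⟩
      _ ≈⟨ *-distribˡ-∑ Ls _ _ ⟩
      _ ≈⟨ ∑-cong Ls step ⟩
      _ ≈⟨ *-distribˡ-∑ Ls _ _ ⟨
      -- The left edge of the last dual vertex carries `reverse h′`; reversal permutes the labels,
      -- so g runs through all of them.
      _ ≈⟨ *-congˡ (∑-allVecs-reverse Bools k (λ g → rowTo w* g emptyLabel (dual bs) (dual ts)
             * w* (dualLabel b) g (dualLabel t) (reverse h))) ⟩
      _ ≈⟨ *-congˡ (rowTo-∷ʳ w* (reverse h) emptyLabel (dual bs) (dual ts) (dualLabel b) (dualLabel t)) ⟨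
      _ ≡⟨ ≡.cong₂ (λ p q → τ^ (Ψ (T ⊕ labN h) (b ∷ bs) ℕ.+ X T (labN h)) * rowTo w* (reverse h) emptyLabel p q)
             (dual-∷ b bs) (dual-∷ t ts) ⟨
      _ ∎
      where
      T′ = T ⊕ labN t
      dual-row : Label k → Carrier
      dual-row h′ = rowTo w* (reverse h′) emptyLabel (dual bs) (dual ts)
      dual-w : Label k → Carrier
      dual-w h′ = w* (dualLabel b) (reverse h′) (dualLabel t) (reverse h)
      vertex : ∀ h′ → pow R x (card h) * (w° b h t h′ * τ^ (ψ T (labN t)))
        * (τ^ (Ψ (T′ ⊕ labN h′) bs ℕ.+ X T′ (labN h′)))
        ≈ τ^ (Ψ (T ⊕ labN h) (b ∷ bs) ℕ.+ X T (labN h)) * dual-w h′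
      vertex h′ with local b h t h′
      ... | inj₁ (w°≈0 , w*≈0) = begin
        _ ≈⟨ *-congʳ (*-congˡ (*-congʳ w°≈0)) ⟩
        _ ≈⟨ solve 4 (λ a b c d → a :* (con 0 :* b) :* c := d :* con 0) refl _ _ _ _ ⟩
        _ ≈⟨ *-congˡ w*≈0 ⟨
        _ ∎
      ... | inj₂ (conserve , eq) = begin
        _ ≈⟨ *-congˡ (pow-+ τ (Ψ (T′ ⊕ labN h′) bs) _) ⟩
        _ ≈⟨ solve 5 (λ a b c d e → a :* (b :* c) :* (d :* e) := (a :* (b :* (c :* e))) :* d) refl _ _ _ _ _ ⟩
        _ ≈⟨ *-congʳ (*-congˡ (*-congˡ (pow-+ τ (ψ T (labN t)) _))) ⟨
        _ ≈⟨ *-cong (eq T) (reflexive (≡.cong (λ u → τ^ (Ψ u bs)) T′⊕h′)) ⟩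
        _ ≈⟨ *-congʳ (*-congʳ (pow-+ τ (ψ (T ⊕ labN h) (labN b)) _)) ⟩
        _ ≈⟨ solve 4 (λ a b c d → ((a :* b) :* c) :* d := ((a :* d) :* b) :* c) refl _ _ _ _ ⟩
        _ ≈⟨ *-congʳ (trans (pow-+ τ (Ψ (T ⊕ labN h) (b ∷ bs)) _)
               (*-congʳ (pow-+ τ (ψ (T ⊕ labN h) (labN b)) _))) ⟨
        _ ∎
        where
        -- Both sides count the particles of the bottom row up to and including this column.
        T′⊕h′ : T′ ⊕ labN h′ ≡ (T ⊕ labN h) ⊕ labN b
        T′⊕h′ = ≡.trans (V.zipWith-assoc ℕ.+-assoc T (labN t) (labN h′))
          (≡.trans (≡.cong (T ⊕_) (≡.trans (≡.sym conserve) (V.zipWith-comm ℕ.+-comm (labN b) (labN h))))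
            (≡.sym (V.zipWith-assoc ℕ.+-assoc T (labN h) (labN b))))
      step : ∀ h′ → pow R x (card h) * (τ^ (Ψ T (t ∷ ts)) * (w b h t h′ * rowTo w emptyLabel h′ bs ts))
        ≈ τ^ (Ψ (T ⊕ labN h) (b ∷ bs) ℕ.+ X T (labN h)) * (dual-row h′ * dual-w h′)
      step h′ = begin
        _ ≈⟨ *-congˡ (*-cong (pow-+ τ (ψ T (labN t)) _) (*-congʳ (w-w° b h t h′))) ⟩
        _ ≈⟨ solve 6 (λ a b c d e f → a :* ((b :* c) :* ((d :* e) :* f)) := (a :* (e :* b)) :* (d :* (c :* f)))
               refl _ _ _ _ _ _ ⟩
        _ ≈⟨ *-congˡ (row-dual-from T′ h′ bs ts) ⟩
        _ ≈⟨ *-assoc _ _ _ ⟨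
        _ ≈⟨ *-congʳ (vertex h′) ⟩
        _ ≈⟨ solve 3 (λ a b c → (a :* b) :* c := a :* (c :* b)) refl _ _ _ ⟩
        _ ∎

    row-dual : ∀ {n} (bs ts : Vec (Label k) n) →
      τ^ (Ψ zeros ts) * rowWeight R w emptyLabel bs ts
      ≈ τ^ (Ψ zeros bs) * rowWeight R w* emptyLabel (dual bs) (dual ts)
    row-dual bs ts = begin
      τ^ (Ψ zeros ts) * rowWeight R w emptyLabel bs ts
        ≈⟨ *-congˡ (rowTo-empty w emptyLabel bs ts) ⟨
      τ^ (Ψ zeros ts) * rowTo w emptyLabel emptyLabel bs ts
        ≈⟨ *-identityˡ _ ⟨
      1# * (τ^ (Ψ zeros ts) * rowTo w emptyLabel emptyLabel bs ts)
        ≡⟨ ≡.cong (λ n → pow R x n * (τ^ (Ψ zeros ts) * rowTo w emptyLabel emptyLabel bs ts)) (card-empty k) ⟨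
      pow R x (card (emptyLabel {k})) * (τ^ (Ψ zeros ts) * rowTo w emptyLabel emptyLabel bs ts)
        ≈⟨ row-dual-from zeros emptyLabel bs ts ⟩
      τ^ (Ψ (zeros ⊕ labN emptyLabel) bs ℕ.+ X zeros (labN emptyLabel))
        * rowTo w* (reverse emptyLabel) emptyLabel (dual bs) (dual ts)
        ≡⟨ ≡.cong₂ (λ u e → τ^ (Ψ (zeros ⊕ u) bs ℕ.+ X zeros u) * rowTo w* e emptyLabel (dual bs) (dual ts))
             (labN-empty k) (reverse-replicate k false) ⟩
      τ^ (Ψ (zeros ⊕ zeros) bs ℕ.+ X zeros zeros) * rowTo w* emptyLabel emptyLabel (dual bs) (dual ts)
        ≡⟨ ≡.cong₂ (λ u n → τ^ (Ψ u bs ℕ.+ n) * rowTo w* emptyLabel emptyLabel (dual bs) (dual ts))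
             (⊕-identityʳ zeros) (X-zeros zeros) ⟩
      τ^ (Ψ zeros bs ℕ.+ 0) * rowTo w* emptyLabel emptyLabel (dual bs) (dual ts)
        ≈⟨ *-cong (reflexive (≡.cong τ^ (ℕ.+-identityʳ (Ψ zeros bs)))) (rowTo-empty w* emptyLabel (dual bs) (dual ts)) ⟩
      τ^ (Ψ zeros bs) * rowWeight R w* emptyLabel (dual bs) (dual ts) ∎

  module _ (τ τ⁻¹ : Carrier) (ττ⁻¹ : τ * τ⁻¹ ≈ 1#) (x : Carrier) {k : ℕ} where
    open OneColour _+_ _*_ 0# 1# using (if01)

    private
      τ^ : ℕ → Carrier
      τ^ = pow R τ

    pow-balance : ∀ m n p → m ℕ.+ n ≡ p → τ^ m ≈ τ^ p * pow R τ⁻¹ n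
    pow-balance m n p eq = begin
      τ^ m                            ≈⟨ *-identityʳ _ ⟨
      τ^ m * 1#                       ≈⟨ *-congˡ (pow-inverse ττ⁻¹ n) ⟨
      τ^ m * (τ^ n * pow R τ⁻¹ n)     ≈⟨ *-assoc _ _ _ ⟨
      (τ^ m * τ^ n) * pow R τ⁻¹ n     ≈⟨ *-congʳ (pow-+ τ m n) ⟨
      τ^ (m ℕ.+ n) * pow R τ⁻¹ n      ≡⟨ ≡.cong (λ p → τ^ p * pow R τ⁻¹ n) eq ⟩
      τ^ p * pow R τ⁻¹ n              ∎

    weight-balance : ∀ c c* n s n* p → c* ≡ c → (n ℕ.+ s) ℕ.+ n* ≡ p →
      pow R x c * (τ^ n * τ^ s) ≈ τ^ p * (pow R x c* * pow R τ⁻¹ n*)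
    weight-balance c c* n s n* p ≡.refl eq = begin
      pow R x c * (τ^ n * τ^ s)            ≈⟨ *-congˡ (pow-+ τ n s) ⟨
      pow R x c * τ^ (n ℕ.+ s)             ≈⟨ *-congˡ (pow-balance (n ℕ.+ s) n* p eq) ⟩
      pow R x c * (τ^ p * pow R τ⁻¹ n*)    ≈⟨ solve 3 (λ a b c → a :* (b :* c) := b :* (a :* c)) refl _ _ _ ⟩
      τ^ p * (pow R x c * pow R τ⁻¹ n*)    ∎

    weight-if01 : ∀ ok c n → weight ok x c τ n ≈ pow R x c * if01 ok (τ^ n)
    weight-if01 true  c n = refl
    weight-if01 false c n = sym (zeroʳ _)

    white-row-dual : ∀ {n} (bs ts : Vec (Label k) n) →
      τ^ (Ψ zeros ts) * rowWeight R (whiteW R τ x) emptyLabel bs ts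
      ≈ τ^ (Ψ zeros bs) * rowWeight R (purpleW R τ⁻¹ x) emptyLabel (dual bs) (dual ts)
    white-row-dual = row-dual τ x (whiteW R τ x) (purpleW R τ⁻¹ x) w° φ φ-zerosʳ
      (λ b h t h′ → trans (reflexive (whiteW-weight τ x b h t h′)) (weight-if01 (allColours whiteOK b h t h′) (card h′) (φ (labN h′) (labN b ⊕ labN h)))) local
      where
      w° : VertexWeight R k
      w° b h t h′ = if01 (allColours whiteOK b h t h′) (τ^ (φ (labN h′) (labN b ⊕ labN h)))
      local : ∀ b h t h′ →
        (w° b h t h′ ≈ 0# × purpleW R τ⁻¹ x (dualLabel b) (reverse h′) (dualLabel t) (reverse h) ≈ 0#)
        ⊎ (labN b ⊕ labN h ≡ labN t ⊕ labN h′
           × (∀ T → pow R x (card h) * (w° b h t h′ * τ^ (ψ T (labN t) ℕ.+ φ (T ⊕ labN t) (labN h′)))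
                ≈ τ^ (ψ (T ⊕ labN h) (labN b) ℕ.+ φ T (labN h))
                  * purpleW R τ⁻¹ x (dualLabel b) (reverse h′) (dualLabel t) (reverse h)))
      local b h t h′
        rewrite purpleW-weight τ⁻¹ x (dualLabel b) (reverse h′) (dualLabel t) (reverse h)
        with allColours whiteOK b h t h′ in ok
           | allColours purpleOK (dualLabel b) (reverse h′) (dualLabel t) (reverse h)
           | allColours-dual {whiteOK} {purpleOK} whiteOK-dual b h t h′
      ... | false | _ | ≡.refl = inj₁ (refl , refl)
      ... | true  | _ | ≡.refl = inj₂ (conserve , λ T → weight-balance (card h) (card (reverse h)) (φ (labN h′) (labN b ⊕ labN h))
              (ψ T (labN t) ℕ.+ φ (T ⊕ labN t) (labN h′))
              (φ (labN (reverse h)) (labN (dualLabel t) ⊖ labN (reverse h′)))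
              (ψ (T ⊕ labN h) (labN b) ℕ.+ φ T (labN h)) (card-reverse h) (balance T))
        where
        conserve = allColours-conserve whiteOK-conserve b h t h′ ok
        exponent : φ (labN (reverse h)) (labN (dualLabel t) ⊖ labN (reverse h′))
          ≡ φ (labN (V.map not t) ⊖ labN h′) (labN h)
        exponent = ≡.trans (≡.cong₂ φ (V.map-reverse b2n h) (≡.trans
          (≡.cong₂ _⊖_ (V.map-reverse b2n (V.map not t)) (V.map-reverse b2n h′))
          (zipWith-reverse ℕ._∸_ (labN (V.map not t)) (labN h′))))
          (φ-reverse (labN h) (labN (V.map not t) ⊖ labN h′))
        balance : ∀ T → (φ (labN h′) (labN b ⊕ labN h)
            ℕ.+ (ψ T (labN t) ℕ.+ φ (T ⊕ labN t) (labN h′)))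
          ℕ.+ φ (labN (reverse h)) (labN (dualLabel t) ⊖ labN (reverse h′))
          ≡ ψ (T ⊕ labN h) (labN b) ℕ.+ φ T (labN h)
        balance T = ≡.trans
          (≡.cong (φ (labN h′) (labN b ⊕ labN h) ℕ.+ (ψ T (labN t) ℕ.+ φ (T ⊕ labN t) (labN h′)) ℕ.+_) exponent)
          (white-balance T (labN b) (labN h) (labN t) (labN h′) (labN (V.map not t) ⊖ labN h′)
            conserve (white-complement b h t h′ ok))

    purple-row-dual : ∀ {n} (bs ts : Vec (Label k) n) →
      τ^ (Ψ zeros ts) * rowWeight R (purpleW R τ x) emptyLabel bs ts
      ≈ τ^ (Ψ zeros bs) * rowWeight R (whiteW R τ⁻¹ x) emptyLabel (dual bs) (dual ts)
    purple-row-dual = row-dual τ x (purpleW R τ x) (whiteW R τ⁻¹ x) w° (λ T h → φ (T ⊕ h) h) (λ T → φ-zerosʳ (T ⊕ zeros))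
      (λ b h t h′ → trans (reflexive (purpleW-weight τ x b h t h′)) (weight-if01 (allColours purpleOK b h t h′) (card h′) (φ (labN h′) (labN t ⊖ labN h)))) local
      where
      w° : VertexWeight R k
      w° b h t h′ = if01 (allColours purpleOK b h t h′) (τ^ (φ (labN h′) (labN t ⊖ labN h)))
      local : ∀ b h t h′ →
        (w° b h t h′ ≈ 0# × whiteW R τ⁻¹ x (dualLabel b) (reverse h′) (dualLabel t) (reverse h) ≈ 0#)
        ⊎ (labN b ⊕ labN h ≡ labN t ⊕ labN h′
           × (∀ T → pow R x (card h) * (w° b h t h′ * τ^ (ψ T (labN t) ℕ.+ φ ((T ⊕ labN t) ⊕ labN h′) (labN h′)))
                ≈ τ^ (ψ (T ⊕ labN h) (labN b) ℕ.+ φ (T ⊕ labN h) (labN h))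
                  * whiteW R τ⁻¹ x (dualLabel b) (reverse h′) (dualLabel t) (reverse h)))
      local b h t h′
        rewrite whiteW-weight τ⁻¹ x (dualLabel b) (reverse h′) (dualLabel t) (reverse h)
        with allColours purpleOK b h t h′ in ok
           | allColours whiteOK (dualLabel b) (reverse h′) (dualLabel t) (reverse h)
           | allColours-dual {purpleOK} {whiteOK} purpleOK-dual b h t h′
      ... | false | _ | ≡.refl = inj₁ (refl , refl)
      ... | true  | _ | ≡.refl = inj₂ (allColours-conserve purpleOK-conserve b h t h′ ok ,
              λ T → weight-balance (card h) (card (reverse h)) (φ (labN h′) (labN t ⊖ labN h))
              (ψ T (labN t) ℕ.+ φ ((T ⊕ labN t) ⊕ labN h′) (labN h′))
              (φ (labN (reverse h)) (labN (dualLabel b) ⊕ labN (reverse h′)))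
              (ψ (T ⊕ labN h) (labN b) ℕ.+ φ (T ⊕ labN h) (labN h)) (card-reverse h) (balance T))
        where
        exponent : φ (labN (reverse h)) (labN (dualLabel b) ⊕ labN (reverse h′))
          ≡ φ (labN (V.map not b) ⊕ labN h′) (labN h)
        exponent = ≡.trans (≡.cong₂ φ (V.map-reverse b2n h) (≡.trans
          (≡.cong₂ _⊕_ (V.map-reverse b2n (V.map not b)) (V.map-reverse b2n h′))
          (zipWith-reverse ℕ._+_ (labN (V.map not b)) (labN h′))))
          (φ-reverse (labN h) (labN (V.map not b) ⊕ labN h′))
        balance : ∀ T → (φ (labN h′) (labN t ⊖ labN h)
            ℕ.+ (ψ T (labN t) ℕ.+ φ ((T ⊕ labN t) ⊕ labN h′) (labN h′)))
          ℕ.+ φ (labN (reverse h)) (labN (dualLabel b) ⊕ labN (reverse h′))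
          ≡ ψ (T ⊕ labN h) (labN b) ℕ.+ φ (T ⊕ labN h) (labN h)
        balance T with t≡ , b≡ , complement ← purple-moves b h t h′ ok = ≡.trans
          (≡.cong (φ (labN h′) (labN t ⊖ labN h)
            ℕ.+ (ψ T (labN t) ℕ.+ φ ((T ⊕ labN t) ⊕ labN h′) (labN h′)) ℕ.+_) exponent)
          (purple-balance T (labN b) (labN h) (labN t) (labN h′) (labN t ⊖ labN h) t≡ b≡
            (labN (V.map not b) ⊕ labN h′) complement)

-- Stacks of rows

eqConfig : ∀ {k n} → Vec (Label k) n → Vec (Label k) n → Bool
eqConfig = eqVec eqVecB

eqVecB-++ : ∀ {m n} (u v : Vec Bool m) (u′ v′ : Vec Bool n) →
  eqVecB (u V.++ u′) (v V.++ v′) ≡ eqVecB u v ∧ eqVecB u′ v′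
eqVecB-++ []      []      u′ v′ = ≡.refl
eqVecB-++ (a ∷ u) (b ∷ v) u′ v′ = ≡.trans (≡.cong (eqBool a b ∧_) (eqVecB-++ u v u′ v′))
  (≡.sym (𝔹.∧-assoc (eqBool a b) _ _))

eqVecB-concat : ∀ {k n} (s t : Vec (Label k) n) → eqVecB (V.concat s) (V.concat t) ≡ eqConfig s t
eqVecB-concat []      []      = ≡.refl
eqVecB-concat (a ∷ s) (b ∷ t) = ≡.trans (eqVecB-++ a b _ _) (≡.cong (eqVecB a b ∧_) (eqVecB-concat s t))

eqConfig-++ : ∀ {k m n} (s t : Vec (Label k) m) (s′ t′ : Vec (Label k) n) →
  eqConfig (s V.++ s′) (t V.++ t′) ≡ eqConfig s t ∧ eqConfig s′ t′
eqConfig-++ []      []      s′ t′ = ≡.refl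
eqConfig-++ (a ∷ s) (b ∷ t) s′ t′ = ≡.trans (≡.cong (eqVecB a b ∧_) (eqConfig-++ s t s′ t′))
  (≡.sym (𝔹.∧-assoc (eqVecB a b) _ _))

concat-injective : ∀ {k n} (s t : Vec (Label k) n) → V.concat s ≡ V.concat t → s ≡ t
concat-injective []      []      _  = ≡.refl
concat-injective (a ∷ s) (b ∷ t) eq = ≡.cong₂ _∷_ (proj₁ (V.++-injective a b eq))
  (concat-injective s t (proj₂ (V.++-injective a b eq)))

map-injective : ∀ {a b} {A : Set a} {B : Set b} {f : A → B} → (∀ {x y} → f x ≡ f y → x ≡ y) →
  ∀ {n} {u v : Vec A n} → V.map f u ≡ V.map f v → u ≡ v
map-injective inj {u = []}    {[]}    _  = ≡.refl
map-injective inj {u = x ∷ u} {y ∷ v} eq =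
  ≡.cong₂ _∷_ (inj (V.∷-injectiveˡ eq)) (map-injective inj (V.∷-injectiveʳ eq))

dual-injective : ∀ {k n} {s t : Vec (Label k) n} → dual s ≡ dual t → s ≡ t
dual-injective eq = map-injective (λ eq → map-injective 𝔹.not-injective (V.reverse-injective eq)) (V.reverse-injective eq)

empties : ∀ {k} n → Vec (Label k) n
empties n = replicate n emptyLabel

⊕-empty : ∀ {k} (b h : Label k) → labN b ⊕ labN h ≡ labN (emptyLabel {k}) ⊕ labN emptyLabel →
  b ≡ emptyLabel × h ≡ emptyLabel
⊕-empty []          []          _  = ≡.refl , ≡.refl
⊕-empty (true  ∷ b) (_ ∷ h)     eq with () ← V.∷-injectiveˡ eq
⊕-empty (false ∷ b) (true  ∷ h) eq with () ← V.∷-injectiveˡ eq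
⊕-empty (false ∷ b) (false ∷ h) eq with ≡.refl , ≡.refl ← ⊕-empty b h (V.∷-injectiveʳ eq) = ≡.refl , ≡.refl

module Stacks {c ℓr} (R : CommutativeRing c ℓr) where
  open CommutativeRing R
  open import Relation.Binary.Reasoning.Setoid setoid
  open Sums R
  open Vertex R
  open Rows R
  open RowDuality R
  open RingSolver commutativeSemiring

  configs : ∀ k n → List (Vec (Label k) n)
  configs k n = allVecs (allLabels k) n

  configs-sift : ∀ {k n} → Sifts (configs k n) eqConfig
  configs-sift {n = n} = ∑-allVecs-sift allLabels-sift n

  stackWeight-[] : ∀ {k n} (bot top : Vec (Label k) n) → stackWeight R [] bot top ≈ [ eqConfig bot top ]
  stackWeight-[] bot top = reflexive (≡.cong [_] (eqVecB-concat bot top))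

  -- The empty stack is the identity transfer matrix. A one-row stack, defined without a sum, thus
  -- obeys the same recursion as the others.
  stackWeight-∷ : ∀ {k n} (w : VertexWeight R k) ws (bot top : Vec (Label k) n) →
    stackWeight R (w ∷ ws) bot top
    ≈ ∑ (configs k n) (λ s → rowWeight R w emptyLabel bot s * stackWeight R ws s top)
  stackWeight-∷ {k} {n} w [] bot top = begin
    rowWeight R w emptyLabel bot top
      ≈⟨ configs-sift top (rowWeight R w emptyLabel bot) ⟨
    ∑ (configs k n) (λ s → [ eqConfig s top ] * rowWeight R w emptyLabel bot s)
      ≈⟨ ∑-cong _ (λ s → trans (*-comm _ _) (*-congˡ (sym (stackWeight-[] s top)))) ⟩
    _ ∎
  stackWeight-∷ w (_ ∷ _) bot top = reflexive (≡.sym (∑-sumR _ _))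

  infix 4 _≋_
  _≋_ : ∀ {k} → List (VertexWeight R k) → List (VertexWeight R k) → Set _
  ws ≋ ws′ = ∀ {n} (bot top : Vec (Label _) n) → stackWeight R ws bot top ≈ stackWeight R ws′ bot top

  ≋-∷ : ∀ {k} (w : VertexWeight R k) ws ws′ → ws ≋ ws′ → w ∷ ws ≋ w ∷ ws′
  ≋-∷ w ws ws′ eq bot top = begin
    _ ≈⟨ stackWeight-∷ w ws bot top ⟩
    _ ≈⟨ ∑-cong _ (λ s → *-congˡ (eq s top)) ⟩
    _ ≈⟨ stackWeight-∷ w ws′ bot top ⟨
    _ ∎

  Commute : ∀ {k} → VertexWeight R k → VertexWeight R k → Set _
  Commute {k} w p = ∀ {n} (bs ts : Vec (Label k) n) →
    ∑ (configs k n) (λ s → rowWeight R w emptyLabel bs s * rowWeight R p emptyLabel s ts)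
    ≈ ∑ (configs k n) (λ s → rowWeight R p emptyLabel bs s * rowWeight R w emptyLabel s ts)

  stackWeight-∷∷ : ∀ {k n} (w p : VertexWeight R k) ws (bot top : Vec (Label k) n) →
    stackWeight R (w ∷ p ∷ ws) bot top ≈ ∑ (configs k n) (λ s′ →
      ∑ (configs k n) (λ s → rowWeight R w emptyLabel bot s * rowWeight R p emptyLabel s s′) * stackWeight R ws s′ top)
  stackWeight-∷∷ {k} {n} w p ws bot top = begin
    _ ≈⟨ stackWeight-∷ w (p ∷ ws) bot top ⟩
    _ ≈⟨ ∑-cong Ss (λ s → *-congˡ (stackWeight-∷ p ws s top)) ⟩
    _ ≈⟨ ∑-cong Ss (λ s → trans (*-distribˡ-∑ Ss _ _) (∑-cong Ss λ s′ → sym (*-assoc _ _ _))) ⟩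
    _ ≈⟨ ∑-swap Ss Ss _ ⟩
    _ ≈⟨ ∑-cong Ss (λ s′ → *-distribʳ-∑ Ss _ _) ⟨
    _ ∎
    where
    Ss = configs k n

  ≋-swap : ∀ {k} {w p : VertexWeight R k} ws → Commute w p → w ∷ p ∷ ws ≋ p ∷ w ∷ ws
  ≋-swap {w = w} {p} ws comm bot top = begin
    _ ≈⟨ stackWeight-∷∷ w p ws bot top ⟩
    _ ≈⟨ ∑-cong _ (λ s′ → *-congʳ (comm bot s′)) ⟩
    _ ≈⟨ stackWeight-∷∷ p w ws bot top ⟨
    _ ∎

  ≋-shift : ∀ {k} {w : VertexWeight R k} {ps} → All (Commute w) ps → ∀ ws → w ∷ ps ++ ws ≋ ps ++ w ∷ ws
  ≋-shift []                          ws bot top = refl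
  ≋-shift {w = w} {p ∷ ps} (cp ∷ cps) ws bot top =
    trans (≋-swap {w = w} {p} (ps ++ ws) cp bot top) (≋-∷ p (w ∷ ps ++ ws) (ps ++ w ∷ ws) (≋-shift cps ws) bot top)

  ≋-++-comm : ∀ {k} {ws ps : List (VertexWeight R k)} → All (λ w → All (Commute w) ps) ws → ws ++ ps ≋ ps ++ ws
  ≋-++-comm {ps = ps} [] bot top = reflexive (≡.cong (λ rs → stackWeight R rs bot top) (≡.sym (++-identityʳ ps)))
    where open import Data.List.Properties using (++-identityʳ)
  ≋-++-comm {ws = w ∷ ws} {ps} (cw ∷ cws) bot top =
    trans (≋-∷ w (ws ++ ps) (ps ++ ws) (≋-++-comm cws) bot top) (≋-shift cw ws bot top)

  ∑-dualLabel : ∀ {k} (f : Label k → Carrier) → ∑ (allLabels k) (λ L → f (dualLabel L)) ≈ ∑ (allLabels k) f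
  ∑-dualLabel {k} f = trans
    (∑-allVecs-map Bools not (λ f → trans (∑-Bools λ b → f (not b)) (trans
      (solve 2 (λ a b → a :+ (b :+ con 0) := b :+ (a :+ con 0)) refl _ _) (sym (∑-Bools f)))) k (λ L → f (reverse L)))
    (∑-allVecs-reverse Bools k f)

  ∑-dual : ∀ {k n} (f : Vec (Label k) n → Carrier) → ∑ (configs k n) (λ s → f (dual s)) ≈ ∑ (configs k n) f
  ∑-dual {k} {n} f = trans (∑-allVecs-map (allLabels k) dualLabel ∑-dualLabel n (λ s → f (reverse s)))
    (∑-allVecs-reverse (allLabels k) n f)

  module _ (τ : Carrier) where

    RowDual : ∀ {k} → VertexWeight R k → VertexWeight R k → Set _
    RowDual {k} w w* = ∀ {n} (bs ts : Vec (Label k) n) →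
      pow R τ (Ψ zeros ts) * rowWeight R w emptyLabel bs ts
      ≈ pow R τ (Ψ zeros bs) * rowWeight R w* emptyLabel (dual bs) (dual ts)

    -- The power of τ at an intermediate configuration s is produced by the stack above it and
    -- consumed by the row below, so the potentials telescope without any division.
    stack-dual : ∀ {k} {ws ws* : List (VertexWeight R k)} → Pointwise RowDual ws ws* →
      ∀ {n} (bot top : Vec (Label k) n) →
      pow R τ (Ψ zeros top) * stackWeight R ws bot top
      ≈ pow R τ (Ψ zeros bot) * stackWeight R ws* (dual bot) (dual top)
    stack-dual [] bot top = begin
      _ ≈⟨ *-comm _ _ ⟩
      _ ≈⟨ absorb support (λ { ≡.refl → refl }) ⟩
      _ ≈⟨ *-comm _ _ ⟩
      _ ≡⟨ ≡.cong (λ ok → pow R τ (Ψ zeros bot) * [ ok ])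
             (eqVecB-⇔ {u = V.concat bot} {V.concat top} {V.concat (dual bot)} {V.concat (dual top)}
               (λ eq → ≡.cong (λ s → V.concat (dual s)) (concat-injective bot top eq))
               (λ eq → ≡.cong V.concat (dual-injective {s = bot} {top} (concat-injective (dual bot) (dual top) eq)))) ⟩
      _ ∎
      where
      support : stackWeight R [] bot top ≈ 0# ⊎ bot ≡ top
      support with eqVecB (V.concat bot) (V.concat top) in eq
      ... | false = inj₁ refl
      ... | true  = inj₂ (concat-injective bot top (eqVecB-sound _ _ eq))
    stack-dual {k} {w ∷ ws} {w* ∷ ws*} (dw ∷ dws) {n} bot top = begin
      _ ≈⟨ *-congˡ (stackWeight-∷ w ws bot top) ⟩
      _ ≈⟨ *-distribˡ-∑ Ss _ _ ⟩
      _ ≈⟨ ∑-cong Ss step ⟩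
      _ ≈⟨ *-distribˡ-∑ Ss _ _ ⟨
      _ ≈⟨ *-congˡ (∑-dual (λ s → rowWeight R w* emptyLabel (dual bot) s * stackWeight R ws* s (dual top))) ⟩
      _ ≈⟨ *-congˡ (stackWeight-∷ w* ws* (dual bot) (dual top)) ⟨
      _ ∎
      where
      Ss = configs k n
      step : ∀ s → pow R τ (Ψ zeros top) * (rowWeight R w emptyLabel bot s * stackWeight R ws s top)
        ≈ pow R τ (Ψ zeros bot) * (rowWeight R w* emptyLabel (dual bot) (dual s) * stackWeight R ws* (dual s) (dual top))
      step s = begin
        _ ≈⟨ solve 3 (λ a b c → a :* (b :* c) := b :* (a :* c)) refl _ _ _ ⟩
        _ ≈⟨ *-congˡ (stack-dual dws s top) ⟩
        _ ≈⟨ solve 3 (λ a b c → a :* (b :* c) := (b :* a) :* c) refl _ _ _ ⟩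
        _ ≈⟨ *-congʳ (dw bot s) ⟩
        _ ≈⟨ *-assoc _ _ _ ⟩
        _ ∎

  -- Removal of surplus empty columns

  record Conservative {k} (w : VertexWeight R k) : Set (c ⊔ ℓr) where
    field
      support : ∀ I J K L → w I J K L ≈ 0# ⊎ labN I ⊕ labN J ≡ labN K ⊕ labN L
      vacuum  : w emptyLabel emptyLabel emptyLabel emptyLabel ≈ 1#

  module _ {k} {w : VertexWeight R k} (con-w : Conservative w) where
    open Conservative con-w

    vertex-empty : ∀ b h → w b h emptyLabel emptyLabel ≈ [ eqVecB b emptyLabel ] * [ eqVecB h emptyLabel ]
    vertex-empty b h with eqVecB b emptyLabel in eqb | eqVecB h emptyLabel in eqh
    ... | true | true with ≡.refl ← eqVecB-sound b _ eqb | ≡.refl ← eqVecB-sound h _ eqh =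
      trans vacuum (sym (*-identityˡ _))
    ... | false | _ with support b h emptyLabel emptyLabel
    ...   | inj₁ w≈0 = trans w≈0 (sym (zeroˡ _))
    ...   | inj₂ eq with ≡.refl , _ ← ⊕-empty b h eq with () ← ≡.trans (≡.sym (eqVecB-refl b)) eqb
    vertex-empty b h | true | false with support b h emptyLabel emptyLabel
    ...   | inj₁ w≈0 = trans w≈0 (sym (zeroʳ _))
    ...   | inj₂ eq with _ , ≡.refl ← ⊕-empty b h eq with () ← ≡.trans (≡.sym (eqVecB-refl h)) eqh

    row-empty : ∀ {e} h (bs : Vec (Label k) e) →
      rowWeight R w h bs (empties e) ≈ [ eqVecB h emptyLabel ] * [ eqConfig bs (empties e) ]
    row-empty h []       = sym (*-identityʳ _)
    row-empty {suc e} h (b ∷ bs) = begin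
      _ ≈⟨ rowWeight-∷ w h b emptyLabel bs (empties e) ⟩
      _ ≈⟨ ∑-cong (allLabels k) (λ h′ → trans (*-congˡ (row-empty h′ bs))
             (solve 3 (λ a b c → a :* (b :* c) := b :* (a :* c)) refl _ _ _)) ⟩
      _ ≈⟨ allLabels-sift emptyLabel (λ h′ → w b h emptyLabel h′ * [ eqConfig bs (empties e) ]) ⟩
      w b h emptyLabel emptyLabel * [ eqConfig bs (empties e) ]
        ≈⟨ *-congʳ (vertex-empty b h) ⟩
      _ ≈⟨ solve 3 (λ a b c → (a :* b) :* c := b :* (a :* c)) refl _ _ _ ⟩
      _ ≈⟨ *-congˡ ([]-∧ (eqVecB b emptyLabel) _) ⟨
      _ ∎

    -- Nothing leaves the last e columns, through the top or on the right, so nothing enters them: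
    -- their bottom edges and the horizontal edge at the cut are empty.
    row-trim : ∀ {n e} h (bs ts : Vec (Label k) n) (bs′ : Vec (Label k) e) →
      rowWeight R w h (bs V.++ bs′) (ts V.++ empties e) ≈ rowWeight R w h bs ts * [ eqConfig bs′ (empties e) ]
    row-trim h []       []       bs′ = row-empty h bs′
    row-trim {e = e} h (b ∷ bs) (t ∷ ts) bs′ = begin
      _ ≈⟨ rowWeight-∷ w h b t (bs V.++ bs′) (ts V.++ empties e) ⟩
      _ ≈⟨ ∑-cong (allLabels k) (λ h′ → trans (*-congˡ (row-trim h′ bs ts bs′)) (sym (*-assoc _ _ _))) ⟩
      _ ≈⟨ *-distribʳ-∑ (allLabels k) _ _ ⟨
      _ ≈⟨ *-congʳ (rowWeight-∷ w h b t bs ts) ⟨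
      _ ∎

  -- Emptiness of the surplus columns is passed down from the top: the rows above force the
  -- intermediate configuration to be empty there, which then is an empty top for the row below.
  stack-trim : ∀ {k} {ws : List (VertexWeight R k)} → All Conservative ws →
    ∀ {n e} (bot top : Vec (Label k) n) (bot′ : Vec (Label k) e) →
    stackWeight R ws (bot V.++ bot′) (top V.++ empties e) ≈ stackWeight R ws bot top * [ eqConfig bot′ (empties e) ]
  stack-trim [] {n} {e} bot top bot′ = begin
    _ ≈⟨ stackWeight-[] (bot V.++ bot′) (top V.++ empties e) ⟩
    _ ≡⟨ ≡.cong [_] (eqConfig-++ bot top bot′ (empties e)) ⟩
    _ ≈⟨ []-∧ (eqConfig bot top) _ ⟩
    _ ≈⟨ *-congʳ (stackWeight-[] bot top) ⟨
    _ ∎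
  stack-trim {k} {w ∷ ws} (cw ∷ cws) {n} {e} bot top bot′ = begin
    _ ≈⟨ stackWeight-∷ w ws (bot V.++ bot′) (top V.++ empties e) ⟩
    _ ≈⟨ ∑-allVecs-++ (allLabels k) n e _ ⟩
    _ ≈⟨ ∑-cong Ss (λ s → ∑-cong (configs k e) λ s′ → trans (*-congˡ (stack-trim cws s top s′))
           (solve 3 (λ a b c → a :* (b :* c) := c :* (a :* b)) refl _ _ _)) ⟩
    _ ≈⟨ ∑-cong Ss (λ s → configs-sift (empties e)
           (λ s′ → rowWeight R w emptyLabel (bot V.++ bot′) (s V.++ s′) * stackWeight R ws s top)) ⟩
    _ ≈⟨ ∑-cong Ss (λ s → trans (*-congʳ (row-trim cw emptyLabel bot s bot′))
           (solve 3 (λ a b c → (a :* b) :* c := (a :* c) :* b) refl _ _ _)) ⟩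
    _ ≈⟨ *-distribʳ-∑ Ss _ _ ⟨
    _ ≈⟨ *-congʳ (stackWeight-∷ w ws bot top) ⟨
    _ ∎
    where
    Ss = configs k n

module Partitions where
  open import Data.Nat using (_+_; _*_; _<_; _<ᵇ_; _≤?_; _<?_)

  ≤ᵇ-true : ∀ {m n} → m ≤ n → (m ≤ᵇ n) ≡ true
  ≤ᵇ-true m≤n = T→true (ℕ.≤⇒≤ᵇ m≤n)

  ≤ᵇ-false : ∀ {m n} → n < m → (m ≤ᵇ n) ≡ false
  ≤ᵇ-false n<m = 𝔹.¬-not λ eq → ℕ.<⇒≱ n<m (ℕ.≤ᵇ⇒≤ _ _ (true→T eq))

  map-upTo-suc : ∀ {A : Set} (f : ℕ → A) n → map f (upTo (suc n)) ≡ f 0 ∷ map (f ∘ suc) (upTo n)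
  map-upTo-suc f n = ≡.cong (f 0 ∷_) (≡.trans (L.map-applyUpTo suc f n) (≡.sym (L.map-upTo (f ∘ suc) n)))

  -- Particle positions of a partition and of its conjugate

  anyUpTo-suc : ∀ n f → anyUpTo (suc n) f ≡ f 0 ∨ anyUpTo n (f ∘ suc)
  anyUpTo-suc n f = ≡.cong or (map-upTo-suc f n)

  anyUpTo-true : ∀ n f {i} → i < n → f i ≡ true → anyUpTo n f ≡ true
  anyUpTo-true (suc n) f {zero}  _         eq rewrite anyUpTo-suc n f | eq = ≡.refl
  anyUpTo-true (suc n) f {suc i} (s≤s i<n) eq rewrite anyUpTo-suc n f | anyUpTo-true n (f ∘ suc) i<n eq = 𝔹.∨-zeroʳ _

  anyUpTo-witness : ∀ n f → anyUpTo n f ≡ true → ∃ λ i → i < n × f i ≡ true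
  anyUpTo-witness (suc n) f eq rewrite anyUpTo-suc n f with f 0 in eq₀
  ... | true  = 0 , s≤s z≤n , eq₀
  ... | false with i , i<n , eqᵢ ← anyUpTo-witness n (f ∘ suc) eq = suc i , s≤s i<n , eqᵢ

  opaque
    ∑ℕ : ℕ → (ℕ → ℕ) → ℕ
    ∑ℕ n f = sumℕ (map f (upTo n))

    ∑ℕ-sumℕ : ∀ n f → ∑ℕ n f ≡ sumℕ (map f (upTo n))
    ∑ℕ-sumℕ n f = ≡.refl

    ∑ℕ-0 : ∀ f → ∑ℕ 0 f ≡ 0
    ∑ℕ-0 f = ≡.refl

    ∑ℕ-suc : ∀ n f → ∑ℕ (suc n) f ≡ f 0 + ∑ℕ n (f ∘ suc)
    ∑ℕ-suc n f = ≡.cong sumℕ (map-upTo-suc f n)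

  count : ℕ → (ℕ → Bool) → ℕ
  count n P = ∑ℕ n (b2n ∘ P)

  b2n≤1 : ∀ b → b2n b ≤ 1
  b2n≤1 true  = ℕ.≤-refl
  b2n≤1 false = z≤n

  count-≥ : ∀ {i} n P → i ≤ n → (∀ {j} → j < i → P j ≡ true) → i ≤ count n P
  count-≥ {zero}  n       P _         all = z≤n
  count-≥ {suc i} (suc n) P (s≤s i≤n) all rewrite ∑ℕ-suc n (b2n ∘ P) | all {0} (s≤s z≤n) =
    s≤s (count-≥ n (P ∘ suc) i≤n (all ∘ s≤s))

  count-≤ : ∀ {i} n P → (∀ {j} → i ≤ j → P j ≡ false) → count n P ≤ i
  count-≤ {i}     zero    P none = ≡.subst (_≤ i) (≡.sym (∑ℕ-0 (b2n ∘ P))) z≤n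
  count-≤ {zero}  (suc n) P none rewrite ∑ℕ-suc n (b2n ∘ P) | none {0} z≤n = count-≤ n (P ∘ suc) (λ _ → none z≤n)
  count-≤ {suc i} (suc n) P none rewrite ∑ℕ-suc n (b2n ∘ P) =
    ℕ.+-mono-≤ (b2n≤1 (P 0)) (count-≤ n (P ∘ suc) (none ∘ s≤s))

  nth-tabulate-ℕ : ∀ {ℓ} (f : ℕ → ℕ) {i} → i < ℓ → nth (tabulate {n = ℓ} (f ∘ toℕ)) i ≡ f i
  nth-tabulate-ℕ {suc ℓ} f {zero}  _         = ≡.refl
  nth-tabulate-ℕ {suc ℓ} f {suc i} (s≤s i<ℓ) = nth-tabulate-ℕ (f ∘ suc) i<ℓ

  nth-beyond : ∀ {ℓ} (ρ : Vec ℕ ℓ) {i} → ℓ ≤ i → nth ρ i ≡ 0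
  nth-beyond []      _         = ≡.refl
  nth-beyond (x ∷ ρ) (s≤s ℓ≤i) = nth-beyond ρ ℓ≤i

  nth-antitone : ∀ {ℓ} {ρ : Vec ℕ ℓ} → IsPartition ρ → ∀ {i j} → i ≤ j → nth ρ j ≤ nth ρ i
  nth-antitone {ρ = ρ} isP {i} {j} i≤j with ℕ.≤⇒≤′ i≤j
  ... | ℕ.≤′-reflexive ≡.refl = ℕ.≤-refl
  ... | ℕ.≤′-step i≤′j = ℕ.≤-trans (isP _) (nth-antitone {ρ = ρ} isP (ℕ.≤′⇒≤ i≤′j))

  occupied : ∀ {ℓ} → Vec ℕ ℓ → ℕ → Bool
  occupied {ℓ} ρ p = anyUpTo ℓ (λ i → pos ρ i ≡ᵇ p)

  nth-conjP : ∀ {ℓ} (ρ : Vec ℕ ℓ) {j} → j < ℓ → nth (conjP ρ) j ≡ count ℓ (λ m → suc j ≤ᵇ nth ρ m)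
  nth-conjP {ℓ} ρ {j} j<ℓ = ≡.trans
    (nth-tabulate-ℕ {ℓ} (λ j → sumℕ (map (λ m → b2n (suc j ≤ᵇ nth ρ m)) (upTo ℓ))) j<ℓ) (≡.sym (∑ℕ-sumℕ ℓ _))

  module _ {ℓ} (ρ : Vec ℕ ℓ) (isP : IsPartition ρ) (ρ₀≤ℓ : nth ρ 0 ≤ ℓ) where

    conjP-≥ : ∀ {i j} → j < ℓ → i ≤ ℓ → (∀ {m} → m < i → j < nth ρ m) → i ≤ nth (conjP ρ) j
    conjP-≥ {i} {j} j<ℓ i≤ℓ big rewrite nth-conjP ρ j<ℓ =
      count-≥ ℓ _ i≤ℓ (λ m<i → ≤ᵇ-true (big m<i))

    conjP-≤ : ∀ {i j} → j < ℓ → (∀ {m} → i ≤ m → nth ρ m ≤ j) → nth (conjP ρ) j ≤ i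
    conjP-≤ {i} {j} j<ℓ small rewrite nth-conjP ρ j<ℓ =
      count-≤ ℓ _ (λ i≤m → ≤ᵇ-false (s≤s (small i≤m)))

    -- p and q are mirror columns in the window of width 2ℓ, that is p = 2ℓ - 1 - q.
    module _ {p q} (p+q : p + suc q ≡ ℓ + ℓ) where

      opposite-parts : ∀ {i j} → i < ℓ → j < ℓ → pos (conjP ρ) j ≡ p → pos ρ i ≡ q →
        nth (conjP ρ) j + nth ρ i ≡ suc i + j
      opposite-parts {i} {j} i<ℓ j<ℓ posj posi = ℕ.+-cancelʳ-≡ (suc (v + u)) _ _ (begin
        (a + b) + suc (v + u)        ≡⟨ ℕS.solve 4 (λ a b u v → (a :+ b) :+ (con 1 :+ (v :+ u)) := (a :+ v) :+ (con 1 :+ (b :+ u))) ≡.refl a b u v ⟩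
        (a + v) + suc (b + u)        ≡⟨ ≡.cong₂ (λ p q → p + suc q) posj posi ⟩
        p + suc q                    ≡⟨ p+q ⟩
        ℓ + ℓ                        ≡⟨ ≡.cong₂ _+_ (ℕ.m+[n∸m]≡n i<ℓ) (ℕ.m+[n∸m]≡n j<ℓ) ⟨
        (suc i + u) + (suc j + v)    ≡⟨ ℕS.solve 4 (λ i j u v → (con 1 :+ i :+ u) :+ (con 1 :+ j :+ v) := (con 1 :+ i :+ j) :+ (con 1 :+ (v :+ u))) ≡.refl i j u v ⟩
        (suc i + j) + suc (v + u)    ∎)
        where
        open ≡.≡-Reasoning
        open ℕS using (_:+_; _:=_; con)
        a = nth (conjP ρ) j
        b = nth ρ i
        u = ℓ ∸ suc i
        v = ℓ ∸ suc j

      -- The cell (i, j) lies in the diagram of ρ or not. If it does, ρ′_j ≥ i + 1 and ρ_i ≥ j + 1;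
      -- if not, ρ′_j ≤ i and ρ_i ≤ j. So ρ′_j + ρ_i is never i + j + 1, the value required by
      -- `opposite-parts`.
      disjoint : ∀ {i j} → i < ℓ → j < ℓ → pos (conjP ρ) j ≡ p → pos ρ i ≡ q → ⊥
      disjoint {i} {j} i<ℓ j<ℓ posj posi with j <? nth ρ i
      ... | yes j<ρᵢ = ℕ.<-irrefl (≡.sym parts) (ℕ.+-mono-≤-< (conjP-≥ j<ℓ i<ℓ λ { (s≤s m≤i) →
              ℕ.≤-trans j<ρᵢ (nth-antitone {ρ = ρ} isP m≤i) }) j<ρᵢ)
        where
        parts : nth (conjP ρ) j + nth ρ i ≡ suc i + j
        parts = opposite-parts i<ℓ j<ℓ posj posi
      ... | no j≮ρᵢ = ℕ.<-irrefl (opposite-parts i<ℓ j<ℓ posj posi) (s≤s (ℕ.+-mono-≤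
              (conjP-≤ j<ℓ λ i≤m → ℕ.≤-trans (nth-antitone {ρ = ρ} isP i≤m) (ℕ.≮⇒≥ j≮ρᵢ)) (ℕ.≮⇒≥ j≮ρᵢ)))

      search : ∀ n → ∃ λ i → i ≤ n × (∀ {m} → m < i → q < pos ρ m) × (i ≡ n ⊎ pos ρ i ≤ q)
      search zero = 0 , z≤n , (λ ()) , inj₁ ≡.refl
      search (suc n) with search n
      ... | i , i≤n , above , inj₂ below = i , ℕ.m≤n⇒m≤1+n i≤n , above , inj₂ below
      ... | i , i≤n , above , inj₁ ≡.refl with pos ρ i ≤? q
      ...   | yes below = i , ℕ.n≤1+n i , above , inj₂ below
      ...   | no ¬below = suc i , ℕ.≤-refl , (λ { (s≤s m≤i) → above′ (ℕ.m≤n⇒m<n∨m≡n m≤i) }) , inj₁ ≡.refl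
        where
        above′ : ∀ {m} → m < i ⊎ m ≡ i → q < pos ρ m
        above′ (inj₁ m<i)    = above m<i
        above′ (inj₂ ≡.refl) = ℕ.≰⇒> ¬below

      -- Let i be the number of particles to the right of the free column q, and j = q + i - ℓ.
      -- Exactly the first i parts of ρ exceed j, so ρ′_j = i, and i + (ℓ - 1 - j) = 2ℓ - 1 - q is
      -- the mirror column p.
      covered : occupied ρ q ≡ false → ∃ λ j → j < ℓ × pos (conjP ρ) j ≡ p
      covered free with search ℓ
      ... | i , i≤ℓ , above , end = j , j<ℓ , pos-j
        where
        open ≡.≡-Reasoning
        pos≢q : ∀ {m} → m < ℓ → pos ρ m ≢ q
        pos≢q {m} m<ℓ eq with () ← ≡.trans (≡.sym free)
          (anyUpTo-true ℓ (λ i → pos ρ i ≡ᵇ q) m<ℓ (T→true (ℕ.≡⇒≡ᵇ _ _ eq)))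
        below : i < ℓ → pos ρ i < q
        below i<ℓ = ℕ.≤∧≢⇒< (fromInj₂ (λ i≡ℓ → contradiction i<ℓ (ℕ.<-irrefl i≡ℓ)) end) (pos≢q i<ℓ)
        ℓ-i : ∀ {m} → m < ℓ → pos ρ m + suc m ≡ nth ρ m + ℓ
        ℓ-i {m} m<ℓ = ≡.trans (ℕ.+-assoc (nth ρ m) _ _) (≡.cong (nth ρ m +_) (ℕ.m∸n+n≡m m<ℓ))
        ℓ≤q+i : ℓ ≤ q + i
        ℓ≤q+i with ℕ.m≤n⇒m<n∨m≡n i≤ℓ
        ... | inj₂ i≡ℓ = ≡.subst (_≤ q + i) i≡ℓ (ℕ.m≤n+m i q)
        ... | inj₁ i<ℓ = ℕ.≤-pred (ℕ.≤-trans (s≤s (ℕ.m≤n+m ℓ (nth ρ i)))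
                (ℕ.≤-trans (ℕ.≤-reflexive (≡.cong suc (≡.sym (ℓ-i i<ℓ)))) (ℕ.≤-trans (ℕ.+-monoˡ-≤ (suc i) (below i<ℓ))
                  (ℕ.≤-reflexive (ℕ.+-suc q i)))))
        j = q + i ∸ ℓ
        j+ℓ : j + ℓ ≡ q + i
        j+ℓ = ℕ.m∸n+n≡m ℓ≤q+i
        big : ∀ {m} → m < i → j < nth ρ m
        big {m} m<i = ℕ.+-cancelʳ-< ℓ j (nth ρ m) (ℕ.<-≤-trans (≡.subst (_< pos ρ i′ + i) (≡.sym j+ℓ)
            (ℕ.+-monoˡ-< i (above i′<i)))
            (ℕ.≤-trans (ℕ.≤-reflexive (≡.trans (≡.cong (pos ρ i′ +_) (≡.sym suc-i′)) (ℓ-i (ℕ.<-≤-trans i′<i i≤ℓ))))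
              (ℕ.+-monoˡ-≤ ℓ (nth-antitone {ρ = ρ} isP (ℕ.≤-pred (≡.subst (m <_) (≡.sym suc-i′) m<i))))))
          where
          i′ = ℕ.pred i
          suc-i′ : suc i′ ≡ i
          suc-i′ = ℕ.suc-pred i ⦃ ℕ.>-nonZero (ℕ.≤-<-trans z≤n m<i) ⦄
          i′<i : i′ < i
          i′<i = ℕ.≤-reflexive suc-i′
        -- If some particle lies to the right of q, then j < ρ₀ ≤ ℓ; otherwise i = 0 and j = q - ℓ
        -- with q < 2ℓ.
        j<ℓ : j < ℓ
        j<ℓ with ℕ.m≤n⇒m<n∨m≡n (z≤n {i})
        ... | inj₁ 0<i  = ℕ.<-≤-trans (big 0<i) ρ₀≤ℓ
        ... | inj₂ 0≡i = ℕ.+-cancelʳ-< ℓ j ℓ (≡.subst (_< ℓ + ℓ) (≡.sym (≡.trans j+ℓ (≡.trans (≡.cong (q +_) (≡.sym 0≡i)) (ℕ.+-identityʳ q))))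
                (≡.subst (q <_) p+q (ℕ.m≤n+m (suc q) p)))
        small : ∀ {m} → i ≤ m → nth ρ m ≤ j
        small {m} i≤m with ℕ.m≤n⇒m<n∨m≡n i≤ℓ
        ... | inj₂ i≡ℓ = ≡.subst (_≤ j) (≡.sym (nth-beyond ρ (≡.subst (_≤ m) i≡ℓ i≤m))) z≤n
        ... | inj₁ i<ℓ = ℕ.≤-trans (nth-antitone {ρ = ρ} isP i≤m) (ℕ.+-cancelʳ-≤ ℓ (nth ρ i) j
                (≡.subst₂ _≤_ (ℓ-i i<ℓ) (≡.sym j+ℓ) (ℕ.≤-pred (≡.subst (pos ρ i + suc i <_) (ℕ.+-suc q i)
                  (ℕ.+-monoˡ-< (suc i) (below i<ℓ))))))
        pos-j : pos (conjP ρ) j ≡ p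
        pos-j = ℕ.+-cancelʳ-≡ (suc j + ℓ) _ _ (begin
          (nth (conjP ρ) j + (ℓ ∸ suc j)) + (suc j + ℓ)
            ≡⟨ ≡.cong (λ z → (z + (ℓ ∸ suc j)) + (suc j + ℓ)) (ℕ.≤-antisym (conjP-≤ j<ℓ small) (conjP-≥ j<ℓ i≤ℓ big)) ⟩
          (i + (ℓ ∸ suc j)) + (suc j + ℓ)
            ≡⟨ ℕS.solve 4 (λ i v j ℓ → (i :+ v) :+ (j :+ ℓ) := (v :+ j) :+ ℓ :+ i) ≡.refl i (ℓ ∸ suc j) (suc j) ℓ ⟩
          (ℓ ∸ suc j + suc j) + ℓ + i
            ≡⟨ ≡.cong (λ z → z + ℓ + i) (ℕ.m∸n+n≡m j<ℓ) ⟩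
          ℓ + ℓ + i
            ≡⟨ ≡.cong (_+ i) p+q ⟨
          p + suc q + i
            ≡⟨ ℕS.solve 3 (λ p q i → p :+ (con 1 :+ q) :+ i := p :+ (con 1 :+ (q :+ i))) ≡.refl p q i ⟩
          p + suc (q + i)
            ≡⟨ ≡.cong (λ z → p + suc z) j+ℓ ⟨
          p + (suc j + ℓ) ∎)
          where open ℕS using (_:+_; _:=_; con)

      occupied-conjP : occupied (conjP ρ) p ≡ not (occupied ρ q)
      occupied-conjP with occupied ρ q in eq
      ... | true with occupied (conjP ρ) p in eq′
      ...   | false = ≡.refl
      ...   | true with i , i<ℓ , posi ← anyUpTo-witness ℓ _ eq | j , j<ℓ , posj ← anyUpTo-witness ℓ _ eq′ =
        ⊥-elim (disjoint i<ℓ j<ℓ (ℕ.≡ᵇ⇒≡ _ _ (true→T posj)) (ℕ.≡ᵇ⇒≡ _ _ (true→T posi)))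
      occupied-conjP | false with j , j<ℓ , posj ← covered eq =
        anyUpTo-true ℓ _ j<ℓ (T→true (ℕ.≡⇒≡ᵇ _ _ posj))

  tabulate-∷ʳ : ∀ {a} {A : Set a} {n} (f : Fin (suc n) → A) → tabulate f ≡ tabulate (f ∘ inject₁) ∷ʳ f (fromℕ n)
  tabulate-∷ʳ {n = zero}  f = ≡.refl
  tabulate-∷ʳ {n = suc n} f = ≡.cong (f zero ∷_) (tabulate-∷ʳ (f ∘ suc))

  opposite-inject₁ : ∀ {n} (i : Fin n) → opposite (inject₁ i) ≡ suc (opposite i)
  opposite-inject₁ zero    = ≡.refl
  opposite-inject₁ (suc i) = ≡.cong inject₁ (opposite-inject₁ i)

  opposite-fromℕ : ∀ n → opposite (fromℕ n) ≡ zero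
  opposite-fromℕ zero    = ≡.refl
  opposite-fromℕ (suc n) = ≡.cong inject₁ (opposite-fromℕ n)

  reverse-tabulate : ∀ {a} {A : Set a} {n} (f : Fin n → A) → reverse (tabulate f) ≡ tabulate (f ∘ opposite)
  reverse-tabulate {n = zero}  f = ≡.refl
  reverse-tabulate {n = suc n} f = begin
    reverse (f zero ∷ tabulate (f ∘ suc))                    ≡⟨ V.reverse-∷ (f zero) (tabulate (f ∘ suc)) ⟩
    reverse (tabulate (f ∘ suc)) ∷ʳ f zero                   ≡⟨ ≡.cong (_∷ʳ f zero) (reverse-tabulate (f ∘ suc)) ⟩
    tabulate (f ∘ suc ∘ opposite) ∷ʳ f zero                  ≡⟨ ≡.cong₂ (λ u x → u ∷ʳ f x)
      (V.tabulate-cong (λ i → ≡.cong f (opposite-inject₁ i))) (opposite-fromℕ n) ⟨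
    tabulate (f ∘ opposite ∘ inject₁) ∷ʳ f (opposite (fromℕ n)) ≡⟨ tabulate-∷ʳ (f ∘ opposite) ⟨
    tabulate (f ∘ opposite)                                  ∎
    where open ≡.≡-Reasoning

  tab : ∀ {a} {A : Set a} n → (ℕ → A) → Vec A n
  tab n f = tabulate {n = n} (f ∘ toℕ)

  tab-++ : ∀ {a} {A : Set a} m n (f : ℕ → A) → tab (m + n) f ≡ tab m f V.++ tab n (λ p → f (m + p))
  tab-++ zero    n f = ≡.refl
  tab-++ (suc m) n f = ≡.cong (f 0 ∷_) (tab-++ m n (f ∘ suc))

  tab-const : ∀ {a} {A : Set a} n (f : ℕ → A) x → (∀ p → f p ≡ x) → tab n f ≡ replicate n x
  tab-const zero    f x eq = ≡.refl
  tab-const (suc n) f x eq = ≡.cong₂ _∷_ (eq 0) (tab-const n (f ∘ suc) x (eq ∘ suc))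

  dualLabel-tabulate : ∀ {k} (f : Fin k → Bool) → dualLabel (tabulate f) ≡ tabulate (λ a → not (f (opposite a)))
  dualLabel-tabulate f = ≡.trans (≡.cong reverse (≡.sym (V.tabulate-∘ not f))) (reverse-tabulate (not ∘ f))

  dual-tabulate : ∀ {k n} (f : Fin n → Label k) → dual (tabulate f) ≡ tabulate (λ p → dualLabel (f (opposite p)))
  dual-tabulate f = ≡.trans (≡.cong reverse (≡.sym (V.tabulate-∘ dualLabel f))) (reverse-tabulate (dualLabel ∘ f))

  column : ∀ {k ℓ} → Tuple k ℓ → ℕ → Label k
  column ρs p = tabulate (λ a → occupied (ρs a) p)

  -- At width `suc (N + ℓ)` this is the boundary state of the lattice; the width is a parameter
  -- because duality needs 2ℓ columns.
  config : ∀ {k ℓ} n → Tuple k ℓ → Vec (Label k) n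
  config n ρs = tab n (column ρs)

  pos-< : ∀ {ℓ} (ρ : Vec ℕ ℓ) → (∀ i → nth ρ i ≤ ℓ) → ∀ {i} → i < ℓ → pos ρ i < ℓ + ℓ
  pos-< {ℓ} ρ small {i} i<ℓ = ℕ.+-mono-≤-< (small i) (ℕ.≤-<-trans (ℕ.∸-monoʳ-≤ ℓ (s≤s z≤n)) pred<)
    where
    pred< : ℓ ∸ 1 < ℓ
    pred< = ℕ.∸-monoʳ-< {ℓ} (s≤s z≤n) (ℕ.≤-trans (s≤s z≤n) i<ℓ)

  occupied-beyond : ∀ {ℓ} (ρ : Vec ℕ ℓ) → (∀ i → nth ρ i ≤ ℓ) → ∀ p → occupied ρ (ℓ + ℓ + p) ≡ false
  occupied-beyond {ℓ} ρ small p = 𝔹.¬-not λ eq → case-witness (anyUpTo-witness ℓ _ eq)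
    where
    case-witness : (∃ λ i → i < ℓ × (pos ρ i ≡ᵇ (ℓ + ℓ + p)) ≡ true) → ⊥
    case-witness (i , i<ℓ , eq) = ℕ.<⇒≱ (pos-< ρ small i<ℓ)
      (ℕ.≤-trans (ℕ.m≤m+n (ℓ + ℓ) p) (ℕ.≤-reflexive (≡.sym (ℕ.≡ᵇ⇒≡ _ _ (true→T eq)))))

  config-++ : ∀ {k ℓ} (ρs : Tuple k ℓ) → (∀ a i → nth (ρs a) i ≤ ℓ) → ∀ e →
    config (ℓ + ℓ + e) ρs ≡ config (ℓ + ℓ) ρs V.++ empties e
  config-++ {k} {ℓ} ρs small e = ≡.trans (tab-++ (ℓ + ℓ) e (column ρs))
    (≡.cong (config (ℓ + ℓ) ρs V.++_) (tab-const e _ emptyLabel λ p →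
      ≡.trans (V.tabulate-cong (λ a → occupied-beyond (ρs a) (small a) p)) (tabulate-false k)))
    where
    tabulate-false : ∀ k → tabulate {n = k} (λ _ → false) ≡ emptyLabel
    tabulate-false zero    = ≡.refl
    tabulate-false (suc k) = ≡.cong (false ∷_) (tabulate-false k)

  config-conjT : ∀ {k ℓ} (ρs : Tuple k ℓ) → (∀ a → IsPartition (ρs a)) → (∀ a → nth (ρs a) 0 ≤ ℓ) →
    config (ℓ + ℓ) (conjT ρs) ≡ dual (config (ℓ + ℓ) ρs)
  config-conjT {k} {ℓ} ρs isP small = ≡.trans
    (V.tabulate-cong λ p → ≡.trans
      (V.tabulate-cong λ a → occupied-conjP (ρs (opposite a)) (isP (opposite a)) (small (opposite a)) (reflect p))
      (≡.sym (dualLabel-tabulate (λ a → occupied (ρs a) (toℕ (opposite p))))))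
    (≡.sym (dual-tabulate (column ρs ∘ toℕ)))
    where
    reflect : ∀ (p : Fin (ℓ + ℓ)) → toℕ p + suc (toℕ (opposite p)) ≡ ℓ + ℓ
    reflect p = ≡.trans (≡.cong (λ q → toℕ p + suc q) (Fin.opposite-prop p))
      (≡.trans (ℕ.+-suc (toℕ p) _) (ℕ.m+[n∸m]≡n (Fin.toℕ<n p)))

  conjP-small : ∀ {ℓ} (ρ : Vec ℕ ℓ) i → nth (conjP ρ) i ≤ ℓ
  conjP-small {ℓ} ρ i with i <? ℓ
  ... | no i≮ℓ = ≡.subst (_≤ ℓ) (≡.sym (nth-beyond (conjP ρ) (ℕ.≮⇒≥ i≮ℓ))) z≤n
  ... | yes i<ℓ = ≡.subst (_≤ ℓ) (≡.sym (nth-conjP ρ i<ℓ)) (count≤n ℓ _)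
    where
    count≤n : ∀ n P → count n P ≤ n
    count≤n zero    P = ℕ.≤-reflexive (∑ℕ-0 (b2n ∘ P))
    count≤n (suc n) P rewrite ∑ℕ-suc n (b2n ∘ P) with P 0
    ... | true  = s≤s (count≤n n _)
    ... | false = ℕ.m≤n⇒m≤1+n (count≤n n _)

  -- The statistic g as a difference of potentials

  ∑ℕ-cong : ∀ n {f g : ℕ → ℕ} → (∀ {i} → i < n → f i ≡ g i) → ∑ℕ n f ≡ ∑ℕ n g
  ∑ℕ-cong zero    {f} {g} eq = ≡.trans (∑ℕ-0 f) (≡.sym (∑ℕ-0 g))
  ∑ℕ-cong (suc n) {f} {g} eq = ≡.trans (∑ℕ-suc n f)
    (≡.trans (≡.cong₂ _+_ (eq (s≤s z≤n)) (∑ℕ-cong n (eq ∘ s≤s))) (≡.sym (∑ℕ-suc n g)))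

  ∑ℕ-+ : ∀ n (f g : ℕ → ℕ) → ∑ℕ n (λ i → f i + g i) ≡ ∑ℕ n f + ∑ℕ n g
  ∑ℕ-+ zero    f g rewrite ∑ℕ-0 f | ∑ℕ-0 g = ∑ℕ-0 (λ i → f i + g i)
  ∑ℕ-+ (suc n) f g rewrite ∑ℕ-suc n (λ i → f i + g i) | ∑ℕ-suc n f | ∑ℕ-suc n g | ∑ℕ-+ n (f ∘ suc) (g ∘ suc) =
    ℕ-interchange (f 0) (g 0) _ _

  ∑ℕ-snoc : ∀ n (f : ℕ → ℕ) → ∑ℕ (suc n) f ≡ ∑ℕ n f + f n
  ∑ℕ-snoc zero    f = ≡.trans (∑ℕ-suc 0 f) (≡.trans (ℕ.+-comm (f 0) _) (≡.cong (_+ f 0) (≡.trans (∑ℕ-0 (f ∘ suc)) (≡.sym (∑ℕ-0 f)))))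
  ∑ℕ-snoc (suc n) f rewrite ∑ℕ-suc (suc n) f | ∑ℕ-snoc n (f ∘ suc) | ∑ℕ-suc n f = ≡.sym (ℕ.+-assoc (f 0) _ _)

  ∑ℕ-zero : ∀ n {f : ℕ → ℕ} → (∀ i → f i ≡ 0) → ∑ℕ n f ≡ 0
  ∑ℕ-zero zero    {f} eq = ∑ℕ-0 f
  ∑ℕ-zero (suc n) {f} eq rewrite ∑ℕ-suc n f | eq 0 = ∑ℕ-zero n (eq ∘ suc)

  ∑ℕ-telescope : ∀ n (g f : ℕ → ℕ) → (∀ {i} → i < n → g i + f (suc i) ≡ f i) → ∑ℕ n g + f n ≡ f 0
  ∑ℕ-telescope zero    g f step = ≡.cong (_+ f 0) (∑ℕ-0 g)
  ∑ℕ-telescope (suc n) g f step rewrite ∑ℕ-suc n g = ≡.trans (ℕ.+-assoc (g 0) _ _)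
    (≡.trans (≡.cong (g 0 +_) (∑ℕ-telescope n (g ∘ suc) (f ∘ suc) (step ∘ s≤s))) (step (s≤s z≤n)))

  -- A discrete divergence theorem in additive form: `X i` is the flux through the left edge of
  -- column i.
  ∑ℕ-balance : ∀ n (e f X : ℕ → ℕ) → (∀ i → e i + X (suc i) ≡ f i + X i) → ∑ℕ n e + X n ≡ ∑ℕ n f + X 0
  ∑ℕ-balance zero    e f X step = ≡.cong (_+ X 0) (≡.trans (∑ℕ-0 e) (≡.sym (∑ℕ-0 f)))
  ∑ℕ-balance (suc n) e f X step rewrite ∑ℕ-suc n e | ∑ℕ-suc n f = begin
    e 0 + ∑ℕ n (e ∘ suc) + X (suc n)     ≡⟨ ℕ.+-assoc (e 0) _ _ ⟩
    e 0 + (∑ℕ n (e ∘ suc) + X (suc n))   ≡⟨ ≡.cong (e 0 +_) (∑ℕ-balance n (e ∘ suc) (f ∘ suc) (X ∘ suc) (step ∘ suc)) ⟩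
    e 0 + (∑ℕ n (f ∘ suc) + X 1)         ≡⟨ solve 3 (λ a b c → a :+ (b :+ c) := (a :+ c) :+ b) ≡.refl (e 0) _ (X 1) ⟩
    e 0 + X 1 + ∑ℕ n (f ∘ suc)           ≡⟨ ≡.cong (_+ ∑ℕ n (f ∘ suc)) (step 0) ⟩
    f 0 + X 0 + ∑ℕ n (f ∘ suc)           ≡⟨ solve 3 (λ a b c → (a :+ b) :+ c := (a :+ c) :+ b) ≡.refl (f 0) (X 0) _ ⟩
    f 0 + ∑ℕ n (f ∘ suc) + X 0           ∎
    where
    open ≡.≡-Reasoning
    open ℕS using (solve; _:+_; _:=_)

  anyUpTo-cong : ∀ n {f g : ℕ → Bool} → (∀ {i} → i < n → f i ≡ g i) → anyUpTo n f ≡ anyUpTo n g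
  anyUpTo-cong zero            eq = ≡.refl
  anyUpTo-cong (suc n) {f} {g} eq = ≡.trans (anyUpTo-suc n f)
    (≡.trans (≡.cong₂ _∨_ (eq (s≤s z≤n)) (anyUpTo-cong n (eq ∘ s≤s))) (≡.sym (anyUpTo-suc n g)))

  -- Passes from the Boolean edges in `gTilde` to numbers of paths, for which conservation can be
  -- proved by counting.
  b2n-anyUpTo : ∀ n f → count n f ≤ 1 → b2n (anyUpTo n f) ≡ count n f
  b2n-anyUpTo zero    f _  = ≡.sym (∑ℕ-0 (b2n ∘ f))
  b2n-anyUpTo (suc n) f le rewrite anyUpTo-suc n f | ∑ℕ-suc n (b2n ∘ f) with f 0
  ... | true  = ≡.cong suc (≡.sym (ℕ.n≤0⇒n≡0 (ℕ.≤-pred le)))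
  ... | false = b2n-anyUpTo n (f ∘ suc) le

  <ᵇ-suc : ∀ m n → (m <ᵇ suc n) ≡ (m ≤ᵇ n)
  <ᵇ-suc zero    n = ≡.refl
  <ᵇ-suc (suc m) n = ≡.refl

  b2n-<-≡ : ∀ m n → b2n (m <ᵇ n) + b2n (m ≡ᵇ n) ≡ b2n (m <ᵇ suc n)
  b2n-<-≡ zero    zero    = ≡.refl
  b2n-<-≡ zero    (suc n) = ≡.refl
  b2n-<-≡ (suc m) zero    = ≡.refl
  b2n-<-≡ (suc m) (suc n) = b2n-<-≡ m n

  b2n-<-≥ : ∀ m n → b2n (m <ᵇ n) + b2n (n ≤ᵇ m) ≡ 1
  b2n-<-≥ m       zero    = ≡.refl
  b2n-<-≥ zero    (suc n) = ≡.refl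
  b2n-<-≥ (suc m) (suc n) = ≡.trans (≡.cong (λ b → b2n (m <ᵇ n) + b2n b) (<ᵇ-suc n m)) (b2n-<-≥ m n)

  b2n-between : ∀ {a b} p → b ≤ a → b2n ((b <ᵇ p) ∧ (p ≤ᵇ a)) + b2n (a <ᵇ p) ≡ b2n (b <ᵇ p)
  b2n-between {a} {b} p b≤a with b <ᵇ p in eq
  ... | true  = ≡.trans (ℕ.+-comm (b2n (p ≤ᵇ a)) _) (b2n-<-≥ a p)
  ... | false = ≡.cong b2n (𝔹.¬-not λ a<p → 𝔹.not-¬ eq (T→true (ℕ.<⇒<ᵇ (ℕ.≤-<-trans b≤a (ℕ.<ᵇ⇒< a p (true→T a<p))))))

  below : ∀ {ℓ} → Vec ℕ ℓ → ℕ → ℕ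
  below {ℓ} ρ p = count ℓ (λ i → pos ρ i <ᵇ p)

  count-occupied : ∀ {ℓ} → Vec ℕ ℓ → ℕ → ℕ
  count-occupied {ℓ} ρ p = count ℓ (λ i → pos ρ i ≡ᵇ p)

  below-suc : ∀ {ℓ} (ρ : Vec ℕ ℓ) p → below ρ p + count-occupied ρ p ≡ below ρ (suc p)
  below-suc {ℓ} ρ p = ≡.trans (≡.sym (∑ℕ-+ ℓ _ _)) (∑ℕ-cong ℓ λ {i} _ → b2n-<-≡ (pos ρ i) p)

  below-zero : ∀ {ℓ} (ρ : Vec ℕ ℓ) → below ρ 0 ≡ 0
  below-zero {ℓ} ρ = ∑ℕ-zero ℓ λ i → ≡.refl

  -- The step from β^r to β^(r+1): the particles of β reappear in α one column further left, and one is added in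
  -- front of them. Hence every box up to the new particle has exactly one incoming path.
  module OneStep {ℓ} (α β : Vec ℕ (suc ℓ))
    (shift : ∀ {i} → i < ℓ → suc (pos α (suc i)) ≡ pos β i)
    (last : pos β ℓ ≡ 0)
    (grow : ∀ i → pos β i ≤ pos α i)
    where
    open ≡.≡-Reasoning

    left : ℕ → Bool
    left p = anyUpTo (suc ℓ) (λ i → (pos β i <ᵇ p) ∧ (p ≤ᵇ pos α i))

    right : ℕ → Bool
    right p = anyUpTo (suc ℓ) (λ i → (pos β i ≤ᵇ p) ∧ (p <ᵇ pos α i))

    right-left : ∀ p → right p ≡ left (suc p)
    right-left p = anyUpTo-cong (suc ℓ) λ {i} _ → ≡.cong (_∧ (p <ᵇ pos α i)) (≡.sym (<ᵇ-suc (pos β i) p))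

    private
      count-left : ℕ → ℕ
      count-left p = count (suc ℓ) (λ i → (pos β i <ᵇ p) ∧ (p ≤ᵇ pos α i))

      any-edge : ℕ → Bool
      any-edge p = p ≤ᵇ pos α 0

      count-left-below : ∀ p → count-left p + below α p ≡ below β p
      count-left-below p = ≡.trans (≡.sym (∑ℕ-+ (suc ℓ) _ _)) (∑ℕ-cong (suc ℓ) λ {i} _ → b2n-between p (grow i))

      below-any-edge : ∀ p → below α p + b2n (any-edge p) ≡ below β (suc p)
      below-any-edge p = begin
        below α p + b2n (p ≤ᵇ pos α 0)
          ≡⟨ ≡.cong (_+ b2n (p ≤ᵇ pos α 0)) (∑ℕ-suc ℓ _) ⟩
        b2n (pos α 0 <ᵇ p) + C + b2n (p ≤ᵇ pos α 0)
          ≡⟨ ℕS.solve 3 (λ a b c → (a ℕS.:+ b) ℕS.:+ c ℕS.:= b ℕS.:+ (a ℕS.:+ c)) ≡.refl (b2n (pos α 0 <ᵇ p)) C _ ⟩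
        C + (b2n (pos α 0 <ᵇ p) + b2n (p ≤ᵇ pos α 0))
          -- By `shift`, particle i + 1 of α lies left of p iff particle i of β lies left of p + 1.
          -- The summand 1 becomes the last particle of β, which sits in column 0.
          ≡⟨ ≡.cong₂ _+_ (∑ℕ-cong ℓ λ {i} i<ℓ → ≡.cong (λ n → b2n (n <ᵇ suc p)) (shift i<ℓ)) (b2n-<-≥ (pos α 0) p) ⟩
        count ℓ (λ i → pos β i <ᵇ suc p) + 1
          ≡⟨ ≡.cong (λ n → count ℓ (λ i → pos β i <ᵇ suc p) + b2n (n <ᵇ suc p)) last ⟨
        count ℓ (λ i → pos β i <ᵇ suc p) + b2n (pos β ℓ <ᵇ suc p)
          ≡⟨ ∑ℕ-snoc ℓ _ ⟨
        below β (suc p) ∎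
        where
        C = count ℓ (λ i → pos α (suc i) <ᵇ p)

      -- Comparing particle counts on both sides of the box leaves one incoming path up to the first
      -- particle of α and none beyond. The bound 1 is what makes every Boolean edge equal to its
      -- count.
      bottom-left : ∀ p → count-occupied β p + count-left p ≡ b2n (any-edge p)
      bottom-left p = ℕ.+-cancelˡ-≡ (below α p) _ _ (begin
        below α p + (count-occupied β p + count-left p)
          ≡⟨ ℕS.solve 3 (λ a b c → a ℕS.:+ (b ℕS.:+ c) ℕS.:= (c ℕS.:+ a) ℕS.:+ b) ≡.refl
               (below α p) (count-occupied β p) (count-left p) ⟩
        (count-left p + below α p) + count-occupied β p   ≡⟨ ≡.cong (_+ count-occupied β p) (count-left-below p) ⟩
        below β p + count-occupied β p                    ≡⟨ below-suc β p ⟩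
        below β (suc p)                                   ≡⟨ below-any-edge p ⟨
        below α p + b2n (any-edge p)                      ∎)

      top-right : ∀ p → count-occupied α p + count-left (suc p) ≡ b2n (any-edge p)
      top-right p = ℕ.+-cancelˡ-≡ (below α p) _ _ (begin
        below α p + (count-occupied α p + count-left (suc p))
          ≡⟨ ℕS.solve 3 (λ a b c → a ℕS.:+ (b ℕS.:+ c) ℕS.:= c ℕS.:+ (a ℕS.:+ b)) ≡.refl
               (below α p) (count-occupied α p) (count-left (suc p)) ⟩
        count-left (suc p) + (below α p + count-occupied α p)   ≡⟨ ≡.cong (count-left (suc p) +_) (below-suc α p) ⟩
        count-left (suc p) + below α (suc p)                    ≡⟨ count-left-below (suc p) ⟩
        below β (suc p)                                         ≡⟨ below-any-edge p ⟨
        below α p + b2n (any-edge p)                            ∎)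

      bounded : ∀ {m n} p → m + n ≡ b2n (any-edge p) → m ≤ 1 × n ≤ 1
      bounded {m} {n} p eq = ℕ.≤-trans (ℕ.m≤m+n m n) m+n≤1 , ℕ.≤-trans (ℕ.m≤n+m n m) m+n≤1
        where
        m+n≤1 : m + n ≤ 1
        m+n≤1 = ≡.subst (_≤ 1) (≡.sym eq) (b2n≤1 (any-edge p))

      b2n-left : ∀ p → b2n (left p) ≡ count-left p
      b2n-left p = b2n-anyUpTo (suc ℓ) _ (proj₂ (bounded p (bottom-left p)))

    b2n-bottom : ∀ p → b2n (occupied β p) ≡ count-occupied β p
    b2n-bottom p = b2n-anyUpTo (suc ℓ) _ (proj₁ (bounded p (bottom-left p)))

    b2n-top : ∀ p → b2n (occupied α p) ≡ count-occupied α p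
    b2n-top p = b2n-anyUpTo (suc ℓ) _ (proj₁ (bounded p (top-right p)))

    left-below : ∀ p → below α p + b2n (left p) ≡ below β p
    left-below p = ≡.trans (≡.cong (below α p +_) (b2n-left p)) (≡.trans (ℕ.+-comm (below α p) _) (count-left-below p))

    -- Incoming and outgoing edges are equally many, and at most one each, so the incoming ones
    -- alone decide whether the colour is present.
    edges : ∀ p → b2n (occupied β p) + b2n (left p) ≡ b2n (occupied β p ∨ occupied α p ∨ left p ∨ right p)
    edges p = both (occupied β p) (left p) (occupied α p) (right p) (any-edge p)
        (≡.trans (≡.cong₂ _+_ (b2n-bottom p) (b2n-left p)) (bottom-left p)) edges-out
      where
      edges-out : b2n (occupied α p) + b2n (right p) ≡ b2n (any-edge p)
      edges-out = ≡.trans (≡.cong₂ _+_ (b2n-top p) (≡.trans (≡.cong b2n (right-left p)) (b2n-left (suc p)))) (top-right p)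
      both : ∀ b l t r e → b2n b + b2n l ≡ b2n e → b2n t + b2n r ≡ b2n e → b2n b + b2n l ≡ b2n (b ∨ t ∨ l ∨ r)
      both true  true  t     r     true  ()
      both true  true  t     r     false ()
      both true  false t     r     e     eq eq′ = ≡.refl
      both false true  true  r     e     eq eq′ = ≡.refl
      both false true  false r     e     eq eq′ = ≡.refl
      both false false true  r     true  ()
      both false false true  r     false eq ()
      both false false false true  true  ()
      both false false false true  false eq ()
      both false false false false e     eq eq′ = ≡.refl

    conserve : ∀ p → b2n (occupied β p) + b2n (left p) ≡ b2n (occupied α p) + b2n (right p)
    conserve p = ≡.trans (≡.cong₂ _+_ (b2n-bottom p) (b2n-left p)) (≡.trans (bottom-left p) (≡.sym (≡.trans
      (≡.cong₂ _+_ (b2n-top p) (≡.trans (≡.cong b2n (right-left p)) (b2n-left (suc p)))) (top-right p))))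

    left-end : ∀ p → (∀ {i} → i < suc ℓ → pos α i < p) → left p ≡ false
    left-end p small = 𝔹.¬-not λ eq → absurd (anyUpTo-witness (suc ℓ) _ eq)
      where
      absurd : (∃ λ i → i < suc ℓ × ((pos β i <ᵇ p) ∧ (p ≤ᵇ pos α i)) ≡ true) → ⊥
      absurd (i , i<ℓ , eq) = ℕ.<⇒≱ (small i<ℓ) (ℕ.≤ᵇ⇒≤ _ _ (true→T (𝔹.∧-conicalʳ (pos β i <ᵇ p) _ eq)))

  sumℕ-map-allFin : ∀ {k} (f : Fin k → ℕ) → sumℕ (map f (allFin k)) ≡ total (tabulate f)
  sumℕ-map-allFin f = ≡.trans (≡.cong sumℕ (L.map-tabulate id f)) (go f)
    where
    go : ∀ {k} (f : Fin k → ℕ) → sumℕ (L.tabulate f) ≡ total (tabulate f)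
    go {zero}  f = ≡.refl
    go {suc k} f = ≡.cong (f zero +_) (go (f ∘ suc))

  total-cong : ∀ {k} {f g : Fin k → ℕ} → (∀ i → f i ≡ g i) → total (tabulate f) ≡ total (tabulate g)
  total-cong eq = ≡.cong total (V.tabulate-cong eq)

  ⊕-tabulate : ∀ {k} (f g : Fin k → ℕ) → tabulate f ⊕ tabulate g ≡ tabulate (λ a → f a + g a)
  ⊕-tabulate {zero}  f g = ≡.refl
  ⊕-tabulate {suc k} f g = ≡.cong (f zero + g zero ∷_) (⊕-tabulate (f ∘ suc) (g ∘ suc))

  total-+ : ∀ {k} (f g : Fin k → ℕ) → total (tabulate (λ a → f a + g a)) ≡ total (tabulate f) + total (tabulate g)
  total-+ f g = ≡.trans (≡.cong total (≡.sym (⊕-tabulate f g))) (total-⊕ (tabulate f) (tabulate g))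

  total-* : ∀ {k} c (f : Fin k → ℕ) → total (tabulate (λ a → c * f a)) ≡ c * total (tabulate f)
  total-* {zero}  c f = ≡.sym (ℕ.*-zeroʳ c)
  total-* {suc k} c f = ≡.trans (≡.cong (c * f zero +_) (total-* c (f ∘ suc))) (≡.sym (ℕ.*-distribˡ-+ c (f zero) _))

  pairs : ∀ {k} → (Fin k → Fin k → Bool) → ℕ
  pairs {k} G = total (tabulate {n = k} λ i → total (tabulate {n = k} λ j → b2n ((toℕ i <ᵇ toℕ j) ∧ G i j)))

  sumℕ-pairs : ∀ {k} (G : Fin k → Fin k → Bool) →
    sumℕ (map (λ i → sumℕ (map (λ j → b2n ((toℕ i <ᵇ toℕ j) ∧ G i j)) (allFin k))) (allFin k)) ≡ pairs G
  sumℕ-pairs {k} G = ≡.trans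
    (sumℕ-map-allFin (λ i → sumℕ (map (λ j → b2n ((toℕ i <ᵇ toℕ j) ∧ G i j)) (allFin k))))
    (total-cong λ i → sumℕ-map-allFin (λ j → b2n ((toℕ i <ᵇ toℕ j) ∧ G i j)))

  -- φ u v is the sum of u_i v_j over i < j; the two products correspond to the two alternatives in
  -- `good`.
  pairs-φ : ∀ {k} (G : Fin k → Fin k → Bool) (u v u′ v′ : Fin k → ℕ) →
    (∀ i j → b2n (G i j) ≡ u i * v j + u′ i * v′ j) →
    pairs G ≡ φ (tabulate u) (tabulate v) + φ (tabulate u′) (tabulate v′)
  pairs-φ {zero}  G u v u′ v′ eq = ≡.refl
  pairs-φ {suc k} G u v u′ v′ eq = ≡.trans
    (≡.cong₂ _+_ first (pairs-φ (λ i j → G (suc i) (suc j)) (u ∘ suc) (v ∘ suc) (u′ ∘ suc) (v′ ∘ suc)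
      (λ i j → eq (suc i) (suc j))))
    (ℕ-interchange (u zero * total (tabulate (v ∘ suc))) _ _ _)
    where
    first : total (tabulate (λ j → b2n (G zero (suc j))))
      ≡ u zero * total (tabulate (v ∘ suc)) + u′ zero * total (tabulate (v′ ∘ suc))
    first = ≡.trans (total-cong (λ j → eq zero (suc j)))
      (≡.trans (total-+ (λ j → u zero * v (suc j)) (λ j → u′ zero * v′ (suc j)))
        (≡.cong₂ _+_ (total-* (u zero) (v ∘ suc)) (total-* (u′ zero) (v′ ∘ suc))))

  Ψ-tab : ∀ {k} n (f : ℕ → Label k) (T : ℕ → Vec ℕ k) → (∀ p → T p ⊕ labN (f p) ≡ T (suc p)) →
    Ψ (T 0) (tab n f) ≡ ∑ℕ n (λ p → ψ (T p) (labN (f p)))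
  Ψ-tab zero    f T step = ≡.sym (∑ℕ-0 _)
  Ψ-tab (suc n) f T step = ≡.trans (≡.cong (ψ (T 0) (labN (f 0)) +_)
    (≡.trans (≡.cong (λ u → Ψ u (tab n (f ∘ suc))) (step 0)) (Ψ-tab n (f ∘ suc) (T ∘ suc) (step ∘ suc))))
    (≡.sym (∑ℕ-suc n _))

  φ-zerosˡ : ∀ {k} (u : Vec ℕ k) → φ zeros u ≡ 0
  φ-zerosˡ []      = ≡.refl
  φ-zerosˡ (a ∷ u) = φ-zerosˡ u

  tabulate-zeros : ∀ {k} {f : Fin k → ℕ} → (∀ a → f a ≡ 0) → tabulate f ≡ zeros
  tabulate-zeros {zero}  eq = ≡.refl
  tabulate-zeros {suc k} eq = ≡.cong₂ _∷_ (eq zero) (tabulate-zeros (eq ∘ suc))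

  module _ {k ℓ} (α β : Tuple k (suc ℓ))
    (shift : ∀ a {i} → i < ℓ → suc (pos (α a) (suc i)) ≡ pos (β a) i)
    (last : ∀ a → pos (β a) ℓ ≡ 0)
    (grow : ∀ a i → pos (β a) i ≤ pos (α a) i)
    (small : ∀ a {i} → i < suc ℓ → pos (α a) i < suc ℓ + suc ℓ)
    where
    open ≡.≡-Reasoning

    private
      module S a = OneStep (α a) (β a) (shift a) (last a) (grow a)

      n = suc ℓ + suc ℓ

      T B h : ℕ → Vec ℕ k
      T p = tabulate (λ a → below (α a) p)
      B p = tabulate (λ a → below (β a) p)
      h p = tabulate (λ a → b2n (S.left a p))

      someV noneV : ℕ → Vec ℕ k
      someV p = tabulate (λ a → b2n (someE α β a p))
      noneV p = tabulate (λ a → b2n (not (someE α β a p)))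

      labN-column : ∀ (ρs : Tuple k (suc ℓ)) p → labN (column ρs p) ≡ tabulate (λ a → b2n (occupied (ρs a) p))
      labN-column ρs p = ≡.sym (V.tabulate-∘ b2n (λ a → occupied (ρs a) p))

      right-h : ∀ p → tabulate (λ a → b2n (S.right a p)) ≡ h (suc p)
      right-h p = V.tabulate-cong (λ a → ≡.cong b2n (S.right-left a p))

      T-suc : ∀ p → T p ⊕ labN (column α p) ≡ T (suc p)
      T-suc p = ≡.trans (≡.cong (T p ⊕_) (labN-column α p)) (≡.trans (⊕-tabulate _ _)
        (V.tabulate-cong λ a → ≡.trans (≡.cong (below (α a) p +_) (S.b2n-top a p)) (below-suc (α a) p)))

      B-suc : ∀ p → B p ⊕ labN (column β p) ≡ B (suc p)
      B-suc p = ≡.trans (≡.cong (B p ⊕_) (labN-column β p)) (≡.trans (⊕-tabulate _ _)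
        (V.tabulate-cong λ a → ≡.trans (≡.cong (below (β a) p +_) (S.b2n-bottom a p)) (below-suc (β a) p)))

      T⊕h : ∀ p → T p ⊕ h p ≡ B p
      T⊕h p = ≡.trans (⊕-tabulate _ _) (V.tabulate-cong λ a → S.left-below a p)

      some : ∀ p → labN (column β p) ⊕ h p ≡ someV p
      some p = ≡.trans (≡.cong (_⊕ h p) (labN-column β p))
        (≡.trans (⊕-tabulate _ _) (V.tabulate-cong λ a → S.edges a p))

      conserve : ∀ p → labN (column β p) ⊕ h p ≡ labN (column α p) ⊕ h (suc p)
      conserve p = begin
        labN (column β p) ⊕ h p
          ≡⟨ ≡.cong (_⊕ h p) (labN-column β p) ⟩
        _ ≡⟨ ⊕-tabulate _ _ ⟩
        _ ≡⟨ V.tabulate-cong (λ a → S.conserve a p) ⟩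
        _ ≡⟨ ⊕-tabulate _ _ ⟨
        tabulate (λ a → b2n (occupied (α a) p)) ⊕ tabulate (λ a → b2n (S.right a p))
          ≡⟨ ≡.cong₂ _⊕_ (≡.sym (labN-column α p)) (right-h p) ⟩
        labN (column α p) ⊕ h (suc p) ∎

      complement : ∀ p → noneV p ⊕ (labN (column β p) ⊕ h p) ≡ ones
      complement p = ≡.trans (≡.cong (noneV p ⊕_) (some p)) (≡.trans (⊕-tabulate _ _)
        (≡.trans (V.tabulate-cong λ a → not+ (someE α β a p)) (tabulate-ones k)))
        where
        not+ : ∀ b → b2n (not b) + b2n b ≡ 1
        not+ true  = ≡.refl
        not+ false = ≡.refl
        tabulate-ones : ∀ k → tabulate {n = k} (λ _ → 1) ≡ ones
        tabulate-ones zero    = ≡.refl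
        tabulate-ones (suc k) = ≡.cong (1 ∷_) (tabulate-ones k)

      -- The right edges of column p are the left edges of column p + 1, so these are the two
      -- exponents in `white-balance`, with `noneV p` as the absent colours.
      goodPairs : ℕ → ℕ
      goodPairs p = φ (h (suc p)) (labN (column β p) ⊕ h p) + φ (noneV p) (h p)

      pairs-good : ∀ p → pairs (good α β p) ≡ goodPairs p
      pairs-good p = ≡.trans
        (pairs-φ (good α β p) (λ a → b2n (S.right a p)) (λ a → b2n (someE α β a p))
          (λ a → b2n (not (someE α β a p))) (λ a → b2n (S.left a p))
          (λ i j → split-good (botE α β i p) (topE α β i p) (leftE α β i p) (rightE α β i p) (someE α β j p) (leftE α β j p)))
        (≡.cong (_+ φ (noneV p) (h p)) (≡.cong₂ φ (right-h p) (≡.sym (some p))))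
        where
        split-good : ∀ b t l r s l′ → b2n ((r ∧ s) ∨ (not (b ∨ t ∨ l ∨ r) ∧ l′))
          ≡ b2n r * b2n s + b2n (not (b ∨ t ∨ l ∨ r)) * b2n l′
        -- A colour on the right edge is present, which excludes the second alternative; the
        -- disjunction is therefore a sum.
        split-good b t l true s l′ rewrite 𝔹.∨-zeroʳ l | 𝔹.∨-zeroʳ t | 𝔹.∨-zeroʳ b | 𝔹.∨-identityʳ s =
          ≡.sym (≡.trans (ℕ.+-identityʳ _) (ℕ.+-identityʳ _))
        split-good b t l false s l′ with b ∨ t ∨ l ∨ false
        ... | true  = ≡.refl
        ... | false = ≡.sym (ℕ.+-identityʳ _)

      balance : ∀ p → (goodPairs p + ψ (T p) (labN (column α p))) + φ (T (suc p)) (h (suc p))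
        ≡ ψ (B p) (labN (column β p)) + φ (T p) (h p)
      balance p = begin
        (goodPairs p + ψ (T p) t) + φ (T (suc p)) (h (suc p))
          ≡⟨ ≡.cong (λ u → (goodPairs p + ψ (T p) t) + φ u (h (suc p))) (T-suc p) ⟨
        (goodPairs p + ψ (T p) t) + φ (T p ⊕ t) (h (suc p))
          ≡⟨ ℕS.solve 4 (λ a b c d → ((a ℕS.:+ b) ℕS.:+ c) ℕS.:+ d ℕS.:= (a ℕS.:+ (c ℕS.:+ d)) ℕS.:+ b) ≡.refl
               (φ (h (suc p)) (labN (column β p) ⊕ h p)) (φ (noneV p) (h p)) (ψ (T p) t) (φ (T p ⊕ t) (h (suc p))) ⟩
        (φ (h (suc p)) (labN (column β p) ⊕ h p) + (ψ (T p) t + φ (T p ⊕ t) (h (suc p)))) + φ (noneV p) (h p)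
          ≡⟨ white-balance (T p) (labN (column β p)) (h p) t (h (suc p)) (noneV p) (conserve p) (complement p) ⟩
        ψ (T p ⊕ h p) (labN (column β p)) + φ (T p) (h p)
          ≡⟨ ≡.cong (λ u → ψ u (labN (column β p)) + φ (T p) (h p)) (T⊕h p) ⟩
        ψ (B p) (labN (column β p)) + φ (T p) (h p) ∎
        where
        t = labN (column α p)

      h-end : ∀ p → n ≤ p → h p ≡ zeros
      h-end p n≤p = tabulate-zeros λ a → ≡.cong b2n (S.left-end a p λ i<ℓ → ℕ.<-≤-trans (small a i<ℓ) n≤p)

      -- `gTilde` runs over n + 1 boxes, one more than there are columns in the configurations. All
      -- particles of α lie in the first n columns, so the extra box has no horizontal path.
      goodPairs-end : goodPairs n ≡ 0
      goodPairs-end rewrite h-end n ℕ.≤-refl | h-end (suc n) (ℕ.n≤1+n n) | φ-zerosʳ (noneV n) =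
        ≡.trans (ℕ.+-identityʳ _) (φ-zerosˡ (labN (column β n) ⊕ zeros))

      T-zero : T 0 ≡ zeros
      T-zero = tabulate-zeros λ a → below-zero (α a)

      B-zero : B 0 ≡ zeros
      B-zero = tabulate-zeros λ a → below-zero (β a)

    gTilde-pairs : gTilde α β ≡ ∑ℕ (suc n) (λ p → pairs (good α β p))
    gTilde-pairs = ≡.trans
      (≡.sym (∑ℕ-sumℕ (suc n) (λ p → sumℕ (map (λ i → sumℕ (map (λ j →
        b2n ((toℕ i <ᵇ toℕ j) ∧ good α β p i j)) (allFin k))) (allFin k)))))
      (∑ℕ-cong (suc n) λ {p} _ → sumℕ-pairs (good α β p))

    -- `white-balance` is summed over the boxes. The flux vanishes on the left, where no particle
    -- precedes column 0, and on the right, where every path has ended.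
    gTilde-Ψ : gTilde α β + Ψ zeros (config n α) ≡ Ψ zeros (config n β)
    gTilde-Ψ = begin
      gTilde α β + Ψ zeros (config n α)
        ≡⟨ ≡.cong₂ _+_ (≡.trans gTilde-pairs (≡.trans (∑ℕ-cong (suc n) λ {p} _ → pairs-good p) (∑ℕ-snoc n goodPairs)))
             (≡.trans (≡.cong (λ u → Ψ u (config n α)) (≡.sym T-zero)) (Ψ-tab n (column α) T T-suc)) ⟩
      ∑ℕ n goodPairs + goodPairs n + ∑ℕ n (λ p → ψ (T p) (labN (column α p)))
        ≡⟨ ≡.cong (λ z → ∑ℕ n goodPairs + z + ∑ℕ n (λ p → ψ (T p) (labN (column α p)))) goodPairs-end ⟩
      ∑ℕ n goodPairs + 0 + ∑ℕ n (λ p → ψ (T p) (labN (column α p)))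
        ≡⟨ ≡.cong (_+ ∑ℕ n (λ p → ψ (T p) (labN (column α p)))) (ℕ.+-identityʳ _) ⟩
      ∑ℕ n goodPairs + ∑ℕ n (λ p → ψ (T p) (labN (column α p)))
        ≡⟨ ∑ℕ-+ n _ _ ⟨
      ∑ℕ n (λ p → goodPairs p + ψ (T p) (labN (column α p)))
        ≡⟨ ℕ.+-identityʳ _ ⟨
      ∑ℕ n (λ p → goodPairs p + ψ (T p) (labN (column α p))) + 0
        ≡⟨ ≡.cong (∑ℕ n (λ p → goodPairs p + ψ (T p) (labN (column α p))) +_)
             (≡.sym (≡.trans (≡.cong (φ (T n)) (h-end n ℕ.≤-refl)) (φ-zerosʳ (T n)))) ⟩
      ∑ℕ n (λ p → goodPairs p + ψ (T p) (labN (column α p))) + φ (T n) (h n)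
        ≡⟨ ∑ℕ-balance n _ _ (λ p → φ (T p) (h p)) balance ⟩
      ∑ℕ n (λ p → ψ (B p) (labN (column β p))) + φ (T 0) (h 0)
        ≡⟨ ≡.cong (∑ℕ n (λ p → ψ (B p) (labN (column β p))) +_)
             (≡.trans (≡.cong (λ u → φ u (h 0)) T-zero) (φ-zerosˡ (h 0))) ⟩
      ∑ℕ n (λ p → ψ (B p) (labN (column β p))) + 0
        ≡⟨ ℕ.+-identityʳ _ ⟩
      ∑ℕ n (λ p → ψ (B p) (labN (column β p)))
        ≡⟨ Ψ-tab n (column β) B B-suc ⟨
      Ψ (B 0) (config n β)
        ≡⟨ ≡.cong (λ u → Ψ u (config n β)) B-zero ⟩
      Ψ zeros (config n β) ∎

  module _ {ℓ} (ρ : Vec ℕ (suc ℓ)) (isP : IsPartition ρ) (ρ₀≤ℓ : nth ρ 0 ≤ suc ℓ) where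

    private
      tail : ℕ → Vec ℕ (suc ℓ)
      tail r = betaR {1} (λ _ → ρ) r zero

    nth-tail : ∀ r {i} → i < suc ℓ → nth (tail r) i ≡ (if i <ᵇ r then nth ρ (suc ℓ ∸ r + i) else 0)
    nth-tail r = nth-tabulate-ℕ (λ i → if i <ᵇ r then nth ρ (suc ℓ ∸ r + i) else 0)

    nth-≤ : ∀ i → nth ρ i ≤ suc ℓ
    nth-≤ i = ℕ.≤-trans (nth-antitone {ρ = ρ} isP z≤n) ρ₀≤ℓ

    nth-tail-≤ : ∀ r i → nth (tail r) i ≤ suc ℓ
    nth-tail-≤ r i with i <? suc ℓ
    ... | no i≮ℓ = ≡.subst (_≤ suc ℓ) (≡.sym (nth-beyond (tail r) (ℕ.≮⇒≥ i≮ℓ))) z≤n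
    ... | yes i<ℓ rewrite nth-tail r i<ℓ with i <ᵇ r
    ...   | true  = nth-≤ (suc ℓ ∸ r + i)
    ...   | false = z≤n

    -- β^(r+1) arises from β^r by putting one part in front. Each old part keeps its size, its index
    -- grows by one, and so its column drops by one.
    tail-shift : ∀ {r} → r < suc ℓ → ∀ {i} → i < ℓ → suc (pos (tail (suc r)) (suc i)) ≡ pos (tail r) i
    tail-shift {r} r<ℓ {i} i<ℓ = begin
      suc (nth (tail (suc r)) (suc i) + (ℓ ∸ suc i))  ≡⟨ ℕ.+-suc _ _ ⟨
      nth (tail (suc r)) (suc i) + suc (ℓ ∸ suc i)    ≡⟨ ≡.cong₂ _+_ nth-shift (≡.sym (ℕ.+-∸-assoc 1 i<ℓ)) ⟩
      nth (tail r) i + (ℓ ∸ i)                        ∎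
      where
      open ≡.≡-Reasoning
      index : suc ℓ ∸ suc r + suc i ≡ suc ℓ ∸ r + i
      index = ≡.trans (ℕ.+-suc (ℓ ∸ r) i) (≡.cong (_+ i) (≡.sym (ℕ.+-∸-assoc 1 (ℕ.≤-pred r<ℓ))))
      nth-shift : nth (tail (suc r)) (suc i) ≡ nth (tail r) i
      nth-shift = ≡.trans (nth-tail (suc r) (s≤s i<ℓ))
        (≡.trans (≡.cong (λ j → if i <ᵇ r then nth ρ j else 0) index) (≡.sym (nth-tail r (ℕ.m≤n⇒m≤1+n i<ℓ))))

    tail-last : ∀ {r} → r < suc ℓ → pos (tail r) ℓ ≡ 0
    tail-last {r} (s≤s r≤ℓ) = ≡.cong₂ _+_ (≡.trans (nth-tail r ℕ.≤-refl)
      (≡.cong (λ b → if b then nth ρ (suc ℓ ∸ r + ℓ) else 0) (𝔹.¬-not λ ℓ<r →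
        ℕ.<⇒≱ (ℕ.<ᵇ⇒< ℓ r (true→T ℓ<r)) r≤ℓ))) (ℕ.n∸n≡0 ℓ)

    tail-grow : ∀ r i → pos (tail r) i ≤ pos (tail (suc r)) i
    tail-grow r i = ℕ.+-monoˡ-≤ (suc ℓ ∸ suc i) nth-grow
      where
      nth-grow : nth (tail r) i ≤ nth (tail (suc r)) i
      nth-grow with i <? suc ℓ
      ... | no i≮ℓ = ≡.subst (_≤ nth (tail (suc r)) i) (≡.sym (nth-beyond (tail r) (ℕ.≮⇒≥ i≮ℓ))) z≤n
      ... | yes i<ℓ rewrite nth-tail r i<ℓ | nth-tail (suc r) i<ℓ with i <ᵇ r in i<r
      ...   | false = z≤n
      ...   | true rewrite T→true (ℕ.<⇒<ᵇ (ℕ.m≤n⇒m≤1+n (ℕ.<ᵇ⇒< i r (true→T i<r)))) =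
        nth-antitone {ρ = ρ} isP (ℕ.+-monoˡ-≤ i (ℕ.∸-monoʳ-≤ (suc ℓ) (ℕ.n≤1+n r)))

    tail-all : ∀ {i} → i < suc ℓ → nth (tail (suc ℓ)) i ≡ nth ρ i
    tail-all {i} i<ℓ = ≡.trans (nth-tail (suc ℓ) i<ℓ) (≡.trans
      (≡.cong (λ b → if b then nth ρ (suc ℓ ∸ suc ℓ + i) else 0) (T→true (ℕ.<⇒<ᵇ i<ℓ)))
      (≡.cong (λ z → nth ρ (z + i)) (ℕ.n∸n≡0 ℓ)))

  -- The chain telescopes. Its start `betaR ρs 0` has all parts zero, so the right-hand side is the
  -- same for every tuple.
  gStat-Ψ : ∀ {k ℓ} (ρs : Tuple k ℓ) → (∀ a → IsPartition (ρs a)) → (∀ a → nth (ρs a) 0 ≤ ℓ) →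
    gStat ρs + Ψ zeros (config (ℓ + ℓ) ρs) ≡ Ψ zeros (config (ℓ + ℓ) (betaR {k} {ℓ} ρs 0))
  gStat-Ψ {k} {zero}  ρs isP small = ≡.refl
  gStat-Ψ {k} {suc ℓ} ρs isP small = begin
    gStat ρs + Ψ zeros (config n ρs)
      ≡⟨ ≡.cong₂ _+_ (≡.sym (∑ℕ-sumℕ (suc ℓ) _)) (≡.cong (Ψ zeros) whole) ⟩
    ∑ℕ (suc ℓ) (λ r → gTilde (betaR ρs (suc r)) (betaR ρs r)) + Ψ zeros (config n (betaR ρs (suc ℓ)))
      ≡⟨ ∑ℕ-telescope (suc ℓ) _ (λ r → Ψ zeros (config n (betaR ρs r))) (λ {r} r<ℓ →
           gTilde-Ψ (betaR ρs (suc r)) (betaR ρs r)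
             (λ a → tail-shift (ρs a) (isP a) (small a) r<ℓ)
             (λ a → tail-last (ρs a) (isP a) (small a) r<ℓ)
             (λ a → tail-grow (ρs a) (isP a) (small a) r)
             (λ a → pos-< (betaR ρs (suc r) a) (nth-tail-≤ (ρs a) (isP a) (small a) (suc r)))) ⟩
    Ψ zeros (config n (betaR ρs 0)) ∎
    where
    open ≡.≡-Reasoning
    n = suc ℓ + suc ℓ
    whole : config n ρs ≡ config n (betaR ρs (suc ℓ))
    whole = V.tabulate-cong λ p → V.tabulate-cong λ a → anyUpTo-cong (suc ℓ) λ {i} i<ℓ →
      ≡.cong (λ z → (z + (suc ℓ ∸ suc i)) ≡ᵇ toℕ p) (≡.sym (tail-all (ρs a) (isP a) (small a) i<ℓ))

open Partitions

-- Assembly of trimming, duality and commutation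

module Duality {c ℓr} (R : CommutativeRing c ℓr) where
  open CommutativeRing R
  open import Relation.Binary.Reasoning.Setoid setoid
  open Sums R
  open Vertex R
  open Rows R
  open RowDuality R
  open Stacks R
  open RingSolver commutativeSemiring

  white-conservative : ∀ {k} τ x → Conservative (whiteW R {k} τ x)
  white-conservative {k} τ x = record
    { support = λ I J K L → Sum.map₂ (allColours-conserve whiteOK-conserve I J K L) (whiteW-support τ x I J K L)
    ; vacuum  = vacuum k
    }
    where
    vacuum : ∀ k → whiteW R {k} τ x emptyLabel emptyLabel emptyLabel emptyLabel ≈ 1#
    vacuum ℕ.zero  = *-identityˡ _
    vacuum (suc k) = vacuum k

  purple-conservative : ∀ {k} τ x → Conservative (purpleW R {k} τ x)
  purple-conservative {k} τ x = record
    { support = λ I J K L → Sum.map₂ (allColours-conserve purpleOK-conserve I J K L) (purpleW-support τ x I J K L)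
    ; vacuum  = vacuum k
    }
    where
    vacuum : ∀ k → purpleW R {k} τ x emptyLabel emptyLabel emptyLabel emptyLabel ≈ 1#
    vacuum ℕ.zero  = *-identityˡ _
    vacuum (suc k) = vacuum k

  module _ {k : ℕ} where

    white-purple-stack purple-white-stack : Carrier → List Carrier → List Carrier → List (VertexWeight R k)
    white-purple-stack τ xs ys = map (whiteW R τ) xs ++ map (purpleW R τ) ys
    purple-white-stack τ xs ys = map (purpleW R τ) xs ++ map (whiteW R τ) ys

    stacks-commute : ∀ τ xs ys → white-purple-stack τ ys xs ≋ purple-white-stack τ xs ys
    stacks-commute τ xs ys = ≋-++-comm (whites ys)
      where
      purples : ∀ y xs → All (Commute (whiteW R {k} τ y)) (map (purpleW R τ) xs)
      purples y []       = []
      purples y (x ∷ xs) = white-purple-commute τ y x ∷ purples y xs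
      whites : ∀ ys → All (λ w → All (Commute w) (map (purpleW R {k} τ) xs)) (map (whiteW R τ) ys)
      whites []       = []
      whites (y ∷ ys) = purples y xs ∷ whites ys

    stacks-dual : ∀ τ τ⁻¹ → τ * τ⁻¹ ≈ 1# → ∀ xs ys →
      Pointwise (RowDual τ) (white-purple-stack τ xs ys) (purple-white-stack τ⁻¹ xs ys)
    stacks-dual τ τ⁻¹ inv (x ∷ xs) ys       = white-row-dual τ τ⁻¹ inv x ∷ stacks-dual τ τ⁻¹ inv xs ys
    stacks-dual τ τ⁻¹ inv []       (y ∷ ys) = purple-row-dual τ τ⁻¹ inv y ∷ stacks-dual τ τ⁻¹ inv [] ys
    stacks-dual τ τ⁻¹ inv []       []       = []

    stacks-conservative : ∀ τ xs ys → All Conservative (white-purple-stack τ xs ys)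
    stacks-conservative τ xs ys = All.++⁺
      (All.map⁺ (All.universal (white-conservative τ) xs)) (All.map⁺ (All.universal (purple-conservative τ) ys))

  eqConfig-refl : ∀ {k n} (s : Vec (Label k) n) → eqConfig s s ≡ true
  eqConfig-refl V.[]       = ≡.refl
  eqConfig-refl (a V.∷ s) rewrite eqVecB-refl a = eqConfig-refl s

  -- Parts of size at most ℓ keep all particles in the first 2ℓ columns; the remaining N - ℓ + 1 are
  -- empty at top and bottom and are cut off.
  LS-trim : ∀ {k ℓ n m N} → ℓ ≤ N → (λs μs : Tuple k ℓ) →
    (∀ a i → nth (λs a) i ≤ ℓ) → (∀ a i → nth (μs a) i ≤ ℓ) →
    (xs : Vec Carrier n) (ys : Vec Carrier m) (τ : Carrier) →
    LS R N λs μs xs ys τ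
    ≈ stackWeight R (white-purple-stack τ (toList xs) (toList ys)) (config (ℓ ℕ.+ ℓ) μs) (config (ℓ ℕ.+ ℓ) λs)
  LS-trim {k} {ℓ} {N = N} ℓ≤N λs μs smallλ smallμ xs ys τ = begin
    stackWeight R ws (config (suc (N ℕ.+ ℓ)) μs) (config (suc (N ℕ.+ ℓ)) λs)
      ≡⟨ ≡.cong (λ W → stackWeight R ws (config W μs) (config W λs)) width ⟩
    stackWeight R ws (config (ℓ ℕ.+ ℓ ℕ.+ e) μs) (config (ℓ ℕ.+ ℓ ℕ.+ e) λs)
      ≡⟨ ≡.cong₂ (stackWeight R ws) (config-++ μs smallμ e) (config-++ λs smallλ e) ⟩
    stackWeight R ws (config (ℓ ℕ.+ ℓ) μs V.++ empties e) (config (ℓ ℕ.+ ℓ) λs V.++ empties e)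
      ≈⟨ stack-trim (stacks-conservative τ (toList xs) (toList ys)) _ _ (empties e) ⟩
    stackWeight R ws (config (ℓ ℕ.+ ℓ) μs) (config (ℓ ℕ.+ ℓ) λs) * [ eqConfig (empties {k} e) (empties e) ]
      ≡⟨ ≡.cong (λ b → stackWeight R ws (config (ℓ ℕ.+ ℓ) μs) (config (ℓ ℕ.+ ℓ) λs) * [ b ])
           (eqConfig-refl (empties {k} e)) ⟩
    stackWeight R ws (config (ℓ ℕ.+ ℓ) μs) (config (ℓ ℕ.+ ℓ) λs) * 1#
      ≈⟨ *-identityʳ _ ⟩
    stackWeight R ws (config (ℓ ℕ.+ ℓ) μs) (config (ℓ ℕ.+ ℓ) λs) ∎
    where
    ws = white-purple-stack τ (toList xs) (toList ys)
    e = suc (N ℕ.∸ ℓ)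
    width : suc (N ℕ.+ ℓ) ≡ ℓ ℕ.+ ℓ ℕ.+ e
    width = ≡.trans (≡.cong (λ z → suc (z ℕ.+ ℓ)) (≡.sym (ℕ.m+[n∸m]≡n ℓ≤N)))
      (ℕS.solve 2 (λ l d → ℕS.con 1 ℕS.:+ (l ℕS.:+ d ℕS.:+ l) ℕS.:= l ℕS.:+ l ℕS.:+ (ℕS.con 1 ℕS.:+ d))
        ≡.refl ℓ (N ℕ.∸ ℓ))

-- The bounds on `nth (λs a) 0` and `nth (μs a) 0` say that the conjugates have at most ℓ nonzero
-- parts, and `ℓ ≤ N` makes the lattice wide enough. The variables take values in an arbitrary
-- commutative ring in which t has an inverse.
theorem4p3 : ∀ {c ℓr : Level} (R : CommutativeRing c ℓr) →
    let open CommutativeRing R in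
    (k ℓ N : ℕ) → 1 ≤ k → ℓ ≤ N →
    (λs μs : Tuple k ℓ) →
    (∀ a → IsPartition (λs a)) → (∀ a → IsPartition (μs a)) →
    (∀ a → nth (λs a) 0 ≤ ℓ) → (∀ a → nth (μs a) 0 ≤ ℓ) →
    (n m : ℕ) (xs : Vec Carrier n) (ys : Vec Carrier m) (t t⁻¹ : Carrier) →
    t * t⁻¹ ≈ 1# →
    LS R N λs μs xs ys t
    ≈ (pow R t (gStat λs) * pow R t⁻¹ (gStat μs))
    * LS R N (conjT λs) (conjT μs) ys xs t⁻¹
theorem4p3 R k ℓ N _ ℓ≤N λs μs isPλ isPμ smallλ smallμ n m xs ys t t⁻¹ tt⁻¹ = begin
  LS R N λs μs xs ys t
    ≈⟨ LS-trim ℓ≤N λs μs (nth≤ λs isPλ smallλ) (nth≤ μs isPμ smallμ) xs ys t ⟩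
  Z
    ≈⟨ *-identityˡ _ ⟨
  1# * Z
    -- D is the potential of the empty tuple, common to λ and μ. Writing it as g(λ) + Ψ(λ) in one
    -- factor and as g(μ) + Ψ(μ) in the other introduces both statistics without subtraction.
    ≈⟨ *-congʳ (pow-inverse tt⁻¹ D) ⟨
  (t^ D * t⁻^ D) * Z
    ≡⟨ ≡.cong₂ (λ p q → (t^ p * t⁻^ q) * Z) (gStat-Ψ λs isPλ smallλ) (gStat-Ψ μs isPμ smallμ) ⟨
  (t^ (gStat λs ℕ.+ Ψλ) * t⁻^ (gStat μs ℕ.+ Ψμ)) * Z
    ≈⟨ *-congʳ (*-cong (pow-+ t (gStat λs) Ψλ) (pow-+ t⁻¹ (gStat μs) Ψμ)) ⟩
  ((t^ (gStat λs) * t^ Ψλ) * (t⁻^ (gStat μs) * t⁻^ Ψμ)) * Z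
    ≈⟨ solve 5 (λ a b c d z → ((a :* b) :* (c :* d)) :* z := ((a :* c) :* d) :* (b :* z)) refl _ _ _ _ _ ⟩
  ((t^ (gStat λs) * t⁻^ (gStat μs)) * t⁻^ Ψμ) * (t^ Ψλ * Z)
    -- Duality consumes t^Ψ(λ) and returns t^Ψ(μ), which cancels against the remaining power of
    -- `t⁻¹`.
    ≈⟨ *-congˡ (stack-dual t (stacks-dual t t⁻¹ tt⁻¹ (toList xs) (toList ys)) bμ bλ) ⟩
  ((t^ (gStat λs) * t⁻^ (gStat μs)) * t⁻^ Ψμ) * (t^ Ψμ * Z*)
    ≈⟨ solve 4 (λ a b c z → (a :* b) :* (c :* z) := a :* ((c :* b) :* z)) refl _ _ _ _ ⟩
  (t^ (gStat λs) * t⁻^ (gStat μs)) * ((t^ Ψμ * t⁻^ Ψμ) * Z*)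
    ≈⟨ *-congˡ (trans (*-congʳ (pow-inverse tt⁻¹ Ψμ)) (*-identityˡ _)) ⟩
  (t^ (gStat λs) * t⁻^ (gStat μs)) * Z*
    ≈⟨ *-congˡ (stacks-commute t⁻¹ (toList xs) (toList ys) (dual bμ) (dual bλ)) ⟨
  (t^ (gStat λs) * t⁻^ (gStat μs)) * stackWeight R (white-purple-stack t⁻¹ (toList ys) (toList xs)) (dual bμ) (dual bλ)
    ≡⟨ ≡.cong₂ (λ bot top → (t^ (gStat λs) * t⁻^ (gStat μs))
         * stackWeight R (white-purple-stack t⁻¹ (toList ys) (toList xs)) bot top)
         (config-conjT μs isPμ smallμ) (config-conjT λs isPλ smallλ) ⟨
  (t^ (gStat λs) * t⁻^ (gStat μs)) * stackWeight R (white-purple-stack t⁻¹ (toList ys) (toList xs))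
    (config (ℓ ℕ.+ ℓ) (conjT μs)) (config (ℓ ℕ.+ ℓ) (conjT λs))
    ≈⟨ *-congˡ (LS-trim ℓ≤N (conjT λs) (conjT μs) (λ a → conjP-small (λs (opposite a)))
         (λ a → conjP-small (μs (opposite a))) ys xs t⁻¹) ⟨
  (t^ (gStat λs) * t⁻^ (gStat μs)) * LS R N (conjT λs) (conjT μs) ys xs t⁻¹ ∎
  where
  open CommutativeRing R
  open import Relation.Binary.Reasoning.Setoid setoid
  open Sums R
  open Stacks R
  open Duality R
  open RingSolver commutativeSemiring
  nth≤ : ∀ (ρs : Tuple k ℓ) → (∀ a → IsPartition (ρs a)) → (∀ a → nth (ρs a) 0 ≤ ℓ) → ∀ a i → nth (ρs a) i ≤ ℓ
  nth≤ ρs isP small a i = ℕ.≤-trans (nth-antitone {ρ = ρs a} (isP a) ℕ.z≤n) (small a)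
  bλ bμ : Vec (Label k) (ℓ ℕ.+ ℓ)
  bλ = config (ℓ ℕ.+ ℓ) λs
  bμ = config (ℓ ℕ.+ ℓ) μs
  Z = stackWeight R (white-purple-stack t (toList xs) (toList ys)) bμ bλ
  Z* = stackWeight R (purple-white-stack t⁻¹ (toList xs) (toList ys)) (dual bμ) (dual bλ)
  t^ t⁻^ : ℕ → Carrier
  t^  = pow R t
  t⁻^ = pow R t⁻¹
  Ψλ Ψμ D : ℕ
  Ψλ = Ψ zeros bλ
  Ψμ = Ψ zeros bμ
  D  = Ψ zeros (config (ℓ ℕ.+ ℓ) (betaR λs 0))
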